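{- For every integer $n\geq 3$, $$cr(K_{n}\times C_4)\leq 16\left\lfloor\frac{n}{2}\right\rfloor\left\lfloor\frac{n-1}{2}\right\rfloor\left\lfloor\frac{n-2}{2}\right\rfloor\left\lfloor\frac{n-3}{2}\right\rfloor+n(n-1)(2n-5).$$
   Context: The crossing number $cr(G)$ of a graph $G$ is the smallest number of pairwise crossings of edges among all drawings of $G$ in the plane. The Kronecker product $G\times H$ of graphs $G$ and $H$ has vertex set $V(G)\times V(H)$ and edge set $\{\{(a,x),(b,y)\} : \{a,b\}\in E(G),\ \{x,y\}\in E(H)\}$. $K_n$ is the complete graph on $n$ vertices and $C_4$ is the cycle on $4$ vertices. Thus $K_n\times C_4$ has vertices $0i,1i,2i,3i$ ($0\leq i\leq n-1$) and edges $(0i,1j),(1i,2j),(2i,3j),(3i,0j)$ for $0\leq i\neq j\leq n-1$. -}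

module Defs where

open import Data.Nat as ℕ using (ℕ; suc; _%_)
open import Data.Fin using (Fin; zero; suc; toℕ)
open import Data.Rational as ℚ using (ℚ; 0ℚ; 1ℚ)
open import Data.Rational.Properties as ℚₚ using ()
open import Data.Product using (Σ; ∃; ∃-syntax; _×_; _,_; proj₁; proj₂)
open import Data.Sum using (_⊎_; inj₁; inj₂; swap)
open import Relation.Nullary using (¬_)
open import Relation.Binary.PropositionalEquality using (_≡_; _≢_; refl; sym; subst)

-- The real plane

-- Cauchy sequences of rationals; two of them denote the same real when _≃_ holds.
record ℝ : Set where
  field
    seq    : ℕ → ℚ
    cauchy : ∀ ε → 0ℚ ℚ.< ε →
             ∃[ N ] (∀ m n → N ℕ.≤ m → N ℕ.≤ n → ℚ.∣ seq m ℚ.- seq n ∣ ℚ.≤ ε)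

open ℝ public

fromℚ : ℚ → ℝ
fromℚ q .seq _ = q
fromℚ q .cauchy ε 0<ε = 0 , λ _ _ _ _ →
  subst (λ r → ℚ.∣ r ∣ ℚ.≤ ε) (sym (ℚₚ.+-inverseʳ q)) (ℚₚ.<⇒≤ 0<ε)

0ℝ 1ℝ : ℝ
0ℝ = fromℚ 0ℚ
1ℝ = fromℚ 1ℚ

-- Implied by |x - y| < ε and implies |x - y| ≤ ε, hence interchangeable with
-- either when ε ranges over all positive rationals.
_≈[_]_ : ℝ → ℚ → ℝ → Set
x ≈[ ε ] y = ∃[ N ] (∀ n → N ℕ.≤ n → ℚ.∣ seq x n ℚ.- seq y n ∣ ℚ.≤ ε)

infix 4 _≃_ _≤ℝ_ _≈[_]_ _≈²[_]_ _≃²_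

_≃_ : ℝ → ℝ → Set
x ≃ y = ∀ ε → 0ℚ ℚ.< ε → x ≈[ ε ] y

_≤ℝ_ : ℝ → ℝ → Set
x ≤ℝ y = ∀ ε → 0ℚ ℚ.< ε → ∃[ N ] (∀ n → N ℕ.≤ n → seq x n ℚ.≤ seq y n ℚ.+ ε)

ℝ² : Set
ℝ² = ℝ × ℝ

_≈²[_]_ : ℝ² → ℚ → ℝ² → Set
(x , y) ≈²[ ε ] (x′ , y′) = (x ≈[ ε ] x′) × (y ≈[ ε ] y′)

_≃²_ : ℝ² → ℝ² → Set
(x , y) ≃² (x′ , y′) = (x ≃ x′) × (y ≃ y′)

record UnitInterval : Set where
  constructor unit
  field
    value : ℝ
    lower : 0ℝ ≤ℝ value
    upper : value ≤ℝ 1ℝ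

open UnitInterval public

-- Continuity makes `at` respect _≃_, so no separate congruence field is needed.
record Arc (p q : ℝ²) : Set where
  field
    at         : UnitInterval → ℝ²
    continuous : ∀ s ε → 0ℚ ℚ.< ε → ∃[ δ ] (0ℚ ℚ.< δ ×
                   (∀ t → value s ≈[ δ ] value t → at s ≈²[ ε ] at t))
    injective  : ∀ s t → at s ≃² at t → value s ≃ value t
    start      : ∀ s → value s ≃ 0ℝ → at s ≃² p
    end        : ∀ s → value s ≃ 1ℝ → at s ≃² q

open Arc public

_∈ᵃ_ : ∀ {p q} → ℝ² → Arc p q → Set
x ∈ᵃ γ = ∃[ s ] (at γ s ≃² x)

-- Graphs

record SimpleGraph : Set₁ where
  field
    V      : Set
    _~_    : V → V → Set
    ~-sym  : ∀ {u v} → u ~ v → v ~ u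
    ~-irrefl : ∀ {v} → ¬ (v ~ v)

open SimpleGraph public using (V)

K : ℕ → SimpleGraph
K n = record
  { V        = Fin n
  ; _~_      = _≢_
  ; ~-sym    = λ u≢v v≡u → u≢v (sym v≡u)
  ; ~-irrefl = λ v≢v → v≢v refl
  }

C₄ : SimpleGraph
C₄ = record
  { V        = Fin 4
  ; _~_      = λ x y → Next x y ⊎ Next y x
  ; ~-sym    = swap
  ; ~-irrefl = λ { (inj₁ p) → irr _ p ; (inj₂ p) → irr _ p }
  }
  where
  Next : Fin 4 → Fin 4 → Set
  Next x y = toℕ y ≡ suc (toℕ x) % 4
  irr : ∀ x → ¬ Next x x
  irr zero ()
  irr (suc zero) ()
  irr (suc (suc zero)) ()
  irr (suc (suc (suc zero))) ()

_⊗_ : SimpleGraph → SimpleGraph → SimpleGraph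
G ⊗ H = record
  { V        = V G × V H
  ; _~_      = λ { (a , x) (b , y) → (a G.~ b) × (x H.~ y) }
  ; ~-sym    = λ { (ab , xy) → G.~-sym ab , H.~-sym xy }
  ; ~-irrefl = λ { (aa , _) → G.~-irrefl aa }
  }
  where
  module G = SimpleGraph G
  module H = SimpleGraph H

-- An edge with an orientation; _≋_ forgets the orientation, so that an
-- (undirected) edge of the graph is a class of _≋_.
record Edge (G : SimpleGraph) : Set where
  constructor edge
  field
    src tgt : V G
    .adj    : SimpleGraph._~_ G src tgt

open Edge public

_≋_ : ∀ {G} → Edge G → Edge G → Set
e ≋ f = (src e ≡ src f × tgt e ≡ tgt f) ⊎ (src e ≡ tgt f × tgt e ≡ src f)

-- Drawings and crossings

record Drawing (G : SimpleGraph) : Set where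
  field
    point    : V G → ℝ²
    distinct : ∀ u v → point u ≃² point v → u ≡ v
    arc      : (e : Edge G) → Arc (point (src e)) (point (tgt e))
    -- both orientations of an edge are drawn as the same set of points
    unoriented : ∀ e f → e ≋ f → ∀ x → x ∈ᵃ arc e → x ∈ᵃ arc f
    -- with injectivity of arcs: an edge meets vertices only at its two ends
    avoids   : ∀ e w → w ≢ src e → w ≢ tgt e → ¬ (point w ∈ᵃ arc e)

-- A pair of different edges together with a common point that is not a shared
-- end.  A point common to several edges yields one crossing for each pair of
-- them; a tangential contact also counts as a crossing.
record Crossing {G : SimpleGraph} (D : Drawing G) : Set where
  open Drawing D
  field
    e₁ e₂     : Edge G
    different : ¬ (e₁ ≋ e₂)
    place     : ℝ²
    on₁       : place ∈ᵃ arc e₁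
    on₂       : place ∈ᵃ arc e₂
    interior  : ∀ w → ¬ (place ≃² point w)

-- Crossings are identified up to the order of the pair and orientations.
SameCrossing : ∀ {G} {D : Drawing G} → Crossing D → Crossing D → Set
SameCrossing c d = (c.place ≃² d.place) ×
  ((c.e₁ ≋ d.e₁ × c.e₂ ≋ d.e₂) ⊎ (c.e₁ ≋ d.e₂ × c.e₂ ≋ d.e₁))
  where
  module c = Crossing c
  module d = Crossing d

-- No k + 1 pairwise distinct crossings.
AtMostCrossings : ∀ {G} → Drawing G → ℕ → Set
AtMostCrossings D k =
  ¬ (Σ (Fin (suc k) → Crossing D) λ c → ∀ i j → SameCrossing (c i) (c j) → i ≡ j)

-- cr G ≤ k: the minimum over all drawings is at most k exactly when some
-- drawing has at most k crossings.
cr_≤_ : SimpleGraph → ℕ → Set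
cr G ≤ k = ∃[ D ] AtMostCrossings {G} D k

infixl 7 _⊗_
infix 4 cr_≤_ _≋_ _∈ᵃ_

{-# OPTIONS --safe #-}
module Submission where

-- Attach to every index i a pair of twins w (i , false), w (i , true) in ℝ³, close to the moment curve (1 , x , x²).
-- The vertices (i , 0) and (i , 2) of K n ⊗ C₄ are drawn in the directions of (-1)^i w (i , false) and
-- (-1)^i w (i , true), the vertices (i , 1) and (i , 3) in the opposite directions, and the edges as arcs of great
-- circles, all projected to the plane.  Two edges cross when the linear relation between their four ends has
-- suitable signs, which is a condition on 3 × 3 determinants.
--
-- Four indices i < j < k < l give 4 * 16 crossings or none, according to their parities; on the moment curve this
-- makes 16 ⌊n/2⌋ ⌊(n-1)/2⌋ ⌊(n-2)/2⌋ ⌊(n-3)/2⌋ in total.  All other crossings involve an edge at each twin of a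
-- pair, and their number depends on how the line through the twins divides the other points.  For odd n the twins
-- lie above each other, which halves the other points evenly.  For even n this is impossible, but the line can be
-- made to separate the twins of another index, whose edges then do not cross each other.

open import Defs

-- Equality of reals is undecidable here, and no arithmetic of reals is built. So a meeting of two
-- arcs is expressed by rational sequences tending to 0; applying linear functionals turns it into
-- combinations of a few fixed rational determinants, which cannot tend to 0 when these have a
-- common sign. For the same reason the arcs are straight segments between rational vectors,
-- projected from the origin by a piecewise linear rule: norms and stereographic projection would
-- need square roots. Let A and B be the numbers of points that the line through a twin pair leaves
-- on its two sides, each point taken with the sign (-1)^i. Then A + B = 2n - 2, and the crossings
-- at this pair grow with A² + B², so A = B = n - 1 is the aim. Whole twin pairs give even A and B,
-- which suits odd n only; for even n an odd number of other pairs must be separated, and one is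
-- enough. Separation must not be mutual, since two twin pairs whose lines separate each other could
-- produce crossings of a further kind.

module Analysis where
  open import Data.Nat as ℕ using (ℕ)
  import Data.Nat.Properties as ℕₚ
  open import Data.Rational hiding (_≃_)
  open import Data.Rational.Properties
  open import Data.Product using (∃-syntax; _×_; _,_)
  open import Data.Sum using (_⊎_; inj₁; inj₂)
  open import Relation.Nullary using (¬_)
  open import Relation.Nullary.Decidable.Core using (dec⇒maybe)
  open import Relation.Binary.PropositionalEquality
  open import Tactic.RingSolver using (solve-∀)
  open import Tactic.RingSolver.Core.AlmostCommutativeRing using (AlmostCommutativeRing; fromCommutativeRing)

  -- Rational inequalities, null sequences and Lipschitz maps.

  ℚ-ring : AlmostCommutativeRing _ _
  ℚ-ring = fromCommutativeRing +-*-commutativeRing (λ x → dec⇒maybe (0ℚ ≟ x))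

  abstract
    0<1 : 0ℚ < 1ℚ
    0<1 = positive⁻¹ 1ℚ

    0≤1 : 0ℚ ≤ 1ℚ
    0≤1 = <⇒≤ 0<1

  +-nonneg : ∀ {p q} → 0ℚ ≤ p → 0ℚ ≤ q → 0ℚ ≤ p + q
  +-nonneg = +-mono-≤

  +-pos : ∀ {p q} → 0ℚ < p → 0ℚ < q → 0ℚ < p + q
  +-pos = +-mono-<

  *-nonneg : ∀ {p q} → 0ℚ ≤ p → 0ℚ ≤ q → 0ℚ ≤ p * q
  *-nonneg {p} {q} 0≤p 0≤q =
    nonNegative⁻¹ (p * q) {{nonNeg*nonNeg⇒nonNeg p {{nonNegative 0≤p}} q {{nonNegative 0≤q}}}}

  *-pos : ∀ {p q} → 0ℚ < p → 0ℚ < q → 0ℚ < p * q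
  *-pos {p} {q} 0<p 0<q =
    positive⁻¹ (p * q) {{pos*pos⇒pos p {{positive 0<p}} q {{positive 0<q}}}}

  *-monoˡ : ∀ {r p q} → 0ℚ ≤ r → p ≤ q → r * p ≤ r * q
  *-monoˡ {r} 0≤r = *-monoˡ-≤-nonNeg r {{nonNegative 0≤r}}

  *-mono-nonneg : ∀ {a b c d} → 0ℚ ≤ a → 0ℚ ≤ d → a ≤ b → c ≤ d → a * c ≤ b * d
  *-mono-nonneg {a} {b} {c} {d} 0≤a 0≤d a≤b c≤d =
    ≤-trans (*-monoˡ 0≤a c≤d) (*-monoʳ-≤-nonNeg d {{nonNegative 0≤d}} a≤b)

  0≤q-p⇒p≤q : ∀ {p q} → 0ℚ ≤ q - p → p ≤ q
  0≤q-p⇒p≤q {p} {q} 0≤d = subst₂ _≤_ (+-identityʳ p) (lem p q) (+-monoʳ-≤ p 0≤d)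
    where lem : ∀ p q → p + (q - p) ≡ q
          lem = solve-∀ ℚ-ring

  p≤q⇒0≤q-p : ∀ {p q} → p ≤ q → 0ℚ ≤ q - p
  p≤q⇒0≤q-p {p} {q} p≤q = subst (_≤ q - p) (+-inverseʳ p) (+-monoˡ-≤ (- p) p≤q)

  p-r≤q⇒p≤q+r : ∀ {p q r} → p - r ≤ q → p ≤ q + r
  p-r≤q⇒p≤q+r {p} {q} {r} h = subst (_≤ q + r) (lem p r) (+-monoˡ-≤ r h)
    where lem : ∀ p r → p - r + r ≡ p
          lem = solve-∀ ℚ-ring

  p≤q+r⇒p-r≤q : ∀ {p q r} → p ≤ q + r → p - r ≤ q
  p≤q+r⇒p-r≤q {p} {q} {r} h = subst (p - r ≤_) (lem q r) (+-monoˡ-≤ (- r) h)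
    where lem : ∀ q r → q + r - r ≡ q
          lem = solve-∀ ℚ-ring

  p≤p+q : ∀ {p q} → 0ℚ ≤ q → p ≤ p + q
  p≤p+q {p} {q} 0≤q = subst (_≤ p + q) (+-identityʳ p) (+-monoʳ-≤ p 0≤q)

  p≤∣p∣ : ∀ p → p ≤ ∣ p ∣
  p≤∣p∣ p with ≤-total 0ℚ p
  ... | inj₁ 0≤p = ≤-reflexive (sym (0≤p⇒∣p∣≡p 0≤p))
  ... | inj₂ p≤0 = ≤-trans p≤0 (0≤∣p∣ p)

  -p≤∣p∣ : ∀ p → - p ≤ ∣ p ∣
  -p≤∣p∣ p = subst (- p ≤_) (∣-p∣≡∣p∣ p) (p≤∣p∣ (- p))

  ∣p∣≤ : ∀ {p r} → p ≤ r → - p ≤ r → ∣ p ∣ ≤ r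
  ∣p∣≤ {p} p≤r -p≤r with ∣p∣≡p∨∣p∣≡-p p
  ... | inj₁ e = subst (_≤ _) (sym e) p≤r
  ... | inj₂ e = subst (_≤ _) (sym e) -p≤r

  ∣p-q∣-comm : ∀ p q → ∣ p - q ∣ ≡ ∣ q - p ∣
  ∣p-q∣-comm p q = trans (sym (∣-p∣≡∣p∣ (p - q))) (cong ∣_∣ (lem p q))
    where lem : ∀ p q → - (p - q) ≡ q - p
          lem = solve-∀ ℚ-ring

  p+1≤q⇒1≤q-p : ∀ {p q} → p + 1ℚ ≤ q → 1ℚ ≤ q - p
  p+1≤q⇒1≤q-p {p} {q} h = subst (_≤ q - p) (lem p) (+-monoˡ-≤ (- p) h)
    where lem : ∀ p → p + 1ℚ - p ≡ 1ℚ
          lem = solve-∀ ℚ-ring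

  neg-neg : ∀ p → - - p ≡ p
  neg-neg = solve-∀ ℚ-ring

  ∣p-q∣≤ : ∀ {p q r} → p ≤ q + r → q ≤ p + r → ∣ p - q ∣ ≤ r
  ∣p-q∣≤ {p} {q} {r} h k = ∣p∣≤ (le p q r h) (subst (_≤ r) (sym (lem p q)) (le q p r k))
    where
    le : ∀ p q r → p ≤ q + r → p - q ≤ r
    le p q r h = p≤q+r⇒p-r≤q (subst (p ≤_) (+-comm q r) h)
    lem : ∀ p q → - (p - q) ≡ q - p
    lem = solve-∀ ℚ-ring

  p≤q+∣p-q∣ : ∀ p q → p ≤ q + ∣ p - q ∣
  p≤q+∣p-q∣ p q = subst (_≤ q + ∣ p - q ∣) (lem p q) (+-monoʳ-≤ q (p≤∣p∣ (p - q)))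
    where lem : ∀ p q → q + (p - q) ≡ p
          lem = solve-∀ ℚ-ring

  q≤p+∣p-q∣ : ∀ p q → q ≤ p + ∣ p - q ∣
  q≤p+∣p-q∣ p q = subst (λ d → q ≤ p + d) (∣p-q∣-comm q p) (p≤q+∣p-q∣ q p)

  ∣∣p∣-∣q∣∣≤∣p-q∣ : ∀ p q → ∣ ∣ p ∣ - ∣ q ∣ ∣ ≤ ∣ p - q ∣
  ∣∣p∣-∣q∣∣≤∣p-q∣ p q = ∣p-q∣≤ (half p q) (subst (λ d → ∣ q ∣ ≤ ∣ p ∣ + d) (∣p-q∣-comm q p) (half q p))
    where
    lem : ∀ p q → q + (p - q) ≡ p
    lem = solve-∀ ℚ-ring
    half : ∀ p q → ∣ p ∣ ≤ ∣ q ∣ + ∣ p - q ∣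
    half p q = subst (λ r → ∣ r ∣ ≤ ∣ q ∣ + ∣ p - q ∣) (lem p q) (∣p+q∣≤∣p∣+∣q∣ q (p - q))

  ∣p+q∣≤ : ∀ {p q a b} → ∣ p ∣ ≤ a → ∣ q ∣ ≤ b → ∣ p + q ∣ ≤ a + b
  ∣p+q∣≤ {p} {q} h k = ≤-trans (∣p+q∣≤∣p∣+∣q∣ p q) (+-mono-≤ h k)

  ∣p*q∣≤ : ∀ {p q a b} → ∣ p ∣ ≤ a → ∣ q ∣ ≤ b → ∣ p * q ∣ ≤ a * b
  ∣p*q∣≤ {p} {q} h k = subst (_≤ _) (sym (∣p*q∣≡∣p∣*∣q∣ p q))
    (*-mono-nonneg (0≤∣p∣ p) (≤-trans (0≤∣p∣ q) k) h k)

  -- The reciprocal of a, provided that 1 ≤ a.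
  abstract
    inv : ℚ → ℚ
    inv a = 1/_ (a ⊔ 1ℚ) {{pos⇒nonZero (a ⊔ 1ℚ) {{positive (<-≤-trans 0<1 (p≤q⊔p a 1ℚ))}}}}

    inv-pos : ∀ a → 0ℚ < inv a
    inv-pos a = positive⁻¹ (inv a) {{1/pos⇒pos (a ⊔ 1ℚ) {{positive (<-≤-trans 0<1 (p≤q⊔p a 1ℚ))}}}}

    inv-inverseˡ : ∀ {a} → 1ℚ ≤ a → inv a * a ≡ 1ℚ
    inv-inverseˡ {a} 1≤a = trans (cong (inv a *_) (sym (p≥q⇒p⊔q≡p 1≤a)))
      (*-inverseˡ (a ⊔ 1ℚ) {{pos⇒nonZero (a ⊔ 1ℚ) {{positive (<-≤-trans 0<1 (p≤q⊔p a 1ℚ))}}}})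

  inv≤1 : ∀ {a} → 1ℚ ≤ a → inv a ≤ 1ℚ
  inv≤1 {a} 1≤a = subst₂ _≤_ (*-identityʳ (inv a)) (inv-inverseˡ 1≤a) (*-monoˡ (<⇒≤ (inv-pos a)) 1≤a)

  shrink : ∀ C ε → 0ℚ ≤ C → 0ℚ < ε → ∃[ δ ] (0ℚ < δ × C * δ ≤ ε)
  shrink C ε 0≤C 0<ε = δ , *-pos 0<ε (inv-pos (C + 1ℚ)) ,
    subst (C * δ ≤_) eq (p≤p+q (*-nonneg (<⇒≤ 0<ε) (<⇒≤ (inv-pos (C + 1ℚ)))))
    where
    δ = ε * inv (C + 1ℚ)
    lem : ∀ C ε i → C * (ε * i) + ε * i ≡ ε * (i * (C + 1ℚ))
    lem = solve-∀ ℚ-ring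
    eq : C * δ + δ ≡ ε
    eq = trans (lem C ε _)
      (trans (cong (ε *_) (inv-inverseˡ (subst (_≤ C + 1ℚ) (+-identityˡ 1ℚ) (+-monoˡ-≤ 1ℚ 0≤C)))) (*-identityʳ ε))

  halve : ∀ ε → 0ℚ < ε → ∃[ δ ] (0ℚ < δ × δ + δ ≤ ε)
  halve ε 0<ε with <-dense 0<ε
  ... | m , 0<m , m<ε = m ⊓ (ε - m) , 0<δ , subst (m ⊓ (ε - m) + m ⊓ (ε - m) ≤_) (lem m ε) (+-mono-≤ (p⊓q≤p m (ε - m)) (p⊓q≤q m (ε - m)))
    where
    lem : ∀ m ε → m + (ε - m) ≡ ε
    lem = solve-∀ ℚ-ring
    0<δ : 0ℚ < m ⊓ (ε - m)
    0<δ with ≤-total m (ε - m)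
    ... | inj₁ h = subst (0ℚ <_) (sym (p≤q⇒p⊓q≡p h)) 0<m
    ... | inj₂ h = subst (0ℚ <_) (sym (p≥q⇒p⊓q≡q h)) (subst (_< ε - m) (+-inverseʳ m) (+-monoˡ-< (- m) m<ε))

  -- Statements about reals are reduced to this: `x ≃ y` says that the termwise difference is null.
  -- Wrapping it in a record keeps `f` visible to unification.
  record Null (f : ℕ → ℚ) : Set where
    constructor null
    field vanishes : ∀ ε → 0ℚ < ε → ∃[ N ] (∀ n → N ℕ.≤ n → ∣ f n ∣ ≤ ε)

  open Null

  null-dominated : ∀ {f g} C → 0ℚ ≤ C → (∀ n → ∣ f n ∣ ≤ C * ∣ g n ∣) → Null g → Null f
  null-dominated {f} {g} C 0≤C h ng .vanishes ε 0<ε =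
    let δ , 0<δ , Cδ≤ε = shrink C ε 0≤C 0<ε
        N , bd = vanishes ng δ 0<δ
    in N , λ n N≤n → ≤-trans (h n) (≤-trans (*-monoˡ 0≤C (bd n N≤n)) Cδ≤ε)

  null-≤ : ∀ {f g} → (∀ n → ∣ f n ∣ ≤ ∣ g n ∣) → Null g → Null f
  null-≤ h ng .vanishes ε 0<ε =
    let N , bd = vanishes ng ε 0<ε in N , λ n N≤n → ≤-trans (h n) (bd n N≤n)

  null-cong : ∀ {f g} → (∀ n → f n ≡ g n) → Null f → Null g
  null-cong h nf .vanishes ε 0<ε =
    let N , bd = vanishes nf ε 0<ε in N , λ n N≤n → subst (λ r → ∣ r ∣ ≤ ε) (h n) (bd n N≤n)

  null-+ : ∀ {f g} → Null f → Null g → Null (λ n → f n + g n)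
  null-+ {f} {g} nf ng .vanishes ε 0<ε =
    let δ , 0<δ , 2δ≤ε = halve ε 0<ε
        M , bf = vanishes nf δ 0<δ
        N , bg = vanishes ng δ 0<δ
    in M ℕ.⊔ N , λ n h → ≤-trans
         (∣p+q∣≤ {f n} {g n} (bf n (ℕₚ.≤-trans (ℕₚ.m≤m⊔n M N) h)) (bg n (ℕₚ.≤-trans (ℕₚ.m≤n⊔m M N) h))) 2δ≤ε

  null-neg : ∀ {f} → Null f → Null (λ n → - f n)
  null-neg {f} = null-≤ (λ n → ≤-reflexive (∣-p∣≡∣p∣ (f n)))

  null-- : ∀ {f g} → Null f → Null g → Null (λ n → f n - g n)
  null-- {f} {g} nf ng = null-+ {f} {λ n → - g n} nf (null-neg {g} ng)

  null-*ˡ : ∀ {f g : ℕ → ℚ} B → (∀ n → ∣ f n ∣ ≤ B) → Null g → Null (λ n → f n * g n)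
  null-*ˡ {f} {g} B bd = null-dominated {λ n → f n * g n} {g} B (≤-trans (0≤∣p∣ (f 0)) (bd 0)) λ n → ∣p*q∣≤ {f n} {g n} (bd n) ≤-refl

  null-scale : ∀ {g : ℕ → ℚ} c → Null g → Null (λ n → c * g n)
  null-scale {g} c = null-*ˡ {λ _ → c} {g} ∣ c ∣ (λ _ → ≤-refl)

  null-0 : Null (λ _ → 0ℚ)
  null-0 .vanishes ε 0<ε = 0 , λ _ _ → <⇒≤ 0<ε

  ¬null : ∀ {f c} → 0ℚ < c → (∀ n → c ≤ f n) → ¬ Null f
  ¬null {f} {c} 0<c h nf =
    let δ , 0<δ , 2δ≤c = halve c 0<c
        N , bd = vanishes nf δ 0<δ
        δ<2δ = subst (_< δ + δ) (+-identityʳ δ) (+-monoʳ-< δ 0<δ)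
    in <-irrefl refl (<-≤-trans δ<2δ (≤-trans 2δ≤c (≤-trans (h N) (≤-trans (p≤∣p∣ (f N)) (bd N ℕₚ.≤-refl)))))

  -- These functions extend termwise to Cauchy sequences. The bound is carried along because a
  -- product of Lipschitz functions is Lipschitz once both factors are bounded.
  record Lipschitz (f : ℚ → ℚ) : Set where
    field
      bound slope : ℚ
      bounded     : ∀ q → ∣ f q ∣ ≤ bound
      0≤slope     : 0ℚ ≤ slope
      lipschitz   : ∀ q r → ∣ f q - f r ∣ ≤ slope * ∣ q - r ∣

  open Lipschitz

  0≤bound : ∀ {f} (l : Lipschitz f) → 0ℚ ≤ bound l
  0≤bound {f} l = ≤-trans (0≤∣p∣ (f 0ℚ)) (bounded l 0ℚ)

  const-lipschitz : ∀ c → Lipschitz (λ _ → c)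
  const-lipschitz c = record
    { bound = ∣ c ∣ ; slope = 0ℚ ; bounded = λ _ → ≤-refl ; 0≤slope = ≤-refl
    ; lipschitz = λ q r → ≤-reflexive (trans (cong ∣_∣ (+-inverseʳ c)) (sym (*-zeroˡ ∣ q - r ∣))) }

  +-lipschitz : ∀ {f g} → Lipschitz f → Lipschitz g → Lipschitz (λ q → f q + g q)
  +-lipschitz {f} {g} F G = record
    { bound = bound F + bound G ; slope = slope F + slope G
    ; bounded = λ q → ∣p+q∣≤ (bounded F q) (bounded G q)
    ; 0≤slope = +-nonneg (0≤slope F) (0≤slope G)
    ; lipschitz = λ q r → subst₂ _≤_ (cong ∣_∣ (lem (f q) (f r) (g q) (g r))) (sym (*-distribʳ-+ ∣ q - r ∣ (slope F) (slope G)))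
        (∣p+q∣≤ (lipschitz F q r) (lipschitz G q r)) }
    where lem : ∀ a b c d → (a - b) + (c - d) ≡ (a + c) - (b + d)
          lem = solve-∀ ℚ-ring

  *-lipschitz : ∀ {f g} → Lipschitz f → Lipschitz g → Lipschitz (λ q → f q * g q)
  *-lipschitz {f} {g} F G = record
    { bound = bound F * bound G ; slope = bound F * slope G + bound G * slope F
    ; bounded = λ q → ∣p*q∣≤ (bounded F q) (bounded G q)
    ; 0≤slope = +-nonneg (*-nonneg (0≤bound F) (0≤slope G)) (*-nonneg (0≤bound G) (0≤slope F))
    ; lipschitz = λ q r → subst₂ _≤_ (cong ∣_∣ (lem (f q) (f r) (g q) (g r))) (lem′ (bound F) (slope G) (bound G) (slope F) ∣ q - r ∣)
        (∣p+q∣≤ (∣p*q∣≤ (bounded F q) (lipschitz G q r)) (∣p*q∣≤ (bounded G r) (lipschitz F q r))) }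
    where
    lem : ∀ a b c d → a * (c - d) + d * (a - b) ≡ a * c - b * d
    lem = solve-∀ ℚ-ring
    lem′ : ∀ a b c d e → a * (b * e) + c * (d * e) ≡ (a * b + c * d) * e
    lem′ = solve-∀ ℚ-ring

  ∣∣-lipschitz : ∀ {f} → Lipschitz f → Lipschitz (λ q → ∣ f q ∣)
  ∣∣-lipschitz {f} F = record
    { bound = bound F ; slope = slope F ; 0≤slope = 0≤slope F
    ; bounded = λ q → subst (_≤ bound F) (sym (∣∣p∣∣≡∣p∣ (f q))) (bounded F q)
    ; lipschitz = λ q r → ≤-trans (∣∣p∣-∣q∣∣≤∣p-q∣ (f q) (f r)) (lipschitz F q r) }

  -- 1/a - 1/b = (b - a)/(ab), and both reciprocals are at most 1.
  inv-lipschitz : ∀ {f} → (∀ q → 1ℚ ≤ f q) → Lipschitz f → Lipschitz (λ q → inv (f q))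
  inv-lipschitz {f} 1≤f F = record
    { bound = 1ℚ ; slope = slope F ; 0≤slope = 0≤slope F
    ; bounded = ∣inv∣≤1
    ; lipschitz = λ q r → ≤-trans (subst₂ _≤_ (cong ∣_∣ (eq q r)) (*-identityˡ ∣ f r - f q ∣)
        (∣p*q∣≤ {inv (f q)} {inv (f r) * (f r - f q)} {1ℚ} (∣inv∣≤1 q)
          (subst (∣ inv (f r) * (f r - f q) ∣ ≤_) (*-identityˡ ∣ f r - f q ∣) (∣p*q∣≤ {inv (f r)} {f r - f q} (∣inv∣≤1 r) ≤-refl))))
        (subst (_≤ slope F * ∣ q - r ∣) (∣p-q∣-comm (f q) (f r)) (lipschitz F q r)) }
    where
    ∣inv∣≤1 : ∀ q → ∣ inv (f q) ∣ ≤ 1ℚ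
    ∣inv∣≤1 q = subst (_≤ 1ℚ) (sym (0≤p⇒∣p∣≡p (<⇒≤ (inv-pos (f q))))) (inv≤1 (1≤f q))
    lem : ∀ i j x y → i * (j * (y - x)) ≡ i * (j * y) - j * (i * x)
    lem = solve-∀ ℚ-ring
    eq : ∀ q r → inv (f q) * (inv (f r) * (f r - f q)) ≡ inv (f q) - inv (f r)
    eq q r = trans (lem (inv (f q)) (inv (f r)) (f q) (f r)) (cong₂ _-_
      (trans (cong (inv (f q) *_) (inv-inverseˡ (1≤f r))) (*-identityʳ (inv (f q))))
      (trans (cong (inv (f r) *_) (inv-inverseˡ (1≤f q))) (*-identityʳ (inv (f r)))))

  -- A real parameter of an arc lies between 0 and 1, but its rational approximations need not, and
  -- outside this range a segment may enter the cone where the projection fails. Clamping the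
  -- approximations leaves the real unchanged (`clamp-value`) and bounds every function of the
  -- parameter.
  clamp : ℚ → ℚ
  clamp q = 0ℚ ⊔ (1ℚ ⊓ q)

  0≤clamp : ∀ q → 0ℚ ≤ clamp q
  0≤clamp q = p≤p⊔q 0ℚ (1ℚ ⊓ q)

  clamp≤1 : ∀ q → clamp q ≤ 1ℚ
  clamp≤1 q = ⊔-lub 0≤1 (p⊓q≤p 1ℚ q)

  clamp-lipschitz : Lipschitz clamp
  clamp-lipschitz = record
    { bound = 1ℚ ; slope = 1ℚ ; 0≤slope = 0≤1
    ; bounded = λ q → subst (_≤ 1ℚ) (sym (0≤p⇒∣p∣≡p (0≤clamp q))) (clamp≤1 q)
    ; lipschitz = λ q r → subst (∣ clamp q - clamp r ∣ ≤_) (sym (*-identityˡ ∣ q - r ∣))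
        (∣p-q∣≤ (half {q} {r} (p≤q+∣p-q∣ q r) (0≤∣p∣ (q - r))) (half {r} {q} (q≤p+∣p-q∣ q r) (0≤∣p∣ (q - r)))) }
    where
    half : ∀ {q r d} → q ≤ r + d → 0ℚ ≤ d → clamp q ≤ clamp r + d
    half {q} {r} {d} h 0≤d = ⊔-lub {clamp r + d} {0ℚ} {1ℚ ⊓ q} (+-nonneg (0≤clamp r) 0≤d)
      (≤-trans {1ℚ ⊓ q} {(1ℚ ⊓ r) + d} (p-r≤q⇒p≤q+r {1ℚ ⊓ q} {1ℚ ⊓ r} {d} (⊓-glb {1ℚ ⊓ q - d} {1ℚ} {r}
                 (p≤q+r⇒p-r≤q {1ℚ ⊓ q} {1ℚ} {d} (≤-trans (p⊓q≤p 1ℚ q) (p≤p+q {1ℚ} {d} 0≤d)))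
                 (p≤q+r⇒p-r≤q {1ℚ ⊓ q} {r} {d} (≤-trans (p⊓q≤q 1ℚ q) h))))
               (+-monoˡ-≤ d (p≤q⊔p 0ℚ (1ℚ ⊓ r))))

  clamp-≤0 : ∀ {q} → q ≤ 0ℚ → clamp q ≡ 0ℚ
  clamp-≤0 {q} q≤0 = p≥q⇒p⊔q≡p (≤-trans (p⊓q≤q 1ℚ q) q≤0)

  clamp-≥1 : ∀ {q} → 1ℚ ≤ q → clamp q ≡ 1ℚ
  clamp-≥1 {q} 1≤q = trans (cong (0ℚ ⊔_) (p≤q⇒p⊓q≡p 1≤q)) (p≤q⇒p⊔q≡q 0≤1)

  clamp-id : ∀ {q} → 0ℚ ≤ q → q ≤ 1ℚ → clamp q ≡ q
  clamp-id {q} 0≤q q≤1 = trans (cong (0ℚ ⊔_) (p≥q⇒p⊓q≡q q≤1)) (p≤q⇒p⊔q≡q 0≤q)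

  -- Serves the requirement that both orientations of an edge are drawn as the same point set: the
  -- reversed segment is traversed with parameter 1 - t.
  clamp-complement : ∀ q → clamp (1ℚ - q) ≡ 1ℚ - clamp q
  clamp-complement q = cases (≤-total 0ℚ q) (≤-total q 1ℚ)
    where
    1-q≤1 : 0ℚ ≤ q → 1ℚ - q ≤ 1ℚ
    1-q≤1 0≤q = p≤q+r⇒p-r≤q {1ℚ} {1ℚ} {q} (p≤p+q {1ℚ} {q} 0≤q)
    cases : 0ℚ ≤ q ⊎ q ≤ 0ℚ → q ≤ 1ℚ ⊎ 1ℚ ≤ q → clamp (1ℚ - q) ≡ 1ℚ - clamp q
    cases (inj₁ 0≤q) (inj₁ q≤1) = trans (clamp-id (p≤q⇒0≤q-p q≤1) (1-q≤1 0≤q)) (cong (λ r → 1ℚ - r) (sym (clamp-id 0≤q q≤1)))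
    cases (inj₁ 0≤q) (inj₂ 1≤q) = trans (clamp-≤0 (p≤q+r⇒p-r≤q {1ℚ} {0ℚ} {q} (subst (1ℚ ≤_) (sym (+-identityˡ q)) 1≤q)))
      (sym (trans (cong (λ r → 1ℚ - r) (clamp-≥1 1≤q)) (+-inverseʳ 1ℚ)))
    cases (inj₂ q≤0) _ = trans (clamp-≥1 (p≤p+q {1ℚ} { - q} (neg-antimono-≤ q≤0)))
      (sym (trans (cong (λ r → 1ℚ - r) (clamp-≤0 q≤0)) (+-identityʳ 1ℚ)))

  lift : ∀ {f} → Lipschitz f → ℝ → ℝ
  lift {f} F x .seq n = f (seq x n)
  lift {f} F x .cauchy ε 0<ε =
    let δ , 0<δ , h = shrink (slope F) ε (0≤slope F) 0<ε
        N , c = cauchy x δ 0<δ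
    in N , λ m n N≤m N≤n →
    ≤-trans (lipschitz F (seq x m) (seq x n)) (≤-trans (*-monoˡ (0≤slope F) (c m n N≤m N≤n)) h)

  lift-continuous : ∀ {f} (F : Lipschitz f) ε → 0ℚ < ε →
    ∃[ δ ] (0ℚ < δ × (∀ x y → x ≈[ δ ] y → lift F x ≈[ ε ] lift F y))
  lift-continuous F ε 0<ε =
    let δ , 0<δ , h = shrink (slope F) ε (0≤slope F) 0<ε
    in δ , 0<δ , λ { x y (N , c) → N , λ n N≤n →
    ≤-trans (lipschitz F (seq x n) (seq y n)) (≤-trans (*-monoˡ (0≤slope F) (c n N≤n)) h) }

  lift-≃ : ∀ {f} (F : Lipschitz f) x y → x ≃ y → lift F x ≃ lift F y
  lift-≃ {f} F x y x≃y = vanishes {λ n → f (seq x n) - f (seq y n)}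
    (null-dominated (slope F) (0≤slope F) (λ n → lipschitz F (seq x n) (seq y n)) (null x≃y))

  ℝ-sym : ∀ x y → x ≃ y → y ≃ x
  ℝ-sym x y x≃y = vanishes {λ n → seq y n - seq x n}
    (null-≤ (λ n → ≤-reflexive (∣p-q∣-comm (seq y n) (seq x n))) (null x≃y))

  ℝ-trans : ∀ x y z → x ≃ y → y ≃ z → x ≃ z
  ℝ-trans x y z p q = vanishes
    (null-cong (λ n → lem (seq x n) (seq y n) (seq z n)) (null-+ {λ n → seq x n - seq y n} {λ n → seq y n - seq z n} (null p) (null q)))
    where lem : ∀ a b c → (a - b) + (b - c) ≡ a - c
          lem = solve-∀ ℚ-ring

  ≃²-sym : ∀ p q → p ≃² q → q ≃² p
  ≃²-sym (x , y) (x′ , y′) (h , k) = ℝ-sym x x′ h , ℝ-sym y y′ k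

  ≃²-trans : ∀ p q r → p ≃² q → q ≃² r → p ≃² r
  ≃²-trans (x , y) (x′ , y′) (x″ , y″) (h , k) (h′ , k′) = ℝ-trans x x′ x″ h h′ , ℝ-trans y y′ y″ k k′

  clamp-value : (s : UnitInterval) → Null (λ n → clamp (seq (value s) n) - seq (value s) n)
  clamp-value s .vanishes ε 0<ε =
    let M , lo = lower s ε 0<ε
        N , up = upper s ε 0<ε
    in M ℕ.⊔ N , λ n h → close 0<ε (seq (value s) n)
          (lo n (ℕₚ.≤-trans (ℕₚ.m≤m⊔n M N) h)) (up n (ℕₚ.≤-trans (ℕₚ.m≤n⊔m M N) h))
    where
    close : ∀ {ε} → 0ℚ < ε → ∀ q → 0ℚ ≤ q + ε → q ≤ 1ℚ + ε → ∣ clamp q - q ∣ ≤ ε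
    close {ε} 0<ε q lo up = ∣p-q∣≤ {clamp q} {q} {ε}
      (⊔-lub lo (≤-trans (p⊓q≤q 1ℚ q) (p≤p+q {q} {ε} (<⇒≤ 0<ε))))
      (p-r≤q⇒p≤q+r {q} {clamp q} {ε} (≤-trans {q - ε} {1ℚ ⊓ q}
        (⊓-glb {q - ε} {1ℚ} {q} (p≤q+r⇒p-r≤q {q} {1ℚ} {ε} up) (p≤q+r⇒p-r≤q {q} {q} {ε} (p≤p+q {q} {ε} (<⇒≤ 0<ε))))
        (p≤q⊔p 0ℚ (1ℚ ⊓ q))))

  complement : UnitInterval → UnitInterval
  complement s .value .seq n = 1ℚ - seq (value s) n
  complement s .value .cauchy ε 0<ε = let N , c = cauchy (value s) ε 0<ε in N , λ m n N≤m N≤n → subst (_≤ ε)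
    (trans (∣p-q∣-comm (seq (value s) m) (seq (value s) n)) (cong ∣_∣ (lem (seq (value s) m) (seq (value s) n)))) (c m n N≤m N≤n)
    where lem : ∀ a b → b - a ≡ (1ℚ - a) - (1ℚ - b)
          lem = solve-∀ ℚ-ring
  complement s .lower ε 0<ε = let N , c = upper s ε 0<ε in N , λ n N≤n → subst (0ℚ ≤_) (lem (seq (value s) n) ε) (p≤q⇒0≤q-p (c n N≤n))
    where lem : ∀ q ε → 1ℚ + ε - q ≡ 1ℚ - q + ε
          lem = solve-∀ ℚ-ring
  complement s .upper ε 0<ε = let N , c = lower s ε 0<ε in N , λ n N≤n → p≤q+r⇒p-r≤q (subst (1ℚ ≤_) (lem (seq (value s) n) ε) (p≤p+q (c n N≤n)))
    where lem : ∀ q ε → 1ℚ + (q + ε) ≡ 1ℚ + ε + q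
          lem = solve-∀ ℚ-ring

-- Determinants, the central projection and meetings of projected segments.

module Vectors where
  open import Data.Nat using (ℕ)
  open import Data.Rational hiding (_≃_)
  open import Data.Rational.Properties
  open import Data.Product using (_,_)
  open import Data.Sum using (_⊎_; inj₁; inj₂)
  open import Data.Sign as Sign using (Sign)
  open import Relation.Nullary using (¬_)
  open import Relation.Nullary.Decidable using (decidable-stable)
  open import Relation.Binary.PropositionalEquality
  open import Tactic.RingSolver using (solve-∀)
  open Analysis

  open Null
  open Lipschitz

  record ℚ³ : Set where
    constructor ⟨_,_,_⟩
    field x y z : ℚ

  open ℚ³

  det : ℚ³ → ℚ³ → ℚ³ → ℚ
  det ⟨ a , b , c ⟩ ⟨ d , e , f ⟩ ⟨ g , h , i ⟩ = a * (e * i - f * h) - b * (d * i - f * g) + c * (d * h - e * g)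

  along : ℚ → ℚ → ℚ → ℚ
  along a b c = a + c * (b - a)

  mix : ℚ³ → ℚ³ → ℚ → ℚ³
  mix ⟨ a , b , c ⟩ ⟨ d , e , f ⟩ t = ⟨ along a d t , along b e t , along c f t ⟩

  neg³ : ℚ³ → ℚ³
  neg³ ⟨ a , b , c ⟩ = ⟨ - a , - b , - c ⟩

  det-mix : ∀ p q u v t → det p q (mix u v t) ≡ (1ℚ - t) * det p q u + t * det p q v
  det-mix ⟨ a , b , c ⟩ ⟨ d , e , f ⟩ ⟨ g , h , i ⟩ ⟨ k , l , m ⟩ t = lem a b c d e f g h i k l m t
    where
    lem : ∀ a b c d e f g h i k l m t →
      a * (e * (i + t * (m - i)) - f * (h + t * (l - h))) - b * (d * (i + t * (m - i)) - f * (g + t * (k - g))) + c * (d * (h + t * (l - h)) - e * (g + t * (k - g)))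
      ≡ (1ℚ - t) * (a * (e * i - f * h) - b * (d * i - f * g) + c * (d * h - e * g)) + t * (a * (e * m - f * l) - b * (d * m - f * k) + c * (d * l - e * k))
    lem = solve-∀ ℚ-ring

  det-repeat₁ : ∀ u v → det u v u ≡ 0ℚ
  det-repeat₁ ⟨ a , b , c ⟩ ⟨ d , e , f ⟩ = lem a b c d e f
    where
    lem : ∀ a b c d e f → a * (e * c - f * b) - b * (d * c - f * a) + c * (d * b - e * a) ≡ 0ℚ
    lem = solve-∀ ℚ-ring

  det-repeat₂ : ∀ u v → det u v v ≡ 0ℚ
  det-repeat₂ ⟨ a , b , c ⟩ ⟨ d , e , f ⟩ = lem a b c d e f
    where
    lem : ∀ a b c d e f → a * (e * f - f * e) - b * (d * f - f * d) + c * (d * e - e * d) ≡ 0ℚ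
    lem = solve-∀ ℚ-ring

  det-rotate : ∀ p q r → det p q r ≡ det q r p
  det-rotate ⟨ a , b , c ⟩ ⟨ d , e , f ⟩ ⟨ g , h , i ⟩ = lem a b c d e f g h i
    where
    lem : ∀ a b c d e f g h i → a * (e * i - f * h) - b * (d * i - f * g) + c * (d * h - e * g)
                              ≡ d * (h * c - i * b) - e * (g * c - i * a) + f * (g * b - h * a)
    lem = solve-∀ ℚ-ring

  det-swap : ∀ p q r → det p q r ≡ - det q p r
  det-swap ⟨ a , b , c ⟩ ⟨ d , e , f ⟩ ⟨ g , h , i ⟩ = lem a b c d e f g h i
    where
    lem : ∀ a b c d e f g h i → a * (e * i - f * h) - b * (d * i - f * g) + c * (d * h - e * g)
                              ≡ - (d * (b * i - c * h) - e * (a * i - c * g) + f * (a * h - b * g))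
    lem = solve-∀ ℚ-ring

  det-neg : ∀ p q r → det p q (neg³ r) ≡ - det p q r
  det-neg ⟨ a , b , c ⟩ ⟨ d , e , f ⟩ ⟨ g , h , i ⟩ = lem a b c d e f g h i
    where
    lem : ∀ a b c d e f g h i → a * (e * (- i) - f * (- h)) - b * (d * (- i) - f * (- g)) + c * (d * (- h) - e * (- g))
                              ≡ - (a * (e * i - f * h) - b * (d * i - f * g) + c * (d * h - e * g))
    lem = solve-∀ ℚ-ring

  -- Signs are kept as elements of the group of order two, so that conditions on determinants become
  -- finite identities that evaluation can decide.
  HasSign : Sign → ℚ → Set
  HasSign Sign.+ d = 0ℚ < d
  HasSign Sign.- d = 0ℚ < - d

  sign⇒≢0 : ∀ s {d} → HasSign s d → d ≢ 0ℚ
  sign⇒≢0 Sign.+ 0<d d≡0 = <-irrefl (sym d≡0) 0<d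
  sign⇒≢0 Sign.- 0<-d refl = <-irrefl refl 0<-d

  null-cancel-const : ∀ {f : ℕ → ℚ} d → d ≢ 0ℚ → Null (λ n → d * f n) → Null f
  null-cancel-const {f} d d≢0 nf = null-cong (λ n → eq (f n)) (null-scale {λ n → d * f n} (1/_ d {{≢-nonZero d≢0}}) nf)
    where
    eq : ∀ q → 1/_ d {{≢-nonZero d≢0}} * (d * q) ≡ q
    eq q = trans (sym (*-assoc (1/_ d {{≢-nonZero d≢0}}) d q))
      (trans (cong (_* q) (*-inverseˡ d {{≢-nonZero d≢0}})) (*-identityˡ q))

  -- The projection from the origin onto the surface z = H (|x| + |y|) - 1, a graph over the plane, which a half-line
  -- meets exactly once, or not at all if it lies in the cone z ≥ H (|x| + |y|).
  module Projection (H : ℚ) where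

    -- Positive exactly outside the cone, and equal to 1 exactly on the surface; hence division by
    -- the depth is the projection.
    depth : ℚ³ → ℚ
    depth v = H * (∣ x v ∣ + ∣ y v ∣) - z v

    scale : ℚ³ → ℚ
    scale v = inv (depth v)

    px py : ℚ³ → ℚ
    px v = x v * scale v
    py v = y v * scale v

    -- A real parameter gives a sequence of vectors instead of one vector. The uniform bound `limit`
    -- keeps `ratio` away from 0, so that it can be cancelled from null sequences.
    record Track : Set where
      field
        vec   : ℕ → ℚ³
        clear : ∀ n → 1ℚ ≤ depth (vec n)
        limit : ℚ
        small : ∀ n → ∣ depth (vec n) ∣ ≤ limit

    open Track

    ratio : Track → ℕ → ℚ
    ratio g n = scale (vec g n)

    ratio-inverse : ∀ g n → ratio g n * depth (vec g n) ≡ 1ℚ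
    ratio-inverse g n = inv-inverseˡ (clear g n)

    0≤ratio : ∀ g n → 0ℚ ≤ ratio g n
    0≤ratio g n = <⇒≤ (inv-pos (depth (vec g n)))

    null-cancel-ratio : ∀ g {f : ℕ → ℚ} → Null (λ n → ratio g n * f n) → Null f
    null-cancel-ratio g {f} nf = null-cong (λ n → eq n)
      (null-*ˡ {λ n → depth (vec g n)} {λ n → ratio g n * f n} (limit g) (small g) nf)
      where
      lem : ∀ r d q → d * (r * q) ≡ (r * d) * q
      lem = solve-∀ ℚ-ring
      eq : ∀ n → depth (vec g n) * (ratio g n * f n) ≡ f n
      eq n = trans (lem (ratio g n) (depth (vec g n)) (f n)) (trans (cong (_* f n) (ratio-inverse g n)) (*-identityˡ (f n)))

    ¬null-ratio : ∀ g → ¬ Null (ratio g)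
    ¬null-ratio g nr = ¬null 0<1 (λ _ → ≤-refl) (null-cancel-ratio g {λ _ → 1ℚ}
      (null-cong (λ n → sym (*-identityʳ (ratio g n))) nr))

    record Close (g g′ : Track) : Set where
      field
        close-x : Null (λ n → px (vec g n) - px (vec g′ n))
        close-y : Null (λ n → py (vec g n) - py (vec g′ n))

    open Close

    -- The scaled vector lies on the surface, so its third coordinate is a function of the two
    -- planar ones. This recovers coincidence in space from coincidence in the plane.
    scaled-z : ∀ g n → z (vec g n) * ratio g n ≡ H * (∣ px (vec g n) ∣ + ∣ py (vec g n) ∣) - 1ℚ
    scaled-z g n = begin
      Z * r                                   ≡⟨ lem₁ H (∣ X ∣) (∣ Y ∣) Z r ⟩
      H * (∣ X ∣ * r + ∣ Y ∣ * r) - r * depth (vec g n)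
        ≡⟨ cong₂ _-_ (cong (H *_) (cong₂ _+_ (abs X) (abs Y))) (ratio-inverse g n) ⟩
      H * (∣ X * r ∣ + ∣ Y * r ∣) - 1ℚ        ∎
      where
      open ≡-Reasoning
      X = x (vec g n)
      Y = y (vec g n)
      Z = z (vec g n)
      r = ratio g n
      lem₁ : ∀ h a b c r → c * r ≡ h * (a * r + b * r) - r * (h * (a + b) - c)
      lem₁ = solve-∀ ℚ-ring
      abs : ∀ q → ∣ q ∣ * r ≡ ∣ q * r ∣
      abs q = sym (trans (∣p*q∣≡∣p∣*∣q∣ q r) (cong (∣ q ∣ *_) (0≤p⇒∣p∣≡p (0≤ratio g n))))

    close-z : ∀ {g g′} → Close g g′ → Null (λ n → z (vec g n) * ratio g n - z (vec g′ n) * ratio g′ n)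
    close-z {g} {g′} c = null-cong {λ n → H * ((∣ px (vec g n) ∣ - ∣ px (vec g′ n) ∣) + (∣ py (vec g n) ∣ - ∣ py (vec g′ n) ∣))} eq
      (null-scale {λ n → (∣ px (vec g n) ∣ - ∣ px (vec g′ n) ∣) + (∣ py (vec g n) ∣ - ∣ py (vec g′ n) ∣)} H
        (null-+ {λ n → ∣ px (vec g n) ∣ - ∣ px (vec g′ n) ∣} {λ n → ∣ py (vec g n) ∣ - ∣ py (vec g′ n) ∣}
          (null-≤ (λ n → ∣∣p∣-∣q∣∣≤∣p-q∣ (px (vec g n)) (px (vec g′ n))) (close-x c))
          (null-≤ (λ n → ∣∣p∣-∣q∣∣≤∣p-q∣ (py (vec g n)) (py (vec g′ n))) (close-y c))))
      where
      lem : ∀ h a b c d → h * ((a - b) + (c - d)) ≡ (h * (a + c) - 1ℚ) - (h * (b + d) - 1ℚ)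
      lem = solve-∀ ℚ-ring
      eq : ∀ n → H * ((∣ px (vec g n) ∣ - ∣ px (vec g′ n) ∣) + (∣ py (vec g n) ∣ - ∣ py (vec g′ n) ∣))
               ≡ z (vec g n) * ratio g n - z (vec g′ n) * ratio g′ n
      eq n = trans (lem H (∣ px (vec g n) ∣) (∣ px (vec g′ n) ∣) (∣ py (vec g n) ∣) (∣ py (vec g′ n) ∣))
        (sym (cong₂ _-_ (scaled-z g n) (scaled-z g′ n)))

    -- The scaled vectors agree in the limit in all three coordinates, hence so do the values of the
    -- linear functional `det p q`, whose coefficients A, B, C are the coordinates of the cross
    -- product of p and q.
    det-close : ∀ {g g′} → Close g g′ → ∀ p q →
      Null (λ n → ratio g n * det p q (vec g n) - ratio g′ n * det p q (vec g′ n))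
    det-close {g} {g′} c p@(⟨ p₁ , p₂ , p₃ ⟩) q@(⟨ q₁ , q₂ , q₃ ⟩) =
      null-cong eq (null-+ {λ n → A * δx n + B * δy n} {λ n → C * δz n}
        (null-+ {λ n → A * δx n} {λ n → B * δy n} (null-scale {δx} A (close-x c)) (null-scale {δy} B (close-y c)))
        (null-scale {δz} C (close-z c)))
      where
      A = p₂ * q₃ - p₃ * q₂
      B = p₃ * q₁ - p₁ * q₃
      C = p₁ * q₂ - p₂ * q₁
      δx δy δz : ℕ → ℚ
      δx n = px (vec g n) - px (vec g′ n)
      δy n = py (vec g n) - py (vec g′ n)
      δz n = z (vec g n) * ratio g n - z (vec g′ n) * ratio g′ n
      lem : ∀ p₁ p₂ p₃ q₁ q₂ q₃ a b c r a′ b′ c′ r′ →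
        ((p₂ * q₃ - p₃ * q₂) * (a * r - a′ * r′) + (p₃ * q₁ - p₁ * q₃) * (b * r - b′ * r′)) + (p₁ * q₂ - p₂ * q₁) * (c * r - c′ * r′)
        ≡ r * (p₁ * (q₂ * c - q₃ * b) - p₂ * (q₁ * c - q₃ * a) + p₃ * (q₁ * b - q₂ * a))
          - r′ * (p₁ * (q₂ * c′ - q₃ * b′) - p₂ * (q₁ * c′ - q₃ * a′) + p₃ * (q₁ * b′ - q₂ * a′))
      lem = solve-∀ ℚ-ring
      eq : ∀ n → (A * δx n + B * δy n) + C * δz n ≡ ratio g n * det p q (vec g n) - ratio g′ n * det p q (vec g′ n)
      eq n = lem p₁ p₂ p₃ q₁ q₂ q₃ (x (vec g n)) (y (vec g n)) (z (vec g n)) (ratio g n)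
                                   (x (vec g′ n)) (y (vec g′ n)) (z (vec g′ n)) (ratio g′ n)

    close-sym : ∀ {g g′} → Close g g′ → Close g′ g
    close-sym {g} {g′} c .close-x = null-≤ (λ n → ≤-reflexive (∣p-q∣-comm (px (vec g′ n)) (px (vec g n)))) (close-x c)
    close-sym {g} {g′} c .close-y = null-≤ (λ n → ≤-reflexive (∣p-q∣-comm (py (vec g′ n)) (py (vec g n)))) (close-y c)

    constant : ∀ w → 1ℚ ≤ depth w → Track
    constant w h = record { vec = λ _ → w ; clear = λ _ → h ; limit = ∣ depth w ∣ ; small = λ _ → ≤-refl }

    Clear : ℚ³ → ℚ³ → Set
    Clear u v = ∀ t → 0ℚ ≤ t → t ≤ 1ℚ → 1ℚ ≤ depth (mix u v t)

    along-lipschitz : ∀ a b → Lipschitz (λ q → along a b (clamp q))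
    along-lipschitz a b = +-lipschitz (const-lipschitz a) (*-lipschitz clamp-lipschitz (const-lipschitz (b - a)))

    neg-lipschitz : ∀ {f : ℚ → ℚ} → Lipschitz f → Lipschitz (λ q → - f q)
    neg-lipschitz {f} F = record
      { bound = bound F ; slope = slope F ; 0≤slope = 0≤slope F
      ; bounded = λ q → subst (_≤ bound F) (sym (∣-p∣≡∣p∣ (f q))) (bounded F q)
      ; lipschitz = λ q r → subst (_≤ slope F * ∣ q - r ∣) (trans (sym (∣-p∣≡∣p∣ (f q - f r))) (cong ∣_∣ (lem (f q) (f r)))) (lipschitz F q r) }
      where lem : ∀ a b → - (a - b) ≡ - a - - b
            lem = solve-∀ ℚ-ring

    depth-lipschitz : ∀ u v → Lipschitz (λ q → depth (mix u v (clamp q)))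
    depth-lipschitz u v = +-lipschitz
      (*-lipschitz (const-lipschitz H) (+-lipschitz (∣∣-lipschitz (along-lipschitz (x u) (x v))) (∣∣-lipschitz (along-lipschitz (y u) (y v)))))
      (neg-lipschitz (along-lipschitz (z u) (z v)))

    scale-lipschitz : ∀ {u v} → Clear u v → Lipschitz (λ q → scale (mix u v (clamp q)))
    scale-lipschitz {u} {v} cl = inv-lipschitz (λ q → cl (clamp q) (0≤clamp q) (clamp≤1 q)) (depth-lipschitz u v)

    px-lipschitz : ∀ {u v} → Clear u v → Lipschitz (λ q → px (mix u v (clamp q)))
    px-lipschitz {u} {v} cl = *-lipschitz (along-lipschitz (x u) (x v)) (scale-lipschitz {u} {v} cl)

    py-lipschitz : ∀ {u v} → Clear u v → Lipschitz (λ q → py (mix u v (clamp q)))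
    py-lipschitz {u} {v} cl = *-lipschitz (along-lipschitz (y u) (y v)) (scale-lipschitz {u} {v} cl)

    segment : ∀ u v → Clear u v → (ℕ → ℚ) → Track
    segment u v cl s = record
      { vec = λ n → mix u v (clamp (s n))
      ; clear = λ n → cl (clamp (s n)) (0≤clamp (s n)) (clamp≤1 (s n))
      ; limit = bound (depth-lipschitz u v)
      ; small = λ n → bounded (depth-lipschitz u v) (s n) }

    0≤1-clamp : ∀ q → 0ℚ ≤ 1ℚ - clamp q
    0≤1-clamp q = p≤q⇒0≤q-p (clamp≤1 q)

    combination : (ℕ → ℚ) → ℚ → ℚ → ℕ → ℚ
    combination s a b n = (1ℚ - clamp (s n)) * a + clamp (s n) * b

    -- A convex combination of two positive numbers is at least the smaller of them; the negative
    -- case is its mirror image.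
    ¬null-combination : ∀ s σ {a b} → HasSign σ a → HasSign σ b → ¬ Null (combination s a b)
    ¬null-combination s Sign.+ {a} {b} 0<a 0<b = ¬null 0<m below
      where
      m = a ⊓ b
      0<m : 0ℚ < m
      0<m = case (≤-total a b)
        where
        case : a ≤ b ⊎ b ≤ a → 0ℚ < m
        case (inj₁ h) = subst (0ℚ <_) (sym (p≤q⇒p⊓q≡p h)) 0<a
        case (inj₂ h) = subst (0ℚ <_) (sym (p≥q⇒p⊓q≡q h)) 0<b
      lem : ∀ c a b m → (1ℚ - c) * (a - m) + c * (b - m) ≡ (1ℚ - c) * a + c * b - m
      lem = solve-∀ ℚ-ring
      below : ∀ n → m ≤ combination s a b n
      below n = 0≤q-p⇒p≤q {m} {combination s a b n} (subst (0ℚ ≤_) (lem (clamp (s n)) a b m) (+-nonneg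
        (*-nonneg (0≤1-clamp (s n)) (p≤q⇒0≤q-p (p⊓q≤p a b))) (*-nonneg (0≤clamp (s n)) (p≤q⇒0≤q-p (p⊓q≤q a b)))))
    ¬null-combination s Sign.- {a} {b} 0<-a 0<-b nc = ¬null-combination s Sign.+ {a = - a} {b = - b} 0<-a 0<-b
      (null-cong (λ n → lem (clamp (s n)) a b) (null-neg {combination s a b} nc))
      where
      lem : ∀ c a b → - ((1ℚ - c) * a + c * b) ≡ (1ℚ - c) * (- a) + c * (- b)
      lem = solve-∀ ℚ-ring

    null-nonneg-sum : ∀ {f g : ℕ → ℚ} → (∀ n → 0ℚ ≤ f n) → (∀ n → 0ℚ ≤ g n) → Null (λ n → f n + g n) → Null f
    null-nonneg-sum {f} {g} 0≤f 0≤g = null-≤ λ n →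
      subst₂ _≤_ (sym (0≤p⇒∣p∣≡p (0≤f n))) (sym (0≤p⇒∣p∣≡p (+-nonneg (0≤f n) (0≤g n)))) (p≤p+q {f n} {g n} (0≤g n))

    det-plane : ∀ u v t → det u v (mix u v t) ≡ 0ℚ
    det-plane u v t = trans (det-mix u v u v t) (trans (cong₂ (λ a b → (1ℚ - t) * a + t * b) (det-repeat₁ u v) (det-repeat₂ u v)) (lem t))
      where lem : ∀ t → (1ℚ - t) * 0ℚ + t * 0ℚ ≡ 0ℚ
            lem = solve-∀ ℚ-ring

    -- The segment lies in the plane through the origin, u and v. Equal projections mean, in the
    -- limit, equal directions, so the other track tends to this plane as well.
    close-det-plane : ∀ {u v cl s g} → Close (segment u v cl s) g → Null (λ n → det u v (vec g n))
    close-det-plane {u} {v} {cl} {s} {g} c = null-cancel-ratio g {λ n → det u v (vec g n)}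
      (null-cong eq (null-neg {λ n → r n * det u v (mix u v (clamp (s n))) - ratio g n * det u v (vec g n)}
        (det-close {segment u v cl s} {g} c u v)))
      where
      r = ratio (segment u v cl s)
      lem : ∀ r d → - (r * 0ℚ - d) ≡ d
      lem = solve-∀ ℚ-ring
      eq : ∀ n → - (r n * det u v (mix u v (clamp (s n))) - ratio g n * det u v (vec g n)) ≡ ratio g n * det u v (vec g n)
      eq n = trans (cong (λ d → - (r n * d - ratio g n * det u v (vec g n))) (det-plane u v (clamp (s n))))
                   (lem (r n) (ratio g n * det u v (vec g n)))

    close-plane : ∀ {u v cl s u′ v′ cl′ s′} → Close (segment u v cl s) (segment u′ v′ cl′ s′) →
      Null (combination s′ (det u v u′) (det u v v′))
    close-plane {u} {v} {cl} {s} {u′} {v′} {cl′} {s′} c = null-cong (λ n → det-mix u v u′ v′ (clamp (s′ n)))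
      (close-det-plane {u} {v} {cl} {s} {segment u′ v′ cl′ s′} c)

    -- Equality of rationals is decidable, so it may be proved by contradiction: a nonzero constant
    -- is not null.
    close-constant : ∀ {u v cl s w h} → Close (segment u v cl s) (constant w h) → det u v w ≡ 0ℚ
    close-constant {u} {v} {cl} {s} {w} {h} c = decidable-stable (det u v w ≟ 0ℚ) λ d≢0 →
      ¬null 0<1 (λ _ → ≤-refl) (null-cancel-const {λ _ → 1ℚ} (det u v w) d≢0
        (null-cong (λ _ → sym (*-identityʳ (det u v w))) (close-det-plane {u} {v} {cl} {s} {constant w h} c)))

    -- The second segment leaves the plane of the first linearly from its start, so they can only
    -- meet at that start. With `close-at-end` this disposes of edges with a common or an antipodal
    -- end.
    close-at-start : ∀ {u v cl s u′ v′ cl′ s′} → Close (segment u v cl s) (segment u′ v′ cl′ s′) →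
      det u v u′ ≡ 0ℚ → det u v v′ ≢ 0ℚ → Null (λ n → clamp (s′ n))
    close-at-start {u} {v} {cl} {s} {u′} {v′} {cl′} {s′} c a≡0 b≢0 =
      null-cancel-const {λ n → clamp (s′ n)} (det u v v′) b≢0 (null-cong eq (close-plane {u} {v} {cl} {s} {u′} {v′} {cl′} {s′} c))
      where
      lem : ∀ c b → (1ℚ - c) * 0ℚ + c * b ≡ b * c
      lem = solve-∀ ℚ-ring
      eq : ∀ n → combination s′ (det u v u′) (det u v v′) n ≡ det u v v′ * clamp (s′ n)
      eq n = trans (cong (λ a → (1ℚ - clamp (s′ n)) * a + clamp (s′ n) * det u v v′) a≡0) (lem (clamp (s′ n)) (det u v v′))

    close-at-end : ∀ {u v cl s u′ v′ cl′ s′} → Close (segment u v cl s) (segment u′ v′ cl′ s′) →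
      det u v v′ ≡ 0ℚ → det u v u′ ≢ 0ℚ → Null (λ n → 1ℚ - clamp (s′ n))
    close-at-end {u} {v} {cl} {s} {u′} {v′} {cl′} {s′} c b≡0 a≢0 =
      null-cancel-const {λ n → 1ℚ - clamp (s′ n)} (det u v u′) a≢0 (null-cong eq (close-plane {u} {v} {cl} {s} {u′} {v′} {cl′} {s′} c))
      where
      lem : ∀ c a → (1ℚ - c) * a + c * 0ℚ ≡ a * (1ℚ - c)
      lem = solve-∀ ℚ-ring
      eq : ∀ n → combination s′ (det u v u′) (det u v v′) n ≡ det u v u′ * (1ℚ - clamp (s′ n))
      eq n = trans (cong (λ b → (1ℚ - clamp (s′ n)) * det u v u′ + clamp (s′ n) * b) b≡0) (lem (clamp (s′ n)) (det u v u′))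

    combination-unique : ∀ s t {a b} → a - b ≢ 0ℚ → Null (combination s a b) → Null (combination t a b) →
      Null (λ n → clamp (s n) - clamp (t n))
    combination-unique s t {a} {b} a-b≢0 ns nt = null-cancel-const {λ n → clamp (s n) - clamp (t n)} (a - b) a-b≢0
      (null-cong (λ n → lem (clamp (s n)) (clamp (t n)) a b) (null-- {combination t a b} {combination s a b} nt ns))
      where
      lem : ∀ c d a b → ((1ℚ - d) * a + d * b) - ((1ℚ - c) * a + c * b) ≡ (a - b) * (c - d)
      lem = solve-∀ ℚ-ring

    -- The axis of the excluded cone. When `det pole u v` is nonzero, `det pole v` and `det pole u`
    -- are, up to factors, the basis dual to u, v: they read off the coefficients of a combination
    -- of u and v.
    pole : ℚ³
    pole = ⟨ 0ℚ , 0ℚ , 1ℚ ⟩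

    det-pole-start : ∀ u v t → det pole v (mix u v t) ≡ (1ℚ - t) * det pole v u
    det-pole-start u v t = trans (det-mix pole v u v t)
      (trans (cong (λ d → (1ℚ - t) * det pole v u + t * d) (det-repeat₂ pole v)) (lem t (det pole v u)))
      where lem : ∀ t a → (1ℚ - t) * a + t * 0ℚ ≡ (1ℚ - t) * a
            lem = solve-∀ ℚ-ring

    det-pole-end : ∀ u v t → det pole u (mix u v t) ≡ t * det pole u v
    det-pole-end u v t = trans (det-mix pole u u v t)
      (trans (cong (λ d → (1ℚ - t) * d + t * det pole u v) (det-repeat₂ pole u)) (lem t (det pole u v)))
      where lem : ∀ t a → (1ℚ - t) * 0ℚ + t * a ≡ t * a
            lem = solve-∀ ℚ-ring

    det-pole-swap : ∀ u v → det pole v u ≡ - det pole u v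
    det-pole-swap u v = trans (det-rotate pole v u) (trans (det-swap v u pole) (cong -_ (sym (det-rotate pole u v))))

    -- The dual functionals show that r (1 - c) and r c agree for both tracks, where r is the ratio
    -- and c the clamped parameter. Their sum gives agreement of r, and then of c.
    close-injective : ∀ {u v cl s t} → det pole u v ≢ 0ℚ → Close (segment u v cl s) (segment u v cl t) →
      Null (λ n → clamp (s n) - clamp (t n))
    close-injective {u} {v} {cl} {s} {t} d≢0 c =
      null-cancel-ratio (segment u v cl s) {λ n → clamp (s n) - clamp (t n)}
        (null-cong (λ n → lem₄ (r n) (clamp (s n)) (r′ n) (clamp (t n)))
          (null-+ {λ n → r n * clamp (s n) - r′ n * clamp (t n)} {λ n → clamp (t n) * (r′ n - r n)} stop′
            (null-*ˡ {λ n → clamp (t n)} {λ n → r′ n - r n} (bound clamp-lipschitz) (λ n → bounded clamp-lipschitz (t n)) radii)))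
      where
      r r′ : ℕ → ℚ
      r = ratio (segment u v cl s)
      r′ = ratio (segment u v cl t)
      d = det pole u v
      lem₁ : ∀ r c r′ c′ d → r * (c * d) - r′ * (c′ * d) ≡ d * (r * c - r′ * c′)
      lem₁ = solve-∀ ℚ-ring
      lem₂ : ∀ r c r′ c′ d → r * ((1ℚ - c) * (- d)) - r′ * ((1ℚ - c′) * (- d)) ≡ d * (r′ * (1ℚ - c′) - r * (1ℚ - c))
      lem₂ = solve-∀ ℚ-ring
      lem₃ : ∀ r c r′ c′ → (r′ * (1ℚ - c′) - r * (1ℚ - c)) - (r * c - r′ * c′) ≡ r′ - r
      lem₃ = solve-∀ ℚ-ring
      lem₄ : ∀ r c r′ c′ → (r * c - r′ * c′) + c′ * (r′ - r) ≡ r * (c - c′)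
      lem₄ = solve-∀ ℚ-ring
      stop′ : Null (λ n → r n * clamp (s n) - r′ n * clamp (t n))
      stop′ = null-cancel-const {λ n → r n * clamp (s n) - r′ n * clamp (t n)} d d≢0
        (null-cong (λ n → trans (cong₂ (λ a b → r n * a - r′ n * b) (det-pole-end u v (clamp (s n))) (det-pole-end u v (clamp (t n))))
                                (lem₁ (r n) (clamp (s n)) (r′ n) (clamp (t n)) d))
          (det-close {segment u v cl s} {segment u v cl t} c pole u))
      start′ : Null (λ n → r′ n * (1ℚ - clamp (t n)) - r n * (1ℚ - clamp (s n)))
      start′ = null-cancel-const {λ n → r′ n * (1ℚ - clamp (t n)) - r n * (1ℚ - clamp (s n))} d d≢0
        (null-cong (λ n → trans (cong₂ (λ a b → r n * a - r′ n * b) (eq (s n)) (eq (t n)))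
                                (lem₂ (r n) (clamp (s n)) (r′ n) (clamp (t n)) d))
          (det-close {segment u v cl s} {segment u v cl t} c pole v))
        where
        eq : ∀ q → det pole v (mix u v (clamp q)) ≡ (1ℚ - clamp q) * (- d)
        eq q = trans (det-pole-start u v (clamp q)) (cong ((1ℚ - clamp q) *_) (det-pole-swap u v))
      radii : Null (λ n → r′ n - r n)
      radii = null-cong (λ n → lem₃ (r n) (clamp (s n)) (r′ n) (clamp (t n)))
        (null-- {λ n → r′ n * (1ℚ - clamp (t n)) - r n * (1ℚ - clamp (s n))} {λ n → r n * clamp (s n) - r′ n * clamp (t n)} start′ stop′)

    -- A nonnegative combination of u and v is never a nonnegative combination of -u and -v.
    ¬close-opposite : ∀ {u v cl s} g {a b : ℕ → ℚ} → det pole u v ≢ 0ℚ → (∀ n → 0ℚ ≤ a n) → (∀ n → 0ℚ ≤ b n) →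
      (∀ n → det pole v (vec g n) ≡ - (a n * det pole v u)) → (∀ n → det pole u (vec g n) ≡ - (b n * det pole u v)) →
      ¬ Close (segment u v cl s) g
    ¬close-opposite {u} {v} {cl} {s} g {a} {b} d≢0 0≤a 0≤b φ ψ c = ¬null-ratio (segment u v cl s)
      (null-cong (λ n → lem (r n) (clamp (s n))) (null-+ {λ n → r n * (1ℚ - clamp (s n))} {λ n → r n * clamp (s n)}
        (part (det pole v u) (λ e → d≢0 (trans (sym (neg-neg (det pole u v))) (trans (cong -_ (trans (sym (det-pole-swap u v)) e)) refl)))
              (λ n → 1ℚ - clamp (s n)) a (λ n → 0≤1-clamp (s n)) 0≤a v (λ n → det-pole-start u v (clamp (s n))) φ)
        (part (det pole u v) d≢0 (λ n → clamp (s n)) b (λ n → 0≤clamp (s n)) 0≤b u (λ n → det-pole-end u v (clamp (s n))) ψ)))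
      where
      r = ratio (segment u v cl s)
      lem : ∀ r c → r * (1ℚ - c) + r * c ≡ r
      lem = solve-∀ ℚ-ring
      lem′ : ∀ r c r′ a d → r * (c * d) - r′ * (- (a * d)) ≡ d * (r * c + r′ * a)
      lem′ = solve-∀ ℚ-ring
      part : ∀ d → d ≢ 0ℚ → ∀ (c₁ c₂ : ℕ → ℚ) → (∀ n → 0ℚ ≤ c₁ n) → (∀ n → 0ℚ ≤ c₂ n) → ∀ w →
        (∀ n → det pole w (mix u v (clamp (s n))) ≡ c₁ n * d) → (∀ n → det pole w (vec g n) ≡ - (c₂ n * d)) →
        Null (λ n → r n * c₁ n)
      part d d≢0 c₁ c₂ 0≤c₁ 0≤c₂ w e₁ e₂ = null-nonneg-sum {λ n → r n * c₁ n} {λ n → ratio g n * c₂ n}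
        (λ n → *-nonneg (0≤ratio (segment u v cl s) n) (0≤c₁ n)) (λ n → *-nonneg (0≤ratio g n) (0≤c₂ n))
        (null-cancel-const {λ n → r n * c₁ n + ratio g n * c₂ n} d d≢0
          (null-cong (λ n → trans (cong₂ (λ p q → r n * p - ratio g n * q) (e₁ n) (e₂ n)) (lem′ (r n) (c₁ n) (ratio g n) (c₂ n) d))
            (det-close {segment u v cl s} {g} c pole w)))

    -- Two edges with pairwise antipodal ends lie on one great circle, so no determinant of three of
    -- their ends can tell them apart; but they occupy opposite arcs.
    ¬close-antipodal : ∀ {u v cl cl′ s s′} → det pole u v ≢ 0ℚ → ¬ Close (segment u v cl s) (segment (neg³ v) (neg³ u) cl′ s′)
    ¬close-antipodal {u} {v} {cl} {cl′} {s} {s′} d≢0 = ¬close-opposite {u} {v} {cl} {s} (segment (neg³ v) (neg³ u) cl′ s′)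
      {λ n → clamp (s′ n)} {λ n → 1ℚ - clamp (s′ n)} d≢0 (λ n → 0≤clamp (s′ n)) (λ n → 0≤1-clamp (s′ n))
      (λ n → trans (det-mix pole v (neg³ v) (neg³ u) (clamp (s′ n)))
        (trans (cong₂ (λ p q → (1ℚ - clamp (s′ n)) * p + clamp (s′ n) * q) (zero′ v) (det-neg pole v u)) (lem₁ (clamp (s′ n)) (det pole v u))))
      (λ n → trans (det-mix pole u (neg³ v) (neg³ u) (clamp (s′ n)))
        (trans (cong₂ (λ p q → (1ℚ - clamp (s′ n)) * p + clamp (s′ n) * q) (det-neg pole u v) (zero′ u)) (lem₂ (clamp (s′ n)) (det pole u v))))
      where
      zero′ : ∀ w → det pole w (neg³ w) ≡ 0ℚ
      zero′ w = trans (det-neg pole w w) (cong -_ (det-repeat₂ pole w))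
      lem₁ : ∀ c d → (1ℚ - c) * 0ℚ + c * (- d) ≡ - (c * d)
      lem₁ = solve-∀ ℚ-ring
      lem₂ : ∀ c d → (1ℚ - c) * (- d) + c * 0ℚ ≡ - ((1ℚ - c) * d)
      lem₂ = solve-∀ ℚ-ring

    ¬close-neg-start : ∀ {u v cl s h} → det pole u v ≢ 0ℚ → ¬ Close (segment u v cl s) (constant (neg³ u) h)
    ¬close-neg-start {u} {v} {cl} {s} {h} d≢0 = ¬close-opposite {u} {v} {cl} {s} (constant (neg³ u) h)
      {λ _ → 1ℚ} {λ _ → 0ℚ} d≢0 (λ _ → 0≤1) (λ _ → ≤-refl)
      (λ _ → trans (det-neg pole v u) (cong -_ (sym (*-identityˡ (det pole v u)))))
      (λ _ → trans (det-neg pole u u) (cong -_ (trans (det-repeat₂ pole u) (sym (*-zeroˡ (det pole u v))))))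

    ¬close-neg-end : ∀ {u v cl s h} → det pole u v ≢ 0ℚ → ¬ Close (segment u v cl s) (constant (neg³ v) h)
    ¬close-neg-end {u} {v} {cl} {s} {h} d≢0 = ¬close-opposite {u} {v} {cl} {s} (constant (neg³ v) h)
      {λ _ → 0ℚ} {λ _ → 1ℚ} d≢0 (λ _ → ≤-refl) (λ _ → 0≤1)
      (λ _ → trans (det-neg pole v v) (cong -_ (trans (det-repeat₂ pole v) (sym (*-zeroˡ (det pole v u))))))
      (λ _ → trans (det-neg pole u v) (cong -_ (sym (*-identityˡ (det pole u v)))))

    -- Two great circles meet in two antipodal points, and each arc might contain a different one.
    -- When the plane through v and v′ separates u from u′, it separates the two arcs except for
    -- these ends; a common point must then lie in that plane, which the first arc reaches only at
    -- v.
    close-facing : ∀ {u v cl s u′ v′ cl′ s′} → Close (segment u v cl s) (segment u′ v′ cl′ s′) →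
      ∀ σ → HasSign σ (det v v′ u) → HasSign (Sign.opposite σ) (det v v′ u′) → Null (λ n → 1ℚ - clamp (s n))
    close-facing {u} {v} {cl} {s} {u′} {v′} {cl′} {s′} c = λ where
        Sign.+ a b → null-cancel-const {λ n → 1ℚ - clamp (s n)} A (sign⇒≢0 Sign.+ a)
          (cancel A B (<⇒≤ a) (<⇒≤ b) (null-cong (λ n → lem₁ (r n) (1ℚ - clamp (s n)) A (r′ n) (1ℚ - clamp (s′ n)) B) difference))
        Sign.- a b → null-cancel-const {λ n → 1ℚ - clamp (s n)} (- A) (λ e → sign⇒≢0 Sign.- a (trans (sym (neg-neg A)) (cong -_ e)))
          (cancel (- A) (- B) (<⇒≤ a) (subst (0ℚ ≤_) (sym (neg-neg B)) (<⇒≤ b))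
            (null-cong (λ n → lem₂ (r n) (1ℚ - clamp (s n)) A (r′ n) (1ℚ - clamp (s′ n)) B)
              (null-neg {λ n → r n * ((1ℚ - clamp (s n)) * A) - r′ n * ((1ℚ - clamp (s′ n)) * B)} difference)))
      where
      A = det v v′ u
      B = det v v′ u′
      r r′ : ℕ → ℚ
      r = ratio (segment u v cl s)
      r′ = ratio (segment u′ v′ cl′ s′)
      lem₁ : ∀ r c a r′ c′ b → r * (c * a) - r′ * (c′ * b) ≡ r * (a * c) + r′ * (c′ * (- b))
      lem₁ = solve-∀ ℚ-ring
      lem₂ : ∀ r c a r′ c′ b → - (r * (c * a) - r′ * (c′ * b)) ≡ r * ((- a) * c) + r′ * (c′ * (- - b))
      lem₂ = solve-∀ ℚ-ring
      lem₃ : ∀ c a → (1ℚ - c) * a + c * 0ℚ ≡ (1ℚ - c) * a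
      lem₃ = solve-∀ ℚ-ring
      zeroᵥ : det v v′ v ≡ 0ℚ
      zeroᵥ = det-repeat₁ v v′
      zeroᵥ′ : det v v′ v′ ≡ 0ℚ
      zeroᵥ′ = det-repeat₂ v v′
      difference : Null (λ n → r n * ((1ℚ - clamp (s n)) * A) - r′ n * ((1ℚ - clamp (s′ n)) * B))
      difference = null-cong (λ n → cong₂ (λ p q → r n * p - r′ n * q)
          (trans (det-mix v v′ u v (clamp (s n))) (trans (cong (λ d → (1ℚ - clamp (s n)) * A + clamp (s n) * d) zeroᵥ) (lem₃ (clamp (s n)) A)))
          (trans (det-mix v v′ u′ v′ (clamp (s′ n))) (trans (cong (λ d → (1ℚ - clamp (s′ n)) * B + clamp (s′ n) * d) zeroᵥ′) (lem₃ (clamp (s′ n)) B))))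
        (det-close {segment u v cl s} {segment u′ v′ cl′ s′} c v v′)
      cancel : ∀ a b → 0ℚ ≤ a → 0ℚ ≤ - b → Null (λ n → r n * (a * (1ℚ - clamp (s n))) + r′ n * ((1ℚ - clamp (s′ n)) * (- b))) →
        Null (λ n → a * (1ℚ - clamp (s n)))
      cancel a b 0≤a 0≤-b nf = null-cancel-ratio (segment u v cl s) {λ n → a * (1ℚ - clamp (s n))}
        (null-nonneg-sum {λ n → r n * (a * (1ℚ - clamp (s n)))} {λ n → r′ n * ((1ℚ - clamp (s′ n)) * (- b))}
          (λ n → *-nonneg (0≤ratio (segment u v cl s) n) (*-nonneg 0≤a (0≤1-clamp (s n))))
          (λ n → *-nonneg (0≤ratio (segment u′ v′ cl′ s′) n) (*-nonneg (0≤1-clamp (s′ n)) 0≤-b)) nf)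

-- Orientations of triples of points, and the distance of the edges from the cone.

module Configurations where
  open import Data.Nat as ℕ using (ℕ; zero; suc)
  import Data.Nat.Properties as ℕₚ
  open import Data.Bool using (Bool; true; false)
  open import Data.Rational hiding (_≃_)
  open import Data.Rational.Properties
  open import Data.Product using (_×_; _,_; proj₁; proj₂)
  open import Data.Sum using (inj₁; inj₂)
  open import Data.Empty using (⊥-elim)
  open import Data.Sign as Sign using (Sign; opposite)
  open import Relation.Nullary using (yes; no)
  open import Relation.Binary.PropositionalEquality
  open import Relation.Binary.Definitions using (tri<; tri≈; tri>)
  open import Tactic.RingSolver using (solve-∀)
  open Analysis
  open Vectors

  open Null
  open Lipschitz
  open ℚ³

  Point : Set
  Point = ℕ × Bool

  idx : Point → ℕ
  idx = proj₁

  bit : Point → Bool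
  bit = proj₂

  below : ℕ → ℕ → Sign
  below i j with i ℕ.<? j
  ... | yes _ = Sign.+
  ... | no _  = Sign.-

  -- For different indices this is the sign of the permutation that sorts them, which is the
  -- orientation of three points of the moment curve.
  order : ℕ → ℕ → ℕ → Sign
  order i j k = below i j Sign.* (below j k Sign.* below i k)

  bit-sign : Bool → Sign
  bit-sign false = Sign.+
  bit-sign true  = Sign.-

  -- The sign of det (w p) (w q) (w r), when `side k r` is its sign for the two points p, q with index k.
  orientation : (ℕ → Point → Sign) → Point → Point → Point → Sign
  orientation side p q r with idx p ℕ.≟ idx q | idx q ℕ.≟ idx r | idx p ℕ.≟ idx r
  ... | yes _ | _     | _     = bit-sign (bit p) Sign.* side (idx p) r
  ... | no _  | yes _ | _     = bit-sign (bit q) Sign.* side (idx q) p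
  ... | no _  | no _  | yes _ = bit-sign (bit r) Sign.* side (idx p) q
  ... | no _  | no _  | no _  = order (idx p) (idx q) (idx r)

  record Configuration : Set where
    field
      abscissa height : Point → ℚ

    w : Point → ℚ³
    w p = ⟨ 1ℚ , abscissa p , height p ⟩

    field
      side      : ℕ → Point → Sign
      -- A fixed gap instead of a strict inequality: it yields the quantitative clearance from the
      -- cone. Twins may share an abscissa, since no edge joins them.
      apart     : ∀ p q → idx p ℕ.< idx q → abscissa p + 1ℚ ≤ abscissa q
      twins     : ∀ k → w (k , false) ≢ w (k , true)
      ordered   : ∀ p q r → idx p ℕ.< idx q → idx q ℕ.< idx r → 0ℚ < det (w p) (w q) (w r)
      side-sign : ∀ k r → k ≢ idx r → HasSign (side k r) (det (w (k , false)) (w (k , true)) (w r))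

  hasSign-neg : ∀ s {d} → HasSign s d → HasSign (opposite s) (- d)
  hasSign-neg Sign.+ {d} h = subst (0ℚ <_) (sym (neg-neg d)) h
  hasSign-neg Sign.- h = h

  below-< : ∀ {i j} → i ℕ.< j → below i j ≡ Sign.+
  below-< {i} {j} i<j with i ℕ.<? j
  ... | yes _ = refl
  ... | no ¬p = ⊥-elim (¬p i<j)

  below-> : ∀ {i j} → j ℕ.< i → below i j ≡ Sign.-
  below-> {i} {j} j<i with i ℕ.<? j
  ... | yes i<j = ⊥-elim (ℕₚ.<-asym i<j j<i)
  ... | no _ = refl

  module Orientation (C : Configuration) where
    open Configuration C

    χ : Point → Point → Point → Sign
    χ = orientation side

    D : Point → Point → Point → ℚ
    D p q r = det (w p) (w q) (w r)

    sign-rotate : ∀ s p q r → HasSign s (D p q r) → HasSign s (D q r p)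
    sign-rotate s p q r = subst (HasSign s) (det-rotate (w p) (w q) (w r))

    sign-swap : ∀ s p q r → HasSign s (D p q r) → HasSign (opposite s) (D q p r)
    sign-swap s p q r h = subst (HasSign (opposite s)) (trans (cong -_ (det-swap (w p) (w q) (w r))) (neg-neg (D q p r))) (hasSign-neg s h)

    -- Each of the six orders is brought to `ordered` by rotations, which keep the determinant, and
    -- at most one swap, which negates it.
    order-sign : ∀ p q r → idx p ≢ idx q → idx q ≢ idx r → idx p ≢ idx r →
      HasSign (order (idx p) (idx q) (idx r)) (D p q r)
    order-sign p q r p≢q q≢r p≢r with ℕₚ.<-cmp (idx p) (idx q) | ℕₚ.<-cmp (idx q) (idx r) | ℕₚ.<-cmp (idx p) (idx r)
    ... | tri≈ _ e _ | _ | _ = ⊥-elim (p≢q e)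
    ... | tri< _ _ _ | tri≈ _ e _ | _ = ⊥-elim (q≢r e)
    ... | tri> _ _ _ | tri≈ _ e _ | _ = ⊥-elim (q≢r e)
    ... | tri< _ _ _ | tri< _ _ _ | tri≈ _ e _ = ⊥-elim (p≢r e)
    ... | tri< _ _ _ | tri> _ _ _ | tri≈ _ e _ = ⊥-elim (p≢r e)
    ... | tri> _ _ _ | tri< _ _ _ | tri≈ _ e _ = ⊥-elim (p≢r e)
    ... | tri> _ _ _ | tri> _ _ _ | tri≈ _ e _ = ⊥-elim (p≢r e)
    ... | tri< a _ _ | tri< b _ _ | tri> _ _ c = ⊥-elim (ℕₚ.<-asym (ℕₚ.<-trans a b) c)
    ... | tri> _ _ a | tri> _ _ b | tri< c _ _ = ⊥-elim (ℕₚ.<-asym (ℕₚ.<-trans b a) c)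
    ... | tri< a _ _ | tri< b _ _ | tri< c _ _ rewrite below-< a | below-< b | below-< c = ordered p q r a b
    ... | tri< a _ _ | tri> _ _ b | tri< c _ _ rewrite below-< a | below-> b | below-< c =
      sign-swap Sign.+ q p r (sign-rotate Sign.+ r q p (sign-rotate Sign.+ p r q (ordered p r q c b)))
    ... | tri< a _ _ | tri> _ _ b | tri> _ _ c rewrite below-< a | below-> b | below-> c =
      sign-rotate Sign.+ r p q (ordered r p q c a)
    ... | tri> _ _ a | tri< b _ _ | tri< c _ _ rewrite below-> a | below-< b | below-< c =
      sign-swap Sign.+ q p r (ordered q p r a c)
    ... | tri> _ _ a | tri< b _ _ | tri> _ _ c rewrite below-> a | below-< b | below-> c =
      sign-rotate Sign.+ r p q (sign-rotate Sign.+ q r p (ordered q r p b c))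
    ... | tri> _ _ a | tri> _ _ b | tri> _ _ c rewrite below-> a | below-> b | below-> c =
      sign-swap Sign.+ q p r (sign-rotate Sign.+ r q p (ordered r q p b a))

    twins-sign : ∀ k b c r → b ≢ c → (k , b) ≢ r → (k , c) ≢ r → HasSign (bit-sign b Sign.* side k r) (D (k , b) (k , c) r)
    twins-sign k false false r b≢c _ _ = ⊥-elim (b≢c refl)
    twins-sign k true true r b≢c _ _ = ⊥-elim (b≢c refl)
    twins-sign k false true r _ p≢r q≢r = side-sign k r (other r p≢r q≢r)
      where
      other : ∀ r → (k , false) ≢ r → (k , true) ≢ r → k ≢ idx r
      other (_ , false) p≢r _ refl = p≢r refl
      other (_ , true) _ q≢r refl = q≢r refl
    twins-sign k true false r b≢c p≢r q≢r = sign-swap (side k r) (k , false) (k , true) r (twins-sign k false true r (λ ()) q≢r p≢r)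

    orientation-sign : ∀ p q r → p ≢ q → q ≢ r → p ≢ r → HasSign (χ p q r) (D p q r)
    orientation-sign p@(i , b) q@(j , c) r@(k , d) p≢q q≢r p≢r with i ℕ.≟ j | j ℕ.≟ k | i ℕ.≟ k
    ... | no i≢j | no j≢k | no i≢k = order-sign p q r i≢j j≢k i≢k
    ... | yes refl | _ | _ = twins-sign i b c r (λ { refl → p≢q refl }) p≢r q≢r
    ... | no _ | yes refl | _ = sign-rotate _ r p q (sign-rotate _ q r p
      (twins-sign j c d p (λ { refl → q≢r refl }) (λ e → p≢q (sym e)) (λ e → p≢r (sym e))))
    ... | no _ | no _ | yes refl = sign-rotate _ r p q
      (twins-sign i d b q (λ { refl → p≢r refl }) (λ e → q≢r (sym e)) p≢q)

  record Bounded (f : Point → ℚ) (n : ℕ) : Set where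
    field
      size    : ℚ
      0≤size  : 0ℚ ≤ size
      bounds  : ∀ p → idx p ℕ.< n → ∣ f p ∣ ≤ size

  open Bounded

  bounded-below : ∀ f n → Bounded f n
  bounded-below f zero = record { size = 0ℚ ; 0≤size = ≤-refl ; bounds = λ _ () }
  bounded-below f (suc n) = record
    { size = s + (a + b) ; 0≤size = +-nonneg (0≤size rest) 0≤a+b ; bounds = bd }
    where
    rest = bounded-below f n
    s = size rest
    a = ∣ f (n , false) ∣
    b = ∣ f (n , true) ∣
    0≤a+b : 0ℚ ≤ a + b
    0≤a+b = +-nonneg (0≤∣p∣ (f (n , false))) (0≤∣p∣ (f (n , true)))
    last : ∀ c → ∣ f (n , c) ∣ ≤ a + b
    last false = p≤p+q {a} {b} (0≤∣p∣ (f (n , true)))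
    last true = subst (b ≤_) (+-comm b a) (p≤p+q {b} {a} (0≤∣p∣ (f (n , false))))
    bd : ∀ p → idx p ℕ.< suc n → ∣ f p ∣ ≤ s + (a + b)
    bd (i , c) (ℕ.s≤s i≤n) with ℕₚ.m≤n⇒m<n∨m≡n i≤n
    ... | inj₁ i<n = ≤-trans (bounds rest (i , c) i<n) (p≤p+q {s} {a + b} 0≤a+b)
    ... | inj₂ refl = ≤-trans (last c) (subst (a + b ≤_) (+-comm (a + b) s) (p≤p+q {a + b} {s} (0≤size rest)))

  signed : Sign → ℚ³ → ℚ³
  signed Sign.+ v = v
  signed Sign.- v = neg³ v

  signed-opposite : ∀ s v → signed (opposite s) v ≡ neg³ (signed s v)
  signed-opposite Sign.+ v = refl
  signed-opposite Sign.- ⟨ a , b , c ⟩ = sym (cong₂ (λ p (q , r) → ⟨ p , q , r ⟩) (neg-neg a) (cong₂ _,_ (neg-neg b) (neg-neg c)))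

  det-signed : ∀ s t r {p q v} σ → HasSign σ (det p q v) → HasSign (s Sign.* (t Sign.* (r Sign.* σ))) (det (signed s p) (signed t q) (signed r v))
  det-signed s t r {p} {q} {v} σ h = rotated s (signed t q) (signed r v) p _
    (rotated t (signed r v) p q _ (rotated r p q v σ h))
    where
    last : ∀ s p q v σ → HasSign σ (det p q v) → HasSign (s Sign.* σ) (det p q (signed s v))
    last Sign.+ p q v σ h = h
    last Sign.- p q v σ h = subst (HasSign (opposite σ)) (sym (det-neg p q v)) (hasSign-neg σ h)
    rotated : ∀ s p q v σ → HasSign σ (det p q v) → HasSign (s Sign.* σ) (det (signed s v) p q)
    rotated s p q v σ h = subst (HasSign (s Sign.* σ)) (sym (det-rotate (signed s v) p q)) (last s p q v σ h)

  -- If y u = a x u and y v = b x v, then b x - y and y - a x on the segment are (1 - t) and t times ± (b - a), so that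
  -- |x| + |y| cannot be small.
  module Clearance (K Z : ℚ) (1≤K : 1ℚ ≤ K) (0≤Z : 0ℚ ≤ Z) where

    -- Once (K + K)(|x| + |y|) is at least 1, this factor lifts the cone to height at least 1 + Z,
    -- hence at least 1 above every vector of height at most Z. That is the content of `deep`.
    height-factor : ℚ
    height-factor = (1ℚ + Z) * (K + K)

    open Projection height-factor

    private
      0≤1+Z : 0ℚ ≤ 1ℚ + Z
      0≤1+Z = +-nonneg 0≤1 0≤Z

      0≤K : 0ℚ ≤ K
      0≤K = ≤-trans 0≤1 1≤K

      deep : ∀ v → 1ℚ ≤ (K + K) * (∣ x v ∣ + ∣ y v ∣) → z v ≤ Z → 1ℚ ≤ depth v
      deep v h z≤Z = 0≤q-p⇒p≤q {1ℚ} {depth v} (subst (0ℚ ≤_) (lem K Z (∣ x v ∣ + ∣ y v ∣) (z v))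
        (+-nonneg (*-nonneg 0≤1+Z (p≤q⇒0≤q-p h)) (p≤q⇒0≤q-p z≤Z)))
        where lem : ∀ k a m c → (1ℚ + a) * ((k + k) * m - 1ℚ) + (a - c) ≡ (1ℚ + a) * (k + k) * m - c - 1ℚ
              lem = solve-∀ ℚ-ring

      spread : ∀ c X Y → ∣ c ∣ ≤ K → ∣ c * X - Y ∣ ≤ K * (∣ X ∣ + ∣ Y ∣)
      spread c X Y c≤K = subst (∣ c * X - Y ∣ ≤_) (sym (*-distribˡ-+ K ∣ X ∣ ∣ Y ∣))
        (∣p+q∣≤ {c * X} { - Y} (∣p*q∣≤ {c} {X} c≤K ≤-refl)
          (subst₂ _≤_ (sym (∣-p∣≡∣p∣ Y)) refl (subst (_≤ K * ∣ Y ∣) (*-identityˡ ∣ Y ∣) (*-monoʳ-≤-nonNeg ∣ Y ∣ {{∣-∣-nonNeg Y}} 1≤K))))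

    clear-vertex : ∀ v → ∣ x v ∣ ≡ 1ℚ → z v ≤ Z → 1ℚ ≤ depth v
    clear-vertex v ∣x∣≡1 = deep v (≤-trans 1≤K (≤-trans (p≤p+q {K} {K} 0≤K)
      (subst (_≤ (K + K) * (∣ x v ∣ + ∣ y v ∣)) (*-identityʳ (K + K))
        (*-monoˡ {K + K} {1ℚ} {∣ x v ∣ + ∣ y v ∣} (+-nonneg 0≤K 0≤K)
          (subst (λ m → 1ℚ ≤ m + ∣ y v ∣) (sym ∣x∣≡1) (p≤p+q {1ℚ} {∣ y v ∣} (0≤∣p∣ (y v))))))))

    clear-segment : ∀ u v a b → ∣ x u ∣ ≡ 1ℚ → ∣ x v ∣ ≡ 1ℚ → y u ≡ a * x u → y v ≡ b * x v →
      1ℚ ≤ ∣ b - a ∣ → ∣ a ∣ ≤ K → ∣ b ∣ ≤ K → z u ≤ Z → z v ≤ Z → Clear u v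
    clear-segment u v a b ∣xu∣ ∣xv∣ yu yv 1≤d a≤K b≤K zu zv t 0≤t t≤1 = deep m wide flat
      where
      m = mix u v t
      X = x m
      Y = y m
      d = ∣ b - a ∣
      0≤1-t : 0ℚ ≤ 1ℚ - t
      0≤1-t = p≤q⇒0≤q-p t≤1
      lem₁ : ∀ a b p q t → b * (p + t * (q - p)) - (a * p + t * (b * q - a * p)) ≡ (1ℚ - t) * (p * (b - a))
      lem₁ = solve-∀ ℚ-ring
      lem₂ : ∀ a b p q t → a * (p + t * (q - p)) - (a * p + t * (b * q - a * p)) ≡ - (t * (q * (b - a)))
      lem₂ = solve-∀ ℚ-ring
      Y≡ : Y ≡ a * x u + t * (b * x v - a * x u)
      Y≡ = cong₂ (λ p q → p + t * (q - p)) yu yv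
      abs : ∀ c e → 0ℚ ≤ c → ∣ e ∣ ≡ 1ℚ → ∣ c * (e * (b - a)) ∣ ≡ c * d
      abs c e 0≤c e≡1 = trans (∣p*q∣≡∣p∣*∣q∣ c (e * (b - a))) (cong₂ _*_ (0≤p⇒∣p∣≡p 0≤c)
        (trans (∣p*q∣≡∣p∣*∣q∣ e (b - a)) (trans (cong (_* d) e≡1) (*-identityˡ d))))
      first : (1ℚ - t) * d ≤ K * (∣ X ∣ + ∣ Y ∣)
      first = subst (_≤ K * (∣ X ∣ + ∣ Y ∣)) (trans (cong ∣_∣ (trans (cong (λ q → b * X - q) Y≡) (lem₁ a b (x u) (x v) t)))
        (abs (1ℚ - t) (x u) 0≤1-t ∣xu∣)) (spread b X Y b≤K)
      second : t * d ≤ K * (∣ X ∣ + ∣ Y ∣)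
      second = subst (_≤ K * (∣ X ∣ + ∣ Y ∣)) (trans (cong ∣_∣ (trans (cong (λ q → a * X - q) Y≡) (lem₂ a b (x u) (x v) t)))
        (trans (∣-p∣≡∣p∣ (t * (x v * (b - a)))) (abs t (x v) 0≤t ∣xv∣))) (spread a X Y a≤K)
      lem₃ : ∀ t d → (1ℚ - t) * d + t * d ≡ d
      lem₃ = solve-∀ ℚ-ring
      wide : 1ℚ ≤ (K + K) * (∣ X ∣ + ∣ Y ∣)
      wide = ≤-trans 1≤d (subst₂ _≤_ (lem₃ t d) (sym (*-distribʳ-+ (∣ X ∣ + ∣ Y ∣) K K)) (+-mono-≤ first second))
      lem₄ : ∀ c p q t → (1ℚ - t) * (c - p) + t * (c - q) ≡ c - (p + t * (q - p))
      lem₄ = solve-∀ ℚ-ring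
      flat : z m ≤ Z
      flat = 0≤q-p⇒p≤q {z m} {Z} (subst (0ℚ ≤_) (lem₄ Z (z u) (z v) t)
        (+-nonneg (*-nonneg 0≤1-t (p≤q⇒0≤q-p zu)) (*-nonneg 0≤t (p≤q⇒0≤q-p zv))))

-- The drawing, its arcs and the sign conditions for a crossing.

module Drawings where
  open import Data.Nat as ℕ using (ℕ; zero; suc)
  import Data.Nat.Properties as ℕₚ
  open import Data.Fin using (Fin; zero; suc; toℕ)
  import Data.Fin.Properties as Finₚ
  open import Data.Bool as Bool using (Bool; true; false)
  import Data.Product.Properties as Productₚ
  open import Data.Rational hiding (_≃_)
  open import Data.Rational.Properties
  open import Data.Product using (Σ; ∃-syntax; _×_; _,_; proj₁; proj₂) renaming (swap to ×-swap)
  open import Data.Sum as Sum using (_⊎_; inj₁; inj₂; swap)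
  open import Data.List using (List; length; lookup)
  open import Data.List.Relation.Unary.Any using (index)
  open import Data.List.Relation.Unary.Any.Properties using (lookup-index)
  open import Data.List.Membership.Propositional using (_∈_)
  open import Data.Empty using (⊥; ⊥-elim)
  open import Data.Sign as Sign using (Sign; opposite)
  import Data.Sign.Properties as Signₚ
  open import Relation.Nullary using (¬_; Dec; yes; no)
  open import Relation.Nullary.Decidable using (decidable-stable; recompute; ¬?; _→-dec_; from-yes)
  open import Relation.Binary.PropositionalEquality
  open import Relation.Binary.Definitions using (tri<; tri≈; tri>)
  open import Tactic.RingSolver using (solve-∀)
  open Analysis
  open Vectors
  open Configurations

  open Null
  open Lipschitz
  open ℚ³
  open Bounded

  parity : ℕ → Sign
  parity zero = Sign.+
  parity (suc n) = opposite (parity n)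

  -- C₄ is the complete bipartite graph between {0, 2} and {1, 3}.
  class : Fin 4 → Sign
  class zero = Sign.+
  class (suc zero) = Sign.-
  class (suc (suc zero)) = Sign.+
  class (suc (suc (suc zero))) = Sign.-

  copy : Fin 4 → Bool
  copy zero = false
  copy (suc zero) = false
  copy (suc (suc zero)) = true
  copy (suc (suc (suc zero))) = true

  class-copy-injective : ∀ a b → class a ≡ class b → copy a ≡ copy b → a ≡ b
  class-copy-injective a b p q = trans (sym (inverse a)) (trans (cong₂ vertex p q) (inverse b))
    where
    vertex : Sign → Bool → Fin 4
    vertex Sign.+ false = zero
    vertex Sign.- false = suc zero
    vertex Sign.+ true = suc (suc zero)
    vertex Sign.- true = suc (suc (suc zero))
    inverse : ∀ a → vertex (class a) (copy a) ≡ a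
    inverse zero = refl
    inverse (suc zero) = refl
    inverse (suc (suc zero)) = refl
    inverse (suc (suc (suc zero))) = refl

  C₄-bipartite : ∀ a b → SimpleGraph._~_ C₄ a b → class b ≡ opposite (class a)
  C₄-bipartite a b (inj₁ p) = next a b p
    where
    next : ∀ a b → toℕ b ≡ suc (toℕ a) ℕ.% 4 → class b ≡ opposite (class a)
    next zero (suc zero) _ = refl
    next (suc zero) (suc (suc zero)) _ = refl
    next (suc (suc zero)) (suc (suc (suc zero))) _ = refl
    next (suc (suc (suc zero))) zero _ = refl
  C₄-bipartite a b (inj₂ p) = trans (sym (Signₚ.opposite-involutive (class b))) (cong opposite (sym (C₄-bipartite b a (inj₁ p))))

  -- Sign identities in up to eight variables are decided by trying all cases, and `from-yes` turns
  -- the decision into a proof.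
  ∀-sign? : ∀ {P : Sign → Set} → (∀ s → Dec (P s)) → Dec (∀ s → P s)
  ∀-sign? P? with P? Sign.+ | P? Sign.-
  ... | yes p | yes q = yes λ { Sign.+ → p ; Sign.- → q }
  ... | no ¬p | _ = no λ h → ¬p (h Sign.+)
  ... | _ | no ¬q = no λ h → ¬q (h Sign.-)

  ≢⇒opposite : ∀ {s t} → s ≢ t → s ≡ opposite t
  ≢⇒opposite {Sign.+} {Sign.+} h = ⊥-elim (h refl)
  ≢⇒opposite {Sign.+} {Sign.-} h = refl
  ≢⇒opposite {Sign.-} {Sign.+} h = refl
  ≢⇒opposite {Sign.-} {Sign.-} h = ⊥-elim (h refl)

  -- The edge A p - B q crosses A p′ - B q′, where A p = (-1)^(idx p) w p and B q = - (-1)^(idx q) w q: the linear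
  -- relation between A p, B q, A p′, B q′ has the signs +, +, -, -.
  record Crosses (side : ℕ → Point → Sign) (p q p′ q′ : Point) : Set where
    private
      χ = orientation side
      σ = λ r → parity (idx r)
    field
      p≁q   : idx p ≢ idx q
      p′≁q′ : idx p′ ≢ idx q′
      p≢p′  : p ≢ p′
      q≢q′  : q ≢ q′
      p≢q′  : p ≢ q′
      q≢p′  : q ≢ p′
      balance₁ : σ q Sign.* χ q p′ q′ ≡ σ p Sign.* χ p p′ q′
      balance₂ : σ p Sign.* χ p q q′ ≡ opposite (σ p′ Sign.* χ q p′ q′)
      balance₃ : σ p′ Sign.* χ p q p′ ≡ σ q′ Sign.* χ p q q′

  private
    -- The determinants of three of the four ends are, with alternating signs, the coefficients of
    -- their linear relation. The pattern +, +, -, - thus makes certain pairs of determinants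
    -- opposite in sign; `balanced₁` to `balanced₃` cancel the signs of the vectors common to both
    -- members of such a pair.
    balanced₁ : ∀ p q p′ q′ a b → opposite q Sign.* (p′ Sign.* (opposite q′ Sign.* a)) ≡ opposite (p Sign.* (p′ Sign.* (opposite q′ Sign.* b))) →
      q Sign.* a ≡ p Sign.* b
    balanced₁ = from-yes (∀-sign? λ p → ∀-sign? λ q → ∀-sign? λ p′ → ∀-sign? λ q′ → ∀-sign? λ a → ∀-sign? λ b →
      (opposite q Sign.* (p′ Sign.* (opposite q′ Sign.* a)) Signₚ.≟ opposite (p Sign.* (p′ Sign.* (opposite q′ Sign.* b)))) →-dec
      (q Sign.* a Signₚ.≟ p Sign.* b))

    balanced₂ : ∀ p q p′ q′ a c → p Sign.* (opposite q Sign.* (opposite q′ Sign.* c)) ≡ opposite (opposite q Sign.* (p′ Sign.* (opposite q′ Sign.* a))) →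
      p Sign.* c ≡ opposite (p′ Sign.* a)
    balanced₂ = from-yes (∀-sign? λ p → ∀-sign? λ q → ∀-sign? λ p′ → ∀-sign? λ q′ → ∀-sign? λ a → ∀-sign? λ c →
      (p Sign.* (opposite q Sign.* (opposite q′ Sign.* c)) Signₚ.≟ opposite (opposite q Sign.* (p′ Sign.* (opposite q′ Sign.* a)))) →-dec
      (p Sign.* c Signₚ.≟ opposite (p′ Sign.* a)))

    balanced₃ : ∀ p q p′ q′ c d → p Sign.* (opposite q Sign.* (p′ Sign.* d)) ≡ opposite (p Sign.* (opposite q Sign.* (opposite q′ Sign.* c))) →
      p′ Sign.* d ≡ q′ Sign.* c
    balanced₃ = from-yes (∀-sign? λ p → ∀-sign? λ q → ∀-sign? λ p′ → ∀-sign? λ q′ → ∀-sign? λ c → ∀-sign? λ d →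
      (p Sign.* (opposite q Sign.* (p′ Sign.* d)) Signₚ.≟ opposite (p Sign.* (opposite q Sign.* (opposite q′ Sign.* c)))) →-dec
      (p′ Sign.* d Signₚ.≟ q′ Sign.* c))

  module Draw (n : ℕ) (C : Configuration) where
    open Configuration C
    open Orientation C using (χ; orientation-sign)

    G : SimpleGraph
    G = K n ⊗ C₄

    spot : V G → Point
    spot (i , a) = toℕ i , copy a

    spot< : ∀ v → idx (spot v) ℕ.< n
    spot< (i , _) = Finₚ.toℕ<n i

    sign : V G → Sign
    sign (i , a) = class a Sign.* parity (toℕ i)

    vec : V G → ℚ³
    vec v = signed (sign v) (w (spot v))

    width tall : ℚ
    -- The extra 1 secures the hypothesis `1 ≤ K` of `Clearance` whatever the abscissas are.
    width = size (bounded-below abscissa n) + 1ℚ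
    tall = size (bounded-below height n)

    1≤width : 1ℚ ≤ width
    1≤width = subst (_≤ width) (+-identityˡ 1ℚ) (+-monoˡ-≤ 1ℚ (0≤size (bounded-below abscissa n)))

    open Clearance width tall 1≤width (0≤size (bounded-below height n))
    open Projection height-factor
    open Close

    ∣x∣≡1 : ∀ v → ∣ x (vec v) ∣ ≡ 1ℚ
    ∣x∣≡1 v = go (sign v)
      where
      go : ∀ s → ∣ x (signed s (w (spot v))) ∣ ≡ 1ℚ
      go Sign.+ = 0≤p⇒∣p∣≡p 0≤1
      go Sign.- = trans (∣-p∣≡∣p∣ 1ℚ) (0≤p⇒∣p∣≡p 0≤1)

    y≡ : ∀ v → y (vec v) ≡ abscissa (spot v) * x (vec v)
    y≡ v = go (sign v)
      where
      lem : ∀ a → - a ≡ a * - 1ℚ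
      lem = solve-∀ ℚ-ring
      go : ∀ s → y (signed s (w (spot v))) ≡ abscissa (spot v) * x (signed s (w (spot v)))
      go Sign.+ = sym (*-identityʳ (abscissa (spot v)))
      go Sign.- = lem (abscissa (spot v))

    z≤tall : ∀ v → z (vec v) ≤ tall
    z≤tall v = ≤-trans (go (sign v)) (bounds (bounded-below height n) (spot v) (spot< v))
      where
      go : ∀ s → z (signed s (w (spot v))) ≤ ∣ height (spot v) ∣
      go Sign.+ = p≤∣p∣ (height (spot v))
      go Sign.- = -p≤∣p∣ (height (spot v))

    abscissa≤width : ∀ v → ∣ abscissa (spot v) ∣ ≤ width
    abscissa≤width v = ≤-trans (bounds (bounded-below abscissa n) (spot v) (spot< v)) (p≤p+q {size (bounded-below abscissa n)} {1ℚ} 0≤1)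

    far : ∀ p q → idx p ≢ idx q → 1ℚ ≤ ∣ abscissa q - abscissa p ∣
    far p q p≁q with ℕₚ.<-cmp (idx p) (idx q)
    ... | tri≈ _ e _ = ⊥-elim (p≁q e)
    ... | tri< l _ _ = ≤-trans (p+1≤q⇒1≤q-p (apart p q l)) (p≤∣p∣ (abscissa q - abscissa p))
    ... | tri> _ _ l = ≤-trans (p+1≤q⇒1≤q-p (apart q p l))
        (subst (abscissa p - abscissa q ≤_) (∣p-q∣-comm (abscissa p) (abscissa q)) (p≤∣p∣ (abscissa p - abscissa q)))

    clear-pair : ∀ u v → idx (spot u) ≢ idx (spot v) → Clear (vec u) (vec v)
    clear-pair u v u≁v = clear-segment (vec u) (vec v) (abscissa (spot u)) (abscissa (spot v)) (∣x∣≡1 u) (∣x∣≡1 v) (y≡ u) (y≡ v)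
      (far (spot u) (spot v) u≁v) (abscissa≤width u) (abscissa≤width v) (z≤tall u) (z≤tall v)

    clear-point : ∀ v → 1ℚ ≤ depth (vec v)
    clear-point v = clear-vertex (vec v) (∣x∣≡1 v) (z≤tall v)

    point : V G → ℝ²
    point v = fromℚ (px (vec v)) , fromℚ (py (vec v))

    -- Adjacency is an irrelevant field of `Edge`, so this consequence is recomputed from its
    -- decidability.
    edge≁ : (e : Edge G) → idx (spot (src e)) ≢ idx (spot (tgt e))
    edge≁ (edge (i , _) (j , _) adj) = recompute (¬? (toℕ i ℕ.≟ toℕ j)) λ e → proj₁ adj (Finₚ.toℕ-injective e)

    edge-class : (e : Edge G) → class (proj₂ (tgt e)) ≡ opposite (class (proj₂ (src e)))
    edge-class (edge (_ , a) (_ , b) adj) = recompute (class b Signₚ.≟ opposite (class a)) (C₄-bipartite a b (proj₂ adj))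

    cl : (e : Edge G) → Clear (vec (src e)) (vec (tgt e))
    cl e = clear-pair (src e) (tgt e) (edge≁ e)

    -- Up to sign this determinant is the difference of the two abscissas.
    det-pole≢0 : ∀ u v → idx (spot u) ≢ idx (spot v) → det pole (vec u) (vec v) ≢ 0ℚ
    det-pole≢0 u v u≁v = sign⇒≢0 _ (det-signed Sign.+ (sign u) (sign v) {pole} {w (spot u)} {w (spot v)} _ (proj₂ base))
      where
      lem : ∀ a b c d → 0ℚ * (a * d - c * b) - 0ℚ * (1ℚ * d - c * 1ℚ) + 1ℚ * (1ℚ * b - a * 1ℚ) ≡ b - a
      lem = solve-∀ ℚ-ring
      lem′ : ∀ a b → a - b ≡ - (b - a)
      lem′ = solve-∀ ℚ-ring
      gap : ∀ p q → idx p ℕ.< idx q → 0ℚ < abscissa q - abscissa p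
      gap p q l = <-≤-trans 0<1 (p+1≤q⇒1≤q-p (apart p q l))
      p = spot u
      q = spot v
      base : ∃[ σ ] HasSign σ (det pole (w p) (w q))
      base with ℕₚ.<-cmp (idx p) (idx q)
      ... | tri≈ _ e _ = ⊥-elim (u≁v e)
      ... | tri< l _ _ = Sign.+ , subst (0ℚ <_) (sym (lem (abscissa p) (abscissa q) (height p) (height q))) (gap p q l)
      ... | tri> _ _ l = Sign.- , subst (0ℚ <_) (trans (lem′ (abscissa p) (abscissa q)) (cong -_ (sym (lem (abscissa p) (abscissa q) (height p) (height q)))))
                                   (gap q p l)

    track : (e : Edge G) → UnitInterval → Track
    track e s = segment (vec (src e)) (vec (tgt e)) (cl e) (seq (value s))

    mark : V G → Track
    mark v = constant (vec v) (clear-point v)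

    on : (e : Edge G) → UnitInterval → ℝ²
    on e s = lift (px-lipschitz {vec (src e)} {vec (tgt e)} (cl e)) (value s) , lift (py-lipschitz {vec (src e)} {vec (tgt e)} (cl e)) (value s)

    on-close : ∀ e s f t → on e s ≃² on f t → Close (track e s) (track f t)
    on-close e s f t (h , k) = record { close-x = null h ; close-y = null k }

    on-mark : ∀ e s v → on e s ≃² point v → Close (track e s) (mark v)
    on-mark e s v (h , k) = record { close-x = null h ; close-y = null k }

    on-≃ : ∀ e s t → value s ≃ value t → on e s ≃² on e t
    on-≃ e s t h = lift-≃ (px-lipschitz {vec (src e)} {vec (tgt e)} (cl e)) (value s) (value t) h
                 , lift-≃ (py-lipschitz {vec (src e)} {vec (tgt e)} (cl e)) (value s) (value t) h

    clamped⇒value : ∀ s t → Null (λ n → clamp (seq (value s) n) - clamp (seq (value t) n)) → value s ≃ value t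
    clamped⇒value s t h = vanishes (null-cong (λ n → lem (clamp (seq (value s) n)) (seq (value s) n) (clamp (seq (value t) n)) (seq (value t) n))
      (null-+ {λ n → - (clamp (seq (value s) n) - seq (value s) n) + (clamp (seq (value s) n) - clamp (seq (value t) n))}
              {λ n → clamp (seq (value t) n) - seq (value t) n}
        (null-+ {λ n → - (clamp (seq (value s) n) - seq (value s) n)} {λ n → clamp (seq (value s) n) - clamp (seq (value t) n)}
          (null-neg {λ n → clamp (seq (value s) n) - seq (value s) n} (clamp-value s)) h)
        (clamp-value t)))
      where
      lem : ∀ c s d t → (- (c - s) + (c - d)) + (d - t) ≡ s - t
      lem = solve-∀ ℚ-ring

    along-0 : ∀ a b → along a b (clamp 0ℚ) ≡ a
    along-0 a b = trans (cong (along a b) (clamp-id ≤-refl 0≤1)) (lem a b)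
      where lem : ∀ a b → a + 0ℚ * (b - a) ≡ a
            lem = solve-∀ ℚ-ring

    along-1 : ∀ a b → along a b (clamp 1ℚ) ≡ b
    along-1 a b = trans (cong (along a b) (clamp-id 0≤1 ≤-refl)) (lem a b)
      where lem : ∀ a b → a + 1ℚ * (b - a) ≡ b
            lem = solve-∀ ℚ-ring

    along-complement : ∀ a b q → along b a (clamp (1ℚ - q)) ≡ along a b (clamp q)
    along-complement a b q = trans (cong (along b a) (clamp-complement q)) (lem a b (clamp q))
      where lem : ∀ a b c → b + (1ℚ - c) * (a - b) ≡ a + c * (b - a)
            lem = solve-∀ ℚ-ring

    ℚ³-≡ : ∀ {u v : ℚ³} → x u ≡ x v → y u ≡ y v → z u ≡ z v → u ≡ v
    ℚ³-≡ refl refl refl = refl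

    mix-0 : ∀ u v → mix u v (clamp 0ℚ) ≡ u
    mix-0 u v = ℚ³-≡ (along-0 (x u) (x v)) (along-0 (y u) (y v)) (along-0 (z u) (z v))

    mix-1 : ∀ u v → mix u v (clamp 1ℚ) ≡ v
    mix-1 u v = ℚ³-≡ (along-1 (x u) (x v)) (along-1 (y u) (y v)) (along-1 (z u) (z v))

    mix-complement : ∀ u v q → mix v u (clamp (1ℚ - q)) ≡ mix u v (clamp q)
    mix-complement u v q = ℚ³-≡ (along-complement (x u) (x v) q) (along-complement (y u) (y v) q) (along-complement (z u) (z v) q)

    pointwise : ∀ {a b : ℝ} → (∀ n → seq a n ≡ seq b n) → a ≃ b
    pointwise {a} {b} h = vanishes (null-cong (λ n → trans (sym (+-inverseʳ (seq a n))) (cong (λ q → seq a n - q) (h n))) null-0)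

    on-start : ∀ e s → value s ≃ 0ℝ → on e s ≃² point (src e)
    on-start e s h = ≃²-trans (on e s) at-0 (point (src e))
        ( lift-≃ (px-lipschitz {u} {v} (cl e)) (value s) 0ℝ h , lift-≃ (py-lipschitz {u} {v} (cl e)) (value s) 0ℝ h)
        ( pointwise {proj₁ at-0} {fromℚ (px u)} (λ _ → cong px (mix-0 u v)) , pointwise {proj₂ at-0} {fromℚ (py u)} (λ _ → cong py (mix-0 u v)))
      where
      u = vec (src e)
      v = vec (tgt e)
      at-0 : ℝ²
      at-0 = lift (px-lipschitz {u} {v} (cl e)) 0ℝ , lift (py-lipschitz {u} {v} (cl e)) 0ℝ

    on-end : ∀ e s → value s ≃ 1ℝ → on e s ≃² point (tgt e)
    on-end e s h = ≃²-trans (on e s) at-1 (point (tgt e))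
        ( lift-≃ (px-lipschitz {u} {v} (cl e)) (value s) 1ℝ h , lift-≃ (py-lipschitz {u} {v} (cl e)) (value s) 1ℝ h)
        ( pointwise {proj₁ at-1} {fromℚ (px v)} (λ _ → cong px (mix-1 u v)) , pointwise {proj₂ at-1} {fromℚ (py v)} (λ _ → cong py (mix-1 u v)))
      where
      u = vec (src e)
      v = vec (tgt e)
      at-1 : ℝ²
      at-1 = lift (px-lipschitz {u} {v} (cl e)) 1ℝ , lift (py-lipschitz {u} {v} (cl e)) 1ℝ

    arcOf : (e : Edge G) → Arc (point (src e)) (point (tgt e))
    arcOf e .at = on e
    arcOf e .continuous s ε 0<ε =
      let δ₁ , 0<δ₁ , h₁ = lift-continuous (px-lipschitz {vec (src e)} {vec (tgt e)} (cl e)) ε 0<ε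
          δ₂ , 0<δ₂ , h₂ = lift-continuous (py-lipschitz {vec (src e)} {vec (tgt e)} (cl e)) ε 0<ε
      in δ₁ ⊓ δ₂ , ⊓-pos 0<δ₁ 0<δ₂ , λ { t (N , c) →
           h₁ (value s) (value t) (N , λ n N≤n → ≤-trans (c n N≤n) (p⊓q≤p δ₁ δ₂)) ,
           h₂ (value s) (value t) (N , λ n N≤n → ≤-trans (c n N≤n) (p⊓q≤q δ₁ δ₂)) }
      where
      ⊓-pos : ∀ {p q} → 0ℚ < p → 0ℚ < q → 0ℚ < p ⊓ q
      ⊓-pos {p} {q} 0<p 0<q with ≤-total p q
      ... | inj₁ h = subst (0ℚ <_) (sym (p≤q⇒p⊓q≡p h)) 0<p
      ... | inj₂ h = subst (0ℚ <_) (sym (p≥q⇒p⊓q≡q h)) 0<q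
    arcOf e .injective s t h = clamped⇒value s t
      (close-injective {vec (src e)} {vec (tgt e)} {cl e} {seq (value s)} {seq (value t)} (det-pole≢0 (src e) (tgt e) (edge≁ e)) (on-close e s e t h))
    arcOf e .start = on-start e
    arcOf e .end = on-end e

    fromℚ-injective : ∀ {a b} → fromℚ a ≃ fromℚ b → a ≡ b
    fromℚ-injective {a} {b} h = decidable-stable (a ≟ b) λ a≢b → ¬null 0<1 (λ _ → ≤-refl)
      (null-cancel-const {λ _ → 1ℚ} (a - b) (λ e → a≢b (trans (sym (lem a b)) (trans (cong (_+ b) e) (+-identityˡ b))))
        (null-cong (λ _ → sym (*-identityʳ (a - b))) (null h)))
      where lem : ∀ a b → a - b + b ≡ a
            lem = solve-∀ ℚ-ring

    -- The first coordinate of a vertex vector is 1 or -1, so the absolute value of `px` is the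
    -- scale itself.
    scale-≡ : ∀ u v → px (vec u) ≡ px (vec v) → scale (vec u) ≡ scale (vec v)
    scale-≡ u v h = trans (sym (lem u)) (trans (cong ∣_∣ h) (lem v))
      where
      lem : ∀ u → ∣ px (vec u) ∣ ≡ scale (vec u)
      lem u = trans (∣p*q∣≡∣p∣*∣q∣ (x (vec u)) (scale (vec u)))
        (trans (cong₂ _*_ (∣x∣≡1 u) (0≤p⇒∣p∣≡p (0≤ratio (mark u) 0))) (*-identityˡ (scale (vec u))))

    point⇒vec : ∀ u v → point u ≃² point v → vec u ≡ vec v
    point⇒vec u v (h , k) = ℚ³-≡ (cancel (x (vec u)) (x (vec v)) ex) (cancel (y (vec u)) (y (vec v)) ey) (cancel (z (vec u)) (z (vec v)) ez)
      where
      ex : px (vec u) ≡ px (vec v)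
      ex = fromℚ-injective h
      ey : py (vec u) ≡ py (vec v)
      ey = fromℚ-injective k
      ez : z (vec u) * scale (vec u) ≡ z (vec v) * scale (vec v)
      ez = trans (scaled-z (mark u) 0) (trans (cong₂ (λ a b → height-factor * (∣ a ∣ + ∣ b ∣) - 1ℚ) ex ey) (sym (scaled-z (mark v) 0)))
      r = scale (vec u)
      lem : ∀ a r d → a * (r * d) ≡ (a * r) * d
      lem = solve-∀ ℚ-ring
      unscale : ∀ a → a ≡ (a * r) * depth (vec u)
      unscale a = trans (sym (*-identityʳ a)) (trans (cong (a *_) (sym (ratio-inverse (mark u) 0))) (lem a r (depth (vec u))))
      cancel : ∀ a b → a * r ≡ b * scale (vec v) → a ≡ b
      cancel a b e = trans (unscale a) (trans (cong (_* depth (vec u)) (trans e (cong (b *_) (sym (scale-≡ u v ex))))) (sym (unscale b)))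

    1≢-1 : 1ℚ ≢ - 1ℚ
    1≢-1 ()

    signed-injective : ∀ s t {p q} → signed s (w p) ≡ signed t (w q) → s ≡ t × w p ≡ w q
    signed-injective Sign.+ Sign.+ e = refl , e
    signed-injective Sign.- Sign.- e = refl , ℚ³-≡ refl (neg-injective (cong y e)) (neg-injective (cong z e))
    signed-injective Sign.+ Sign.- e = ⊥-elim (1≢-1 (cong x e))
    signed-injective Sign.- Sign.+ e = ⊥-elim (1≢-1 (sym (cong x e)))

    ¬1+≤ : ∀ {a b} → a + 1ℚ ≤ b → a ≢ b
    ¬1+≤ {a} h refl = <-irrefl refl (<-≤-trans (subst (_< a + 1ℚ) (+-identityʳ a) (+-monoʳ-< a 0<1)) h)

    w-injective : ∀ p q → w p ≡ w q → p ≡ q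
    w-injective p q e with ℕₚ.<-cmp (idx p) (idx q)
    ... | tri< l _ _ = ⊥-elim (¬1+≤ (apart p q l) (cong y e))
    ... | tri> _ _ l = ⊥-elim (¬1+≤ (apart q p l) (sym (cong y e)))
    w-injective (i , false) (_ , false) e | tri≈ _ refl _ = refl
    w-injective (i , true) (_ , true) e | tri≈ _ refl _ = refl
    w-injective (i , false) (_ , true) e | tri≈ _ refl _ = ⊥-elim (twins i e)
    w-injective (i , true) (_ , false) e | tri≈ _ refl _ = ⊥-elim (twins i (sym e))

    vertex-≡ : ∀ u v → spot u ≡ spot v → class (proj₂ u) ≡ class (proj₂ v) → u ≡ v
    vertex-≡ (i , a) (j , b) e c = cong₂ _,_ (Finₚ.toℕ-injective (cong idx e)) (class-copy-injective a b c (cong bit e))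

    distinctOf : ∀ u v → point u ≃² point v → u ≡ v
    distinctOf u v h =
      let s≡t , wp≡wq = signed-injective (sign u) (sign v) {spot u} {spot v} (point⇒vec u v h)
          spots = w-injective (spot u) (spot v) wp≡wq
      in vertex-≡ u v spots (Signₚ.*-cancelʳ-≡ (parity (idx (spot u))) (class (proj₂ u)) (class (proj₂ v))
           (trans s≡t (cong (λ p → class (proj₂ v) Sign.* parity (idx p)) (sym spots))))

    antipode : ∀ u v → spot u ≡ spot v → class (proj₂ v) ≡ opposite (class (proj₂ u)) → vec v ≡ neg³ (vec u)
    antipode u v e c = trans (cong₂ signed eq (cong w (sym e))) (signed-opposite (sign u) (w (spot u)))
      where
      lem : ∀ s t → opposite s Sign.* t ≡ opposite (s Sign.* t)
      lem Sign.+ t = refl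
      lem Sign.- t = sym (Signₚ.opposite-involutive t)
      eq : sign v ≡ opposite (sign u)
      eq = trans (cong₂ (λ s i → s Sign.* parity i) c (cong idx (sym e))) (lem (class (proj₂ u)) (parity (idx (spot u))))

    _≟ᵖ_ : (p q : Point) → Dec (p ≡ q)
    _≟ᵖ_ = Productₚ.≡-dec ℕ._≟_ Bool._≟_

    det-sign : ∀ u v t → spot u ≢ spot v → spot v ≢ spot t → spot u ≢ spot t →
      HasSign (sign u Sign.* (sign v Sign.* (sign t Sign.* χ (spot u) (spot v) (spot t)))) (det (vec u) (vec v) (vec t))
    det-sign u v t a b c = det-signed (sign u) (sign v) (sign t) {w (spot u)} {w (spot v)} {w (spot t)} _
      (orientation-sign (spot u) (spot v) (spot t) a b c)

    det≢0 : ∀ u v t → spot u ≢ spot v → spot v ≢ spot t → spot u ≢ spot t → det (vec u) (vec v) (vec t) ≢ 0ℚ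
    det≢0 u v t a b c = sign⇒≢0 _ (det-sign u v t a b c)

    other-class : ∀ u v → u ≢ v → spot u ≡ spot v → class (proj₂ v) ≡ opposite (class (proj₂ u))
    other-class u v u≢v e = ≢⇒opposite λ c → u≢v (vertex-≡ u v e (sym c))

    -- A vertex other than the two ends either lies over the same point as an end, and is then
    -- antipodal to that end, or over a third point, and is then outside the plane of the edge.
    avoidsOf : ∀ e t → t ≢ src e → t ≢ tgt e → ∀ s → ¬ (on e s ≃² point t)
    avoidsOf e t t≢u t≢v s h with spot (src e) ≟ᵖ spot t | spot (tgt e) ≟ᵖ spot t
    ... | yes p | _ = subst (λ v → (h : 1ℚ ≤ depth v) → ¬ Close (track e s) (constant v h))
        (sym (antipode (src e) t p (other-class (src e) t (λ r → t≢u (sym r)) p)))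
        (λ h → ¬close-neg-start {vec (src e)} {vec (tgt e)} {cl e} {seq (value s)} {h} (det-pole≢0 (src e) (tgt e) (edge≁ e)))
        (clear-point t) (on-mark e s t h)
    ... | no _ | yes p = subst (λ v → (h : 1ℚ ≤ depth v) → ¬ Close (track e s) (constant v h))
        (sym (antipode (tgt e) t p (other-class (tgt e) t (λ r → t≢v (sym r)) p)))
        (λ h → ¬close-neg-end {vec (src e)} {vec (tgt e)} {cl e} {seq (value s)} {h} (det-pole≢0 (src e) (tgt e) (edge≁ e)))
        (clear-point t) (on-mark e s t h)
    ... | no p | no q = det≢0 (src e) (tgt e) t (λ r → edge≁ e (cong idx r)) q p
        (close-constant {vec (src e)} {vec (tgt e)} {cl e} {seq (value s)} {vec t} {clear-point t} (on-mark e s t h))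

    unorientedOf : ∀ e f → e ≋ f → ∀ p → p ∈ᵃ arcOf e → p ∈ᵃ arcOf f
    unorientedOf (edge a b _) (edge _ _ _) (inj₁ (refl , refl)) p m = m
    unorientedOf e@(edge a b _) f@(edge _ _ _) (inj₂ (refl , refl)) p (s , h) = complement s ,
      ≃²-trans (on f (complement s)) (on e s) p
        ( pointwise {proj₁ (on f (complement s))} {proj₁ (on e s)} (λ n → cong px (mix-complement (vec a) (vec b) (seq (value s) n)))
        , pointwise {proj₂ (on f (complement s))} {proj₂ (on e s)} (λ n → cong py (mix-complement (vec a) (vec b) (seq (value s) n)))) h

    drawing : Drawing G
    drawing = record
      { point = point ; distinct = distinctOf ; arc = arcOf ; unoriented = unorientedOf
      ; avoids = λ e t t≢u t≢v m → avoidsOf e t t≢u t≢v (proj₁ m) (proj₂ m) }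

    Oriented : Edge G → Set
    Oriented e = class (proj₂ (src e)) ≡ Sign.+

    -- Every edge joins the two classes, so it can be read from class + to class -. The signs of its
    -- ends are then known from the indices alone.
    orient : (e : Edge G) → ∃[ f ] (Oriented f × e ≋ f)
    orient e@(edge u v adj) with class (proj₂ u) in eq
    ... | Sign.+ = e , eq , inj₁ (refl , refl)
    ... | Sign.- = edge v u (SimpleGraph.~-sym G {u} {v} adj) , trans (edge-class e) (cong opposite eq) , inj₂ (refl , refl)

    P Q : Edge G → Point
    P e = spot (src e)
    Q e = spot (tgt e)

    tgt-class : ∀ e → Oriented e → class (proj₂ (tgt e)) ≡ Sign.-
    tgt-class e o = trans (edge-class e) (cong opposite o)

    same-edge : ∀ e f → Oriented e → Oriented f → P e ≡ P f → Q e ≡ Q f → src e ≡ src f × tgt e ≡ tgt f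
    same-edge e f oᵉ oᶠ p q = vertex-≡ (src e) (src f) p (trans oᵉ (sym oᶠ)) , vertex-≡ (tgt e) (tgt f) q (trans (tgt-class e oᵉ) (sym (tgt-class f oᶠ)))

    src-sign : ∀ e → Oriented e → sign (src e) ≡ parity (idx (P e))
    src-sign e o = cong (Sign._* parity (idx (P e))) o

    tgt-sign : ∀ e → Oriented e → sign (tgt e) ≡ opposite (parity (idx (Q e)))
    tgt-sign e o = cong (Sign._* parity (idx (Q e))) (tgt-class e o)

    clamp-0 : ∀ s → Null (λ n → clamp (seq (value s) n)) → value s ≃ 0ℝ
    clamp-0 s h = vanishes (null-cong (λ n → lem (clamp (seq (value s) n)) (seq (value s) n))
      (null-+ {λ n → - (clamp (seq (value s) n) - seq (value s) n)} {λ n → clamp (seq (value s) n)}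
        (null-neg {λ n → clamp (seq (value s) n) - seq (value s) n} (clamp-value s)) h))
      where lem : ∀ c s → - (c - s) + c ≡ s - 0ℚ
            lem = solve-∀ ℚ-ring

    clamp-1 : ∀ s → Null (λ n → 1ℚ - clamp (seq (value s) n)) → value s ≃ 1ℝ
    clamp-1 s h = vanishes (null-cong (λ n → lem (clamp (seq (value s) n)) (seq (value s) n))
      (null-neg {λ n → (clamp (seq (value s) n) - seq (value s) n) + (1ℚ - clamp (seq (value s) n))}
        (null-+ {λ n → clamp (seq (value s) n) - seq (value s) n} {λ n → 1ℚ - clamp (seq (value s) n)} (clamp-value s) h)))
      where lem : ∀ c s → - ((c - s) + (1ℚ - c)) ≡ s - 1ℚ
            lem = solve-∀ ℚ-ring

    module Meeting (e f : Edge G) (oᵉ : Oriented e) (oᶠ : Oriented f) (s t : UnitInterval) (meet : on e s ≃² on f t) where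

      close : Close (track e s) (track f t)
      close = on-close e s f t meet

      plane : Null (combination (seq (value t)) (det (vec (src e)) (vec (tgt e)) (vec (src f))) (det (vec (src e)) (vec (tgt e)) (vec (tgt f))))
      plane = close-plane {vec (src e)} {vec (tgt e)} {cl e} {seq (value s)} {vec (src f)} {vec (tgt f)} {cl f} {seq (value t)} close

      plane′ : Null (combination (seq (value s)) (det (vec (src f)) (vec (tgt f)) (vec (src e))) (det (vec (src f)) (vec (tgt f)) (vec (tgt e))))
      plane′ = close-plane {vec (src f)} {vec (tgt f)} {cl f} {seq (value t)} {vec (src e)} {vec (tgt e)} {cl e} {seq (value s)} (close-sym close)

      at-src : det (vec (src e)) (vec (tgt e)) (vec (src f)) ≡ 0ℚ → det (vec (src e)) (vec (tgt e)) (vec (tgt f)) ≢ 0ℚ → on f t ≃² point (src f)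
      at-src p q = on-start f t (clamp-0 t (close-at-start {vec (src e)} {vec (tgt e)} {cl e} {seq (value s)} {vec (src f)} {vec (tgt f)} {cl f} {seq (value t)} close p q))

      at-tgt : det (vec (src e)) (vec (tgt e)) (vec (tgt f)) ≡ 0ℚ → det (vec (src e)) (vec (tgt e)) (vec (src f)) ≢ 0ℚ → on f t ≃² point (tgt f)
      at-tgt p q = on-end f t (clamp-1 t (close-at-end {vec (src e)} {vec (tgt e)} {cl e} {seq (value s)} {vec (src f)} {vec (tgt f)} {cl f} {seq (value t)} close p q))

      P≢Q : P e ≢ Q e
      P≢Q r = edge≁ e (cong idx r)

      σ = λ (e : Edge G) → parity (idx (P e))
      τ = λ (e : Edge G) → opposite (parity (idx (Q e)))

      det-sign′ : ∀ x y z {r r′ r″} → sign x ≡ r → sign y ≡ r′ → sign z ≡ r″ → spot x ≢ spot y → spot y ≢ spot z → spot x ≢ spot z →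
        HasSign (r Sign.* (r′ Sign.* (r″ Sign.* χ (spot x) (spot y) (spot z)))) (det (vec x) (vec y) (vec z))
      det-sign′ x y z refl refl refl = det-sign x y z

      module Generic (p : P e ≢ P f) (q : Q e ≢ Q f) (r : P e ≢ Q f) (k : Q e ≢ P f) where
        χ₁ = χ (Q e) (P f) (Q f)
        χ₂ = χ (P e) (P f) (Q f)
        χ₃ = χ (P e) (Q e) (Q f)
        χ₄ = χ (P e) (Q e) (P f)
        s₁ s₂ s₃ s₄ : Sign
        s₁ = τ e Sign.* (σ f Sign.* (τ f Sign.* χ₁))
        s₂ = σ e Sign.* (σ f Sign.* (τ f Sign.* χ₂))
        s₃ = σ e Sign.* (τ e Sign.* (τ f Sign.* χ₃))
        s₄ = σ e Sign.* (τ e Sign.* (σ f Sign.* χ₄))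
        P≢Q′ : P f ≢ Q f
        P≢Q′ i = edge≁ f (cong idx i)
        h₁ : HasSign s₁ (det (vec (tgt e)) (vec (src f)) (vec (tgt f)))
        h₁ = det-sign′ (tgt e) (src f) (tgt f) (tgt-sign e oᵉ) (src-sign f oᶠ) (tgt-sign f oᶠ) k P≢Q′ q
        h₂ : HasSign s₂ (det (vec (src e)) (vec (src f)) (vec (tgt f)))
        h₂ = det-sign′ (src e) (src f) (tgt f) (src-sign e oᵉ) (src-sign f oᶠ) (tgt-sign f oᶠ) p P≢Q′ r
        h₃ : HasSign s₃ (det (vec (src e)) (vec (tgt e)) (vec (tgt f)))
        h₃ = det-sign′ (src e) (tgt e) (tgt f) (src-sign e oᵉ) (tgt-sign e oᵉ) (tgt-sign f oᶠ) P≢Q q r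
        h₄ : HasSign s₄ (det (vec (src e)) (vec (tgt e)) (vec (src f)))
        h₄ = det-sign′ (src e) (tgt e) (src f) (src-sign e oᵉ) (tgt-sign e oᵉ) (src-sign f oᶠ) P≢Q k p

        -- The arc of `f` reaches the plane of `e`, so its ends cannot lie strictly on one side;
        -- `s₁≡` is the same with the edges exchanged.
        s₄≡ : s₄ ≡ opposite s₃
        s₄≡ = ≢⇒opposite λ i → ¬null-combination (seq (value t)) s₃ (subst (λ m → HasSign m (det (vec (src e)) (vec (tgt e)) (vec (src f)))) i h₄) h₃ plane

        s₁≡ : s₁ ≡ opposite s₂
        s₁≡ = ≢⇒opposite λ i → ¬null-combination (seq (value s)) s₂
          (subst (HasSign s₂) (det-rotate (vec (src e)) (vec (src f)) (vec (tgt f))) h₂) (subst (HasSign s₂) (det-rotate (vec (tgt e)) (vec (src f)) (vec (tgt f))) (subst (λ m → HasSign m (det (vec (tgt e)) (vec (src f)) (vec (tgt f)))) i h₁)) plane′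

        -- The condition that both arcs contain the same one of the two antipodal intersections of
        -- their circles: otherwise `close-facing` moves the meeting point to the head of `e`, which
        -- an interior point is not.
        s₃≡ : (∀ x → ¬ (on e s ≃² point x)) → s₃ ≡ opposite s₁
        s₃≡ interior = ≢⇒opposite λ i → interior (tgt e) (on-end e s (clamp-1 s
          (close-facing {vec (src e)} {vec (tgt e)} {cl e} {seq (value s)} {vec (src f)} {vec (tgt f)} {cl f} {seq (value t)} close s₃ (subst (HasSign s₃) (det-rotate (vec (src e)) (vec (tgt e)) (vec (tgt f))) h₃)
            (subst (HasSign (opposite s₃)) flip (hasSign-neg s₃ (subst (λ m → HasSign m (det (vec (tgt e)) (vec (src f)) (vec (tgt f)))) (sym i) h₁))))))
          where
          flip : - det (vec (tgt e)) (vec (src f)) (vec (tgt f)) ≡ det (vec (tgt e)) (vec (tgt f)) (vec (src f))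
          flip = trans (cong -_ (trans (det-rotate (vec (tgt e)) (vec (src f)) (vec (tgt f))) (det-rotate (vec (src f)) (vec (tgt f)) (vec (tgt e))))) (sym (det-swap (vec (tgt e)) (vec (tgt f)) (vec (src f))))

        crosses : (∀ x → ¬ (on e s ≃² point x)) → Crosses side (P e) (Q e) (P f) (Q f)
        crosses interior = record
          { p≁q = edge≁ e ; p′≁q′ = edge≁ f ; p≢p′ = p ; q≢q′ = q ; p≢q′ = r ; q≢p′ = k
          ; balance₁ = balanced₁ (σ e) (parity (idx (Q e))) (σ f) (parity (idx (Q f))) χ₁ χ₂ s₁≡
          ; balance₂ = balanced₂ (σ e) (parity (idx (Q e))) (σ f) (parity (idx (Q f))) χ₁ χ₃ (s₃≡ interior)
          ; balance₃ = balanced₃ (σ e) (parity (idx (Q e))) (σ f) (parity (idx (Q f))) χ₃ χ₄ s₄≡ }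

        a-b≢0 : det (vec (src e)) (vec (tgt e)) (vec (src f)) - det (vec (src e)) (vec (tgt e)) (vec (tgt f)) ≢ 0ℚ
        a-b≢0 i = clash s₃ h₃ (subst₂ HasSign s₄≡ (trans (sym (lem (det (vec (src e)) (vec (tgt e)) (vec (src f))) (det (vec (src e)) (vec (tgt e)) (vec (tgt f)))))
            (trans (cong (_+ det (vec (src e)) (vec (tgt e)) (vec (tgt f))) i) (+-identityˡ (det (vec (src e)) (vec (tgt e)) (vec (tgt f)))))) h₄)
          where
          lem : ∀ a b → a - b + b ≡ a
          lem = solve-∀ ℚ-ring
          clash : ∀ s {d} → HasSign s d → HasSign (opposite s) d → ⊥
          clash Sign.+ {d} x y = <-irrefl refl (subst (0ℚ <_) (+-inverseʳ d) (+-pos x y))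
          clash Sign.- {d} x y = <-irrefl refl (subst (0ℚ <_) (+-inverseˡ d) (+-pos x y))

      -- Edges with a common or an antipodal end can meet only at an end of `f`, and edges with both
      -- ends antipodal do not meet. What remains are four ends over four different points.
      analyse : ¬ (e ≋ f) → (∀ x → ¬ (on e s ≃² point x)) → (∀ x → ¬ (on f t ≃² point x)) → Crosses side (P e) (Q e) (P f) (Q f)
      analyse e≉f interior interior′ with P e ≟ᵖ P f | Q e ≟ᵖ Q f | P e ≟ᵖ Q f | Q e ≟ᵖ P f
      ... | yes p | yes q | _ | _ = ⊥-elim (e≉f (inj₁ (same-edge e f oᵉ oᶠ p q)))
      ... | yes p | no q | _ | _ = ⊥-elim (interior′ (src f) (at-src
          (trans (cong (λ i → det (vec (src e)) (vec (tgt e)) (vec i)) (sym (vertex-≡ (src e) (src f) p (trans oᵉ (sym oᶠ))))) (det-repeat₁ (vec (src e)) (vec (tgt e))))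
          (det≢0 (src e) (tgt e) (tgt f) P≢Q q (λ r → edge≁ f (cong idx (trans (sym p) r))))))
      ... | no p | yes q | _ | _ = ⊥-elim (interior′ (tgt f) (at-tgt
          (trans (cong (λ i → det (vec (src e)) (vec (tgt e)) (vec i)) (sym (vertex-≡ (tgt e) (tgt f) q (trans (tgt-class e oᵉ) (sym (tgt-class f oᶠ)))))) (det-repeat₂ (vec (src e)) (vec (tgt e))))
          (det≢0 (src e) (tgt e) (src f) P≢Q (λ r → edge≁ f (cong idx (trans (sym r) q))) p)))
      ... | no p | no q | yes r | yes k = ⊥-elim (antipodal (vec (src f)) (vec (tgt f)) (cl f)
          (antipode (tgt e) (src f) k (trans oᶠ (cong opposite (sym (tgt-class e oᵉ))))) (antipode (src e) (tgt f) r (trans (tgt-class f oᶠ) (cong opposite (sym oᵉ)))) close)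
        where
        antipodal : ∀ x y (c : Clear x y) → x ≡ neg³ (vec (tgt e)) → y ≡ neg³ (vec (src e)) → ¬ Close (track e s) (segment x y c (seq (value t)))
        antipodal _ _ c refl refl = ¬close-antipodal {vec (src e)} {vec (tgt e)} {cl e} {c} {seq (value s)} {seq (value t)} (det-pole≢0 (src e) (tgt e) (edge≁ e))
      ... | no p | no q | yes r | no k = ⊥-elim (interior′ (tgt f) (at-tgt
          (trans (cong (det (vec (src e)) (vec (tgt e))) (antipode (src e) (tgt f) r (trans (tgt-class f oᶠ) (cong opposite (sym oᵉ)))))
            (trans (det-neg (vec (src e)) (vec (tgt e)) (vec (src e))) (cong -_ (det-repeat₁ (vec (src e)) (vec (tgt e))))))
          (det≢0 (src e) (tgt e) (src f) P≢Q k p)))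
      ... | no p | no q | no r | yes k = ⊥-elim (interior′ (src f) (at-src
          (trans (cong (det (vec (src e)) (vec (tgt e))) (antipode (tgt e) (src f) k (trans oᶠ (cong opposite (sym (tgt-class e oᵉ))))))
            (trans (det-neg (vec (src e)) (vec (tgt e)) (vec (tgt e))) (cong -_ (det-repeat₂ (vec (src e)) (vec (tgt e))))))
          (det≢0 (src e) (tgt e) (tgt f) P≢Q q r)))
      ... | no p | no q | no r | no k = Generic.crosses p q r k interior

    -- `SameCrossing` also compares the places, so two edges must determine their crossing point.
    -- They do: the determinant along `f` is affine with different values at the ends, hence
    -- vanishes for one parameter only.
    unique : ∀ e f → Oriented e → Oriented f → P e ≢ P f → Q e ≢ Q f → P e ≢ Q f → Q e ≢ P f →
      ∀ s t s̃ t̃ → on e s ≃² on f t → on e s̃ ≃² on f t̃ → on f t ≃² on f t̃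
    unique e f oᵉ oᶠ p q r k s t s̃ t̃ m m̃ = on-≃ f t t̃ (clamped⇒value t t̃
      (combination-unique (seq (value t)) (seq (value t̃)) {det (vec (src e)) (vec (tgt e)) (vec (src f))} {det (vec (src e)) (vec (tgt e)) (vec (tgt f))} (M.Generic.a-b≢0 p q r k) M.plane (Meeting.plane e f oᵉ oᶠ s̃ t̃ m̃)))
      where module M = Meeting e f oᵉ oᶠ s t m

    record Resolved (c : Crossing drawing) : Set where
      field
        e f : Edge G
        oᵉ  : Oriented e
        oᶠ  : Oriented f
        e₁≋ : Crossing.e₁ c ≋ e
        e₂≋ : Crossing.e₂ c ≋ f
        s t : UnitInterval
        on-e : on e s ≃² Crossing.place c
        on-f : on f t ≃² Crossing.place c
        crosses : Crosses side (P e) (Q e) (P f) (Q f)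

    ≋-sym : ∀ (e f : Edge G) → e ≋ f → f ≋ e
    ≋-sym _ _ (inj₁ (refl , refl)) = inj₁ (refl , refl)
    ≋-sym _ _ (inj₂ (refl , refl)) = inj₂ (refl , refl)

    ≋-trans : ∀ (e f g : Edge G) → e ≋ f → f ≋ g → e ≋ g
    ≋-trans _ _ _ (inj₁ (refl , refl)) h = h
    ≋-trans _ _ _ (inj₂ (refl , refl)) (inj₁ (refl , refl)) = inj₂ (refl , refl)
    ≋-trans _ _ _ (inj₂ (refl , refl)) (inj₂ (refl , refl)) = inj₁ (refl , refl)

    resolve : ∀ c → Resolved c
    resolve c =
      let e , oᵉ , e₁≋e = orient (Crossing.e₁ c)
          f , oᶠ , e₂≋f = orient (Crossing.e₂ c)
          s , on-e = unorientedOf (Crossing.e₁ c) e e₁≋e (Crossing.place c) (Crossing.on₁ c)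
          t , on-f = unorientedOf (Crossing.e₂ c) f e₂≋f (Crossing.place c) (Crossing.on₂ c)
          meet = ≃²-trans (on e s) (Crossing.place c) (on f t) on-e (≃²-sym (on f t) (Crossing.place c) on-f)
      in record
        { e = e ; f = f ; oᵉ = oᵉ ; oᶠ = oᶠ ; e₁≋ = e₁≋e ; e₂≋ = e₂≋f ; s = s ; t = t ; on-e = on-e ; on-f = on-f
        ; crosses = Meeting.analyse e f oᵉ oᶠ s t meet
            (λ e≋f → Crossing.different c (≋-trans (Crossing.e₁ c) e (Crossing.e₂ c) e₁≋e (≋-trans e f (Crossing.e₂ c) e≋f (≋-sym (Crossing.e₂ c) f e₂≋f))))
            (λ x h → Crossing.interior c x (≃²-trans (Crossing.place c) (on e s) (point x) (≃²-sym (on e s) (Crossing.place c) on-e) h))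
            (λ x h → Crossing.interior c x (≃²-trans (Crossing.place c) (on f t) (point x) (≃²-sym (on f t) (Crossing.place c) on-f) h)) }

    -- Tail and head of one edge, then of the other: the finite data by which crossings are counted.
    Code : Set
    Code = Point × Point × Point × Point

    code : ∀ {c} → Resolved c → Code
    code r = P e , Q e , P f , Q f
      where open Resolved r

    same-code : ∀ {c d} (r : Resolved c) (q : Resolved d) → code r ≡ code q → SameCrossing c d
    same-code {c} {d} r q eq = go (Resolved.e q) (Resolved.f q)
        (same-edge R.e (Resolved.e q) R.oᵉ (Resolved.oᵉ q) (cong proj₁ eq) (cong (λ k → proj₁ (proj₂ k)) eq))
        (same-edge R.f (Resolved.f q) R.oᶠ (Resolved.oᶠ q) (cong (λ k → proj₁ (proj₂ (proj₂ k))) eq) (cong (λ k → proj₂ (proj₂ (proj₂ k))) eq))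
        (Resolved.e₁≋ q) (Resolved.e₂≋ q) (Resolved.s q) (Resolved.t q) (Resolved.on-e q) (Resolved.on-f q)
      where
      module R = Resolved r
      module X = Crosses R.crosses
      go : ∀ e f → src R.e ≡ src e × tgt R.e ≡ tgt e → src R.f ≡ src f × tgt R.f ≡ tgt f →
        Crossing.e₁ d ≋ e → Crossing.e₂ d ≋ f → ∀ s t → on e s ≃² Crossing.place d → on f t ≃² Crossing.place d → SameCrossing c d
      go (edge _ _ _) (edge _ _ _) (refl , refl) (refl , refl) d₁ d₂ s t on-e on-f =
        ≃²-trans (Crossing.place c) (on R.f R.t) (Crossing.place d) (≃²-sym (on R.f R.t) (Crossing.place c) R.on-f)
          (≃²-trans (on R.f R.t) (on R.f t) (Crossing.place d)
            (unique R.e R.f R.oᵉ R.oᶠ X.p≢p′ X.q≢q′ X.p≢q′ X.q≢p′ R.s R.t s t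
              (≃²-trans (on R.e R.s) (Crossing.place c) (on R.f R.t) R.on-e (≃²-sym (on R.f R.t) (Crossing.place c) R.on-f))
              (≃²-trans (on R.e s) (Crossing.place d) (on R.f t) on-e (≃²-sym (on R.f t) (Crossing.place d) on-f))) on-f)
        , inj₁ ( ≋-trans (Crossing.e₁ c) R.e (Crossing.e₁ d) R.e₁≋ (≋-sym (Crossing.e₁ d) R.e d₁)
               , ≋-trans (Crossing.e₂ c) R.f (Crossing.e₂ d) R.e₂≋ (≋-sym (Crossing.e₂ d) R.f d₂))

    flip : Crossing drawing → Crossing drawing
    flip c = record
      { e₁ = Crossing.e₂ c ; e₂ = Crossing.e₁ c ; different = λ h → Crossing.different c (≋-sym (Crossing.e₂ c) (Crossing.e₁ c) h) ; place = Crossing.place c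
      ; on₁ = Crossing.on₂ c ; on₂ = Crossing.on₁ c ; interior = Crossing.interior c }

    Entry : List Code → Crossing drawing → Set
    Entry L d = Σ Code λ k → k ∈ L × (k ≡ code (resolve d) ⊎ k ≡ code (resolve (flip d)))

    same-entry : ∀ d d′ k → k ≡ code (resolve d) ⊎ k ≡ code (resolve (flip d)) → k ≡ code (resolve d′) ⊎ k ≡ code (resolve (flip d′)) → SameCrossing d d′
    same-entry d d′ k (inj₁ p) (inj₁ q) = same-code (resolve d) (resolve d′) (trans (sym p) q)
    same-entry d d′ k (inj₁ p) (inj₂ q) = let h , o = same-code (resolve d) (resolve (flip d′)) (trans (sym p) q) in h , swap o
    same-entry d d′ k (inj₂ p) (inj₁ q) = let h , o = same-code (resolve (flip d)) (resolve d′) (trans (sym p) q) in h , Sum.map ×-swap ×-swap (swap o)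
    same-entry d d′ k (inj₂ p) (inj₂ q) = let h , o = same-code (resolve (flip d)) (resolve (flip d′)) (trans (sym p) q) in h , Sum.map ×-swap ×-swap o

    -- A crossing is unordered while a code is not, so it is enough that one of its two codes is
    -- listed. Among more crossings than entries, two share an entry and are therefore the same.
    at-most : ∀ k (L : List Code) → length L ℕ.≤ k →
      (∀ p q p′ q′ → idx p ℕ.< n → idx q ℕ.< n → idx p′ ℕ.< n → idx q′ ℕ.< n → Crosses side p q p′ q′ →
        (p , q , p′ , q′) ∈ L ⊎ (p′ , q′ , p , q) ∈ L) → AtMostCrossings drawing k
    at-most k L L≤k listed (c , distinct) =
      let i , j , i<j , e = Finₚ.pigeonhole (ℕ.s≤s L≤k) (λ i → index (proj₁ (proj₂ (entry (c i)))))
      in Finₚ.<-irrefl (distinct i j (same (c i) (c j) (entry (c i)) (entry (c j)) e)) i<j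
      where
      choose : ∀ d → code (resolve d) ∈ L ⊎ code (resolve (flip d)) ∈ L → Entry L d
      choose d (inj₁ m) = code (resolve d) , m , inj₁ refl
      choose d (inj₂ m) = code (resolve (flip d)) , m , inj₂ refl
      entry : ∀ d → Entry L d
      entry d = choose d (listed (P r.e) (Q r.e) (P r.f) (Q r.f) (spot< (src r.e)) (spot< (tgt r.e)) (spot< (src r.f)) (spot< (tgt r.f)) r.crosses)
        where module r = Resolved (resolve d)
      same : ∀ d d′ (m : Entry L d) (m′ : Entry L d′) → index (proj₁ (proj₂ m)) ≡ index (proj₁ (proj₂ m′)) → SameCrossing d d′
      same d d′ (k , m , r) (k′ , m′ , r′) e =
        same-entry d d′ k r (subst (λ k → k ≡ code (resolve d′) ⊎ k ≡ code (resolve (flip d′))) (sym k≡k′) r′)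
        where
        k≡k′ : k ≡ k′
        k≡k′ = trans (lookup-index m) (trans (cong (lookup L) e) (sym (lookup-index m′)))

-- A list with a code for every possible crossing.

module Enumeration where
  open import Data.Nat using (ℕ; zero; suc; _+_; _*_; _<_; s≤s; _≟_)
  open import Data.Nat.Properties
  open import Data.Nat.Tactic.RingSolver using (solve-∀)
  open import Data.Fin using (Fin; zero; suc; toℕ)
  open import Data.Bool using (Bool; true; false; not)
  open import Data.List using (List; []; _∷_; _++_; length; replicate)
  open import Data.List.Properties using (length-++)
  open import Data.List.Membership.Propositional using (_∈_)
  open import Data.List.Membership.Propositional.Properties using (∈-++⁺ˡ; ∈-++⁺ʳ)
  open import Data.List.Relation.Unary.Any using (here; there)
  open import Data.Product using (_×_; _,_; proj₁; proj₂)
  open import Data.Sum using (_⊎_; inj₁; inj₂)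
  open import Data.Empty using (⊥-elim)
  open import Data.Sign using (Sign; opposite) renaming (_*_ to _·_)
  import Data.Sign.Properties as Signₚ
  import Data.Fin.Properties as Finₚ
  open import Relation.Nullary using (¬_; Dec; yes; no)
  open import Relation.Nullary.Decidable using (from-yes; _→-dec_; _×-dec_)
  open import Relation.Binary.PropositionalEquality
  open import Relation.Binary.Definitions using (tri<; tri≈; tri>)
  open Configurations
  open Drawings

  sum : ℕ → (ℕ → ℕ) → ℕ
  sum zero f = 0
  sum (suc n) f = f n + sum n f

  range : ∀ {A : Set} → ℕ → (ℕ → List A) → List A
  range zero f = []
  range (suc n) f = f n ++ range n f

  ∈-range : ∀ {A : Set} {x : A} {n} f {i} → i < n → x ∈ f i → x ∈ range n f
  ∈-range {n = suc n} f {i} (s≤s i≤n) h with m≤n⇒m<n∨m≡n i≤n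
  ... | inj₁ i<n = ∈-++⁺ʳ (f n) (∈-range f i<n h)
  ... | inj₂ refl = ∈-++⁺ˡ h

  length-range : ∀ {A : Set} n (f : ℕ → List A) → length (range n f) ≡ sum n (λ i → length (f i))
  length-range zero f = refl
  length-range (suc n) f = trans (length-++ (f n)) (cong (length (f n) +_) (length-range n f))

  sum-cong : ∀ n {f g : ℕ → ℕ} → (∀ i → i < n → f i ≡ g i) → sum n f ≡ sum n g
  sum-cong zero h = refl
  sum-cong (suc n) h = cong₂ _+_ (h n ≤-refl) (sum-cong n (λ i i<n → h i (m<n⇒m<1+n i<n)))

  sum-+ : ∀ n (f g : ℕ → ℕ) → sum n (λ i → f i + g i) ≡ sum n f + sum n g
  sum-+ zero f g = refl
  sum-+ (suc n) f g = trans (cong (f n + g n +_) (sum-+ n f g)) (lem (f n) (g n) (sum n f) (sum n g))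
    where lem : ∀ a b c d → a + b + (c + d) ≡ a + c + (b + d)
          lem = solve-∀

  sum-*ˡ : ∀ n c (f : ℕ → ℕ) → sum n (λ i → c * f i) ≡ c * sum n f
  sum-*ˡ zero c f = sym (*-zeroʳ c)
  sum-*ˡ (suc n) c f = trans (cong (c * f n +_) (sum-*ˡ n c f)) (sym (*-distribˡ-+ c (f n) (sum n f)))

  sum-const : ∀ n c → sum n (λ _ → c) ≡ n * c
  sum-const zero c = refl
  sum-const (suc n) c = cong (c +_) (sum-const n c)

  sum-swap : ∀ m n (f : ℕ → ℕ → ℕ) → sum m (λ i → sum n (f i)) ≡ sum n (λ j → sum m (λ i → f i j))
  sum-swap zero n f = sym (trans (sum-const n 0) (*-zeroʳ n))
  sum-swap (suc m) n f = trans (cong (sum n (f m) +_) (sum-swap m n f)) (sym (sum-+ n (f m) (λ j → sum m (λ i → f i j))))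

  sum-update : ∀ n (f g : ℕ → ℕ) i c → i < n → (∀ j → j ≢ i → f j ≡ g j) → f i + c ≡ g i → sum n f + c ≡ sum n g
  sum-update (suc n) f g i c (s≤s i≤n) off at with m≤n⇒m<n∨m≡n i≤n
  ... | inj₁ i<n = trans (+-assoc (f n) (sum n f) c)
    (cong₂ _+_ (off n λ { refl → <-irrefl refl i<n }) (sum-update n f g i c i<n off at))
  ... | inj₂ refl = trans (lem (f n) (sum n f) c)
    (cong₂ _+_ at (sum-cong n (λ j j<n → off j λ { refl → <-irrefl refl j<n })))
    where lem : ∀ a b c → a + b + c ≡ a + c + b
          lem = solve-∀

  sum-square : ∀ n (f : ℕ → ℕ) → sum n (λ i → sum n (λ j → f i * f j)) ≡ sum n f * sum n f
  sum-square n f = trans (sum-cong n (λ i _ → trans (sum-*ˡ n (f i) f) (*-comm (f i) (sum n f)))) (sum-*ˡ n (sum n f) f)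

  -- Conditions are numbers 0 or 1, used as multiplicities in `replicate`. The length of a list is
  -- then a sum of products of such indicators.
  ≢ᵇ : ℕ → ℕ → ℕ
  ≢ᵇ i j with i ≟ j
  ... | yes _ = 0
  ... | no _ = 1

  ≢ᵇ-≢ : ∀ {i j} → i ≢ j → ≢ᵇ i j ≡ 1
  ≢ᵇ-≢ {i} {j} i≢j with i ≟ j
  ... | yes p = ⊥-elim (i≢j p)
  ... | no _ = refl

  ≢ᵇ-refl : ∀ i → ≢ᵇ i i ≡ 0
  ≢ᵇ-refl i with i ≟ i
  ... | yes _ = refl
  ... | no ¬p = ⊥-elim (¬p refl)

  ≡ˢ : Sign → Sign → ℕ
  ≡ˢ Sign.+ Sign.+ = 1
  ≡ˢ Sign.- Sign.- = 1
  ≡ˢ _ _ = 0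

  ≡ˢ-≡ : ∀ {s t} → s ≡ t → ≡ˢ s t ≡ 1
  ≡ˢ-≡ {Sign.+} refl = refl
  ≡ˢ-≡ {Sign.-} refl = refl

  ∈-replicate : ∀ {A : Set} {x : A} {n} → n ≡ 1 → x ∈ replicate n x
  ∈-replicate refl = here refl

  bits : ∀ {A : Set} → (Bool → List A) → List A
  bits f = f false ++ f true

  ∈-bits : ∀ {A : Set} {x : A} f b → x ∈ f b → x ∈ bits f
  ∈-bits f false = ∈-++⁺ˡ
  ∈-bits f true = ∈-++⁺ʳ (f false)

  length-bits : ∀ {A : Set} (f : Bool → List A) → length (bits f) ≡ length (f false) + length (f true)
  length-bits f = length-++ (f false)

  below-flip : ∀ {i j} → i ≢ j → below i j ≡ opposite (below j i)
  below-flip {i} {j} i≢j with <-cmp i j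
  ... | tri< a _ _ = trans (below-< a) (cong opposite (sym (below-> a)))
  ... | tri≈ _ e _ = ⊥-elim (i≢j e)
  ... | tri> _ _ c = trans (below-> c) (cong opposite (sym (below-< c)))

  module _ {i j k : ℕ} (i≢j : i ≢ j) (j≢k : j ≢ k) (i≢k : i ≢ k) where

    order-rotate : order i j k ≡ order j k i
    order-rotate rewrite below-flip i≢k | below-flip i≢j = lem (below j i) (below j k) (below k i)
      where
      lem : ∀ a b c → opposite a · (b · opposite c) ≡ b · (c · a)
      lem = from-yes (∀-sign? λ a → ∀-sign? λ b → ∀-sign? λ c → opposite a · (b · opposite c) Signₚ.≟ b · (c · a))

    order-reverse : order k j i ≡ opposite (order i j k)
    order-reverse rewrite below-flip i≢k | below-flip i≢j | below-flip j≢k = lem (below j i) (below k j) (below k i)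
      where
      lem : ∀ a b c → b · (a · c) ≡ opposite (opposite a · (opposite b · opposite c))
      lem = from-yes (∀-sign? λ a → ∀-sign? λ b → ∀-sign? λ c → b · (a · c) Signₚ.≟ opposite (opposite a · (opposite b · opposite c)))

    order-swap : order j i k ≡ opposite (order i j k)
    order-swap rewrite below-flip i≢j = lem (below j i) (below j k) (below i k)
      where
      lem : ∀ a b c → a · (c · b) ≡ opposite (opposite a · (b · c))
      lem = from-yes (∀-sign? λ a → ∀-sign? λ b → ∀-sign? λ c → a · (c · b) Signₚ.≟ opposite (opposite a · (b · c)))

  Code : Set
  Code = Point × Point × Point × Point

  sign-bit : Sign → Bool
  sign-bit Sign.+ = false
  sign-bit Sign.- = true

  not-≢ : ∀ {b c} → b ≢ c → c ≡ not b
  not-≢ {false} {false} h = ⊥-elim (h refl)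
  not-≢ {false} {true} h = refl
  not-≢ {true} {false} h = refl
  not-≢ {true} {true} h = ⊥-elim (h refl)

  choose : ∀ {A : Set} → Sign → A → A → A
  choose Sign.+ a b = a
  choose Sign.- a b = b

  each : ∀ {A B : Set} → List A → (A → List B) → List B
  each [] f = []
  each (x ∷ xs) f = f x ++ each xs f

  ∈-each : ∀ {A B : Set} {x : A} {y : B} {xs} f → x ∈ xs → y ∈ f x → y ∈ each xs f
  ∈-each f (here refl) h = ∈-++⁺ˡ h
  ∈-each {xs = x ∷ _} f (there m) h = ∈-++⁺ʳ (f x) (∈-each f m h)

  pick : ∀ {A : Set} → A → A → A → A → Fin 4 → A
  pick a b c d zero = a
  pick a b c d (suc zero) = b
  pick a b c d (suc (suc zero)) = c
  pick a b c d (suc (suc (suc zero))) = d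

  -- What `Crosses` demands of four different indices. The bits have dropped out, whence the factor
  -- 16.
  Balanced : ℕ → ℕ → ℕ → ℕ → Set
  Balanced i j k l = (parity j · order j k l ≡ parity i · order i k l)
    × (parity i · order i j l ≡ opposite (parity k · order j k l))
    × (parity k · order i j k ≡ parity l · order i j l)

  Arrangement : Set
  Arrangement = Fin 4 × Fin 4 × Fin 4 × Fin 4

  -- The ranks of tail, head, tail, head. Exchanging the two edges allows the first tail to be the
  -- smaller one, which leaves 12 of the 24 arrangements. They are grouped by the place of the first
  -- head among the two tails, then by the rank of the second head, as in the case distinction of
  -- `∈-quads`.
  arrangements : List Arrangement
  arrangements =
    (f2 , f1 , f3 , f0) ∷ (f2 , f0 , f3 , f1) ∷ (f1 , f0 , f3 , f2) ∷ (f1 , f0 , f2 , f3) ∷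
    (f1 , f2 , f3 , f0) ∷ (f0 , f2 , f3 , f1) ∷ (f0 , f1 , f3 , f2) ∷ (f0 , f1 , f2 , f3) ∷
    (f1 , f3 , f2 , f0) ∷ (f0 , f3 , f2 , f1) ∷ (f0 , f3 , f1 , f2) ∷ (f0 , f2 , f1 , f3) ∷ []
    where
    f0 f1 f2 f3 : Fin 4
    f0 = zero
    f1 = suc zero
    f2 = suc (suc zero)
    f3 = suc (suc (suc zero))

  orderᶠ : Fin 4 → Fin 4 → Fin 4 → Sign
  orderᶠ x y z = order (toℕ x) (toℕ y) (toℕ z)

  balanced : (Fin 4 → Sign) → Arrangement → ℕ
  balanced s (x , y , z , t) = ≡ˢ (s y · orderᶠ y z t) (s x · orderᶠ x z t) *
    (≡ˢ (s x · orderᶠ x y t) (opposite (s z · orderᶠ y z t)) * ≡ˢ (s z · orderᶠ x y z) (s t · orderᶠ x y t))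

  quad : (Fin 4 → ℕ) → (Fin 4 → Sign) → List Code
  quad f s = each arrangements λ { π@(x , y , z , t) → bits λ b → bits λ c → bits λ d → bits λ e →
    replicate (balanced s π) ((f x , b) , (f y , c) , (f z , d) , (f t , e)) }

  quads : ℕ → List Code
  quads n = range n λ d → range d λ c → range c λ b → range b λ a →
    quad (pick a b c d) (pick (parity a) (parity b) (parity c) (parity d))

  pick-map : ∀ {A B : Set} (g : A → B) a b c d x → pick (g a) (g b) (g c) (g d) x ≡ g (pick a b c d x)
  pick-map g a b c d zero = refl
  pick-map g a b c d (suc zero) = refl
  pick-map g a b c d (suc (suc zero)) = refl
  pick-map g a b c d (suc (suc (suc zero))) = refl

  module Sorted {a b c d : ℕ} (a<b : a < b) (b<c : b < c) (c<d : c < d) where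

    f : Fin 4 → ℕ
    f = pick a b c d

    mono : ∀ x y → toℕ x < toℕ y → f x < f y
    mono zero (suc zero) _ = a<b
    mono zero (suc (suc zero)) _ = <-trans a<b b<c
    mono zero (suc (suc (suc zero))) _ = <-trans a<b (<-trans b<c c<d)
    mono (suc zero) (suc (suc zero)) _ = b<c
    mono (suc zero) (suc (suc (suc zero))) _ = <-trans b<c c<d
    mono (suc (suc zero)) (suc (suc (suc zero))) _ = c<d
    mono _ zero ()
    mono (suc _) (suc zero) (s≤s ())
    mono (suc (suc _)) (suc (suc zero)) (s≤s (s≤s ()))
    mono (suc (suc (suc zero))) (suc (suc (suc zero))) (s≤s (s≤s (s≤s ())))

    below-irrefl : ∀ i → below i i ≡ Sign.-
    below-irrefl i with i Data.Nat.<? i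
    ... | yes i<i = ⊥-elim (<-irrefl refl i<i)
    ... | no _ = refl

    below-f : ∀ x y → below (f x) (f y) ≡ below (toℕ x) (toℕ y)
    below-f x y with <-cmp (toℕ x) (toℕ y)
    ... | tri< l _ _ = trans (below-< (mono x y l)) (sym (below-< l))
    ... | tri> _ _ l = trans (below-> (mono y x l)) (sym (below-> l))
    ... | tri≈ _ e _ with Finₚ.toℕ-injective {i = x} {j = y} e
    ... | refl = trans (below-irrefl (f x)) (sym (below-irrefl (toℕ x)))

    order-f : ∀ x y z → order (f x) (f y) (f z) ≡ orderᶠ x y z
    order-f x y z = cong₂ _·_ (below-f x y) (cong₂ _·_ (below-f y z) (below-f x z))

    ∈-quad : ∀ {n} → d < n → ∀ x y z t → (x , y , z , t) ∈ arrangements → Balanced (f x) (f y) (f z) (f t) →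
      ∀ b₁ b₂ b₃ b₄ → ((f x , b₁) , (f y , b₂) , (f z , b₃) , (f t , b₄)) ∈ quads n
    ∈-quad {n} d<n x y z t m (p , q , r) b₁ b₂ b₃ b₄ =
      ∈-range (λ d → range d λ c → range c λ b → range b λ a → cell a b c d) d<n
        (∈-range (λ c → range c λ b → range b λ a → cell a b c d) c<d
          (∈-range (λ b → range b λ a → cell a b c d) b<c
            (∈-range (λ a → cell a b c d) a<b
              (∈-each (λ { π@(x , y , z , t) → bits λ b → bits λ c → bits λ d → bits λ e →
                  replicate (balanced s π) ((f x , b) , (f y , c) , (f z , d) , (f t , e)) }) m
                (∈-bits (λ b → bits λ c → bits λ d → bits λ e → leaf b c d e) b₁
                  (∈-bits (λ c → bits λ d → bits λ e → leaf b₁ c d e) b₂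
                    (∈-bits (λ d → bits λ e → leaf b₁ b₂ d e) b₃
                      (∈-bits (λ e → leaf b₁ b₂ b₃ e) b₄ (∈-replicate one)))))))))
      where
      cell : ℕ → ℕ → ℕ → ℕ → List Code
      cell a b c d = quad (pick a b c d) (pick (parity a) (parity b) (parity c) (parity d))
      s = pick (parity a) (parity b) (parity c) (parity d)
      leaf : Bool → Bool → Bool → Bool → List Code
      leaf b c d e = replicate (balanced s (x , y , z , t)) ((f x , b) , (f y , c) , (f z , d) , (f t , e))
      s≡ : ∀ x → s x ≡ parity (f x)
      s≡ = pick-map parity a b c d
      side≡ : ∀ w x y z → s w · orderᶠ x y z ≡ parity (f w) · order (f x) (f y) (f z)
      side≡ w x y z = cong₂ _·_ (s≡ w) (sym (order-f x y z))
      one : balanced s (x , y , z , t) ≡ 1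
      one = cong₂ _*_ (≡ˢ-≡ (trans (side≡ y y z t) (trans p (sym (side≡ x x z t)))))
        (cong₂ _*_ (≡ˢ-≡ (trans (side≡ x x y t) (trans q (cong opposite (sym (side≡ z y z t))))))
                   (≡ˢ-≡ (trans (side≡ z x y z) (trans r (sym (side≡ t x y t))))))

  ∈-quads : ∀ {n} i j k l → i < n → j < n → k < n → l < n → i ≢ j → i ≢ l → j ≢ k → j ≢ l → k ≢ l → i < k → Balanced i j k l →
    ∀ b₁ b₂ b₃ b₄ → ((i , b₁) , (j , b₂) , (k , b₃) , (l , b₄)) ∈ quads n
  ∈-quads {n} i j k l i<n j<n k<n l<n i≢j i≢l j≢k j≢l k≢l i<k h with <-cmp j i | <-cmp j k
  ... | tri≈ _ e _ | _ = ⊥-elim (i≢j (sym e))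
  ... | _ | tri≈ _ e _ = ⊥-elim (j≢k e)
  ... | tri< j<i _ _ | tri> _ _ k<j = ⊥-elim (<-asym j<i (<-trans i<k k<j))
  ... | tri< j<i _ _ | tri< j<k _ _ with <-cmp l j | <-cmp l i | <-cmp l k
  ...   | tri≈ _ e _ | _ | _ = ⊥-elim (j≢l (sym e))
  ...   | _ | tri≈ _ e _ | _ = ⊥-elim (i≢l (sym e))
  ...   | _ | _ | tri≈ _ e _ = ⊥-elim (k≢l (sym e))
  ...   | tri< a _ _ | _ | _ = Sorted.∈-quad a j<i i<k k<n _ _ _ _ (here refl) h
  ...   | tri> _ _ a | tri< b _ _ | _ = Sorted.∈-quad a b i<k k<n _ _ _ _ (there (here refl)) h
  ...   | tri> _ _ a | tri> _ _ b | tri< c _ _ = Sorted.∈-quad j<i b c k<n _ _ _ _ (there (there (here refl))) h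
  ...   | tri> _ _ a | tri> _ _ b | tri> _ _ c = Sorted.∈-quad j<i i<k c l<n _ _ _ _ (there (there (there (here refl)))) h
  ∈-quads {n} i j k l i<n j<n k<n l<n i≢j i≢l j≢k j≢l k≢l i<k h | tri> _ _ i<j | tri< j<k _ _ with <-cmp l i | <-cmp l j | <-cmp l k
  ...   | tri≈ _ e _ | _ | _ = ⊥-elim (i≢l (sym e))
  ...   | _ | tri≈ _ e _ | _ = ⊥-elim (j≢l (sym e))
  ...   | _ | _ | tri≈ _ e _ = ⊥-elim (k≢l (sym e))
  ...   | tri< a _ _ | _ | _ = Sorted.∈-quad a i<j j<k k<n _ _ _ _ (there (there (there (there (here refl))))) h
  ...   | tri> _ _ a | tri< b _ _ | _ = Sorted.∈-quad a b j<k k<n _ _ _ _ (there (there (there (there (there (here refl)))))) h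
  ...   | tri> _ _ a | tri> _ _ b | tri< c _ _ = Sorted.∈-quad i<j b c k<n _ _ _ _ (there (there (there (there (there (there (here refl))))))) h
  ...   | tri> _ _ a | tri> _ _ b | tri> _ _ c = Sorted.∈-quad i<j j<k c l<n _ _ _ _ (there (there (there (there (there (there (there (here refl)))))))) h
  ∈-quads {n} i j k l i<n j<n k<n l<n i≢j i≢l j≢k j≢l k≢l i<k h | tri> _ _ i<j | tri> _ _ k<j with <-cmp l i | <-cmp l k | <-cmp l j
  ...   | tri≈ _ e _ | _ | _ = ⊥-elim (i≢l (sym e))
  ...   | _ | tri≈ _ e _ | _ = ⊥-elim (k≢l (sym e))
  ...   | _ | _ | tri≈ _ e _ = ⊥-elim (j≢l (sym e))
  ...   | tri< a _ _ | _ | _ = Sorted.∈-quad a i<k k<j j<n _ _ _ _ (there (there (there (there (there (there (there (there (here refl))))))))) h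
  ...   | tri> _ _ a | tri< b _ _ | _ = Sorted.∈-quad a b k<j j<n _ _ _ _ (there (there (there (there (there (there (there (there (there (here refl)))))))))) h
  ...   | tri> _ _ a | tri> _ _ b | tri< c _ _ = Sorted.∈-quad i<k b c j<n _ _ _ _ (there (there (there (there (there (there (there (there (there (there (here refl))))))))))) h
  ...   | tri> _ _ a | tri> _ _ b | tri> _ _ c = Sorted.∈-quad i<k k<j c l<n _ _ _ _ (there (there (there (there (there (there (there (there (there (there (there (here refl)))))))))))) h

  module Codes (side : ℕ → Point → Sign) where

    χ : Point → Point → Point → Sign
    χ = orientation side

    χ-first : ∀ p q r → idx p ≡ idx q → χ p q r ≡ bit-sign (bit p) · side (idx p) r
    χ-first p q r e with idx p ≟ idx q
    ... | yes _ = refl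
    ... | no ¬e = ⊥-elim (¬e e)

    χ-second : ∀ p q r → idx p ≢ idx q → idx q ≡ idx r → χ p q r ≡ bit-sign (bit q) · side (idx q) p
    χ-second p q r n e with idx p ≟ idx q | idx q ≟ idx r
    ... | yes y | _ = ⊥-elim (n y)
    ... | no _ | yes _ = refl
    ... | no _ | no ¬e = ⊥-elim (¬e e)

    χ-third : ∀ p q r → idx p ≢ idx q → idx q ≢ idx r → idx p ≡ idx r → χ p q r ≡ bit-sign (bit r) · side (idx p) q
    χ-third p q r n m e with idx p ≟ idx q | idx q ≟ idx r | idx p ≟ idx r
    ... | yes y | _ | _ = ⊥-elim (n y)
    ... | no _ | yes y | _ = ⊥-elim (m y)
    ... | no _ | no _ | yes _ = refl
    ... | no _ | no _ | no ¬e = ⊥-elim (¬e e)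

    χ-none : ∀ p q r → idx p ≢ idx q → idx q ≢ idx r → idx p ≢ idx r → χ p q r ≡ order (idx p) (idx q) (idx r)
    χ-none p q r n m l with idx p ≟ idx q | idx q ≟ idx r | idx p ≟ idx r
    ... | yes y | _ | _ = ⊥-elim (n y)
    ... | no _ | yes y | _ = ⊥-elim (m y)
    ... | no _ | no _ | yes y = ⊥-elim (l y)
    ... | no _ | no _ | no _ = refl

    -- The side of the plane through the twins with index k on which the signed vector (-1)^i w x
    -- lies, i being the index of x.
    seen : ℕ → Point → Sign
    seen k x = parity (idx x) · side k x

    -- The ends x and y must be seen on the same side; the last condition then decides which twin
    -- has to be joined to which of them for the edges to cross.
    triple : ℕ → Point → Point → ℕ
    triple k x y = ≢ᵇ (idx x) k * (≢ᵇ (idx y) k * (≢ᵇ (idx x) (idx y) *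
      (≡ˢ (seen k x) (seen k y) * ≡ˢ (parity (idx x) · order (idx x) k (idx y)) (parity k · side k y))))

    -- Crossings of an edge of (k , false) with one of (k , true), both in the same class, whose other ends are x and y.
    triples : (ℕ → Point → Point → Code) → ℕ → List Code
    triples code n = range n λ k → range n λ i → range n λ j → bits λ b → bits λ c →
      replicate (triple k (i , b) (j , c)) (code k (i , b) (j , c))

    at-tails at-heads : ℕ → Point → Point → Code
    at-tails k x y = (k , false) , x , (k , true) , y
    at-heads k x y = x , (k , false) , y , (k , true)

    ∈-triples : ∀ code {n k x y} → k < n → idx x < n → idx y < n → idx x ≢ k → idx y ≢ k → idx x ≢ idx y →
      seen k x ≡ seen k y → parity (idx x) · order (idx x) k (idx y) ≡ parity k · side k y → code k x y ∈ triples code n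
    ∈-triples code {n} {k} {i , b} {j , c} k<n i<n j<n i≢k j≢k i≢j s o =
      ∈-range (λ k → range n λ i → range n λ j → bits λ b → bits λ c → cell k i b j c) k<n
        (∈-range (λ i → range n λ j → bits λ b → bits λ c → cell k i b j c) i<n
          (∈-range (λ j → bits λ b → bits λ c → cell k i b j c) j<n
            (∈-bits (λ b → bits λ c → cell k i b j c) b (∈-bits (λ c → cell k i b j c) c (∈-replicate one)))))
      where
      cell : ℕ → ℕ → Bool → ℕ → Bool → List Code
      cell k i b j c = replicate (triple k (i , b) (j , c)) (code k (i , b) (j , c))
      one : triple k (i , b) (j , c) ≡ 1
      one = cong₂ _*_ (≢ᵇ-≢ i≢k) (cong₂ _*_ (≢ᵇ-≢ j≢k) (cong₂ _*_ (≢ᵇ-≢ i≢j) (cong₂ _*_ (≡ˢ-≡ s) (≡ˢ-≡ o))))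

    -- The four edges from the twins of k in class + to the twins of j in class - form two disjoint
    -- couples. At most one couple crosses, and none if one of the two lines separates the other
    -- twins; `link` names the couple.
    pair : ℕ → ℕ → ℕ
    pair k j = ≢ᵇ k j * (≡ˢ (side k (j , false)) (side k (j , true)) * ≡ˢ (side j (k , false)) (side j (k , true)))

    link : ℕ → ℕ → Code
    link k j = (k , false) , (j , c) , (k , true) , (j , not c)
      where c = sign-bit (opposite (parity k · (parity j · (side k (j , false) · side j (k , false)))))

    pairs : ℕ → List Code
    pairs n = range n λ k → range n λ j → replicate (pair k j) (link k j)

    ∈-pairs : ∀ {n k j} → k < n → j < n → k ≢ j → side k (j , false) ≡ side k (j , true) → side j (k , false) ≡ side j (k , true) →
      link k j ∈ pairs n
    ∈-pairs {n} {k} {j} k<n j<n k≢j s t = ∈-range (λ k → range n λ j → replicate (pair k j) (link k j)) k<n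
      (∈-range (λ j → replicate (pair k j) (link k j)) j<n
        (∈-replicate (cong₂ _*_ (≢ᵇ-≢ k≢j) (cong₂ _*_ (≡ˢ-≡ s) (≡ˢ-≡ t)))))

    -- No pair of indices whose twin lines separate each other's twins.
    Unlinked : Set
    Unlinked = ∀ k j → k ≢ j → side k (j , false) ≢ side k (j , true) → side j (k , false) ≡ side j (k , true)

    private
      tails-lemma : ∀ k x y o s t → x · o ≡ k · t → k · opposite s ≡ y · opposite o → x · s ≡ y · t
      tails-lemma = from-yes (∀-sign? λ k → ∀-sign? λ x → ∀-sign? λ y → ∀-sign? λ o → ∀-sign? λ s → ∀-sign? λ t →
        (x · o Signₚ.≟ k · t) →-dec ((k · opposite s Signₚ.≟ y · opposite o) →-dec (x · s Signₚ.≟ y · t)))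

      tails-lemma′ : ∀ k x y o s t → x · o ≡ k · opposite t → k · s ≡ y · opposite o → (y · t ≡ x · s) × (y · opposite o ≡ k · s)
      tails-lemma′ = from-yes (∀-sign? λ k → ∀-sign? λ x → ∀-sign? λ y → ∀-sign? λ o → ∀-sign? λ s → ∀-sign? λ t →
        (x · o Signₚ.≟ k · opposite t) →-dec ((k · s Signₚ.≟ y · opposite o) →-dec ((y · t Signₚ.≟ x · s) ×-dec (y · opposite o Signₚ.≟ k · s))))

      heads-lemma : ∀ k x y o s t → x · s ≡ opposite (y · opposite t) → y · o ≡ k · s → (x · s ≡ y · t) × (x · o ≡ k · t)
      heads-lemma = from-yes (∀-sign? λ k → ∀-sign? λ x → ∀-sign? λ y → ∀-sign? λ o → ∀-sign? λ s → ∀-sign? λ t →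
        (x · s Signₚ.≟ opposite (y · opposite t)) →-dec ((y · o Signₚ.≟ k · s) →-dec ((x · s Signₚ.≟ y · t) ×-dec (x · o Signₚ.≟ k · t))))

      heads-lemma′ : ∀ k x y o s t → x · opposite s ≡ opposite (y · t) → y · o ≡ k · opposite s → (y · t ≡ x · s) × (y · opposite o ≡ k · s)
      heads-lemma′ = from-yes (∀-sign? λ k → ∀-sign? λ x → ∀-sign? λ y → ∀-sign? λ o → ∀-sign? λ s → ∀-sign? λ t →
        (x · opposite s Signₚ.≟ opposite (y · t)) →-dec ((y · o Signₚ.≟ k · opposite s) →-dec ((y · t Signₚ.≟ x · s) ×-dec (y · opposite o Signₚ.≟ k · s))))

      -- Here `m` and `n` are the two bits written as signs, and `choose` looks up the side
      -- belonging to a bit, so that one finite check covers all four choices of bits.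
      pair-lemma : ∀ m n j k s₀ s₁ r₀ r₁ →
        j · (opposite n · choose m r₁ r₀) ≡ k · (m · choose n s₁ s₀) →
        k · (n · choose m r₀ r₁) ≡ opposite (k · (opposite n · choose m r₁ r₀)) →
        k · (opposite m · choose n s₀ s₁) ≡ j · (n · choose m r₀ r₁) →
        (s₀ ≡ s₁) × (r₀ ≡ r₁) × opposite (k · (j · (s₀ · r₀))) ≡ m · n
      pair-lemma = from-yes (∀-sign? λ m → ∀-sign? λ n → ∀-sign? λ j → ∀-sign? λ k → ∀-sign? λ s₀ → ∀-sign? λ s₁ → ∀-sign? λ r₀ → ∀-sign? λ r₁ →
        (j · (opposite n · choose m r₁ r₀) Signₚ.≟ k · (m · choose n s₁ s₀)) →-dec
        ((k · (n · choose m r₀ r₁) Signₚ.≟ opposite (k · (opposite n · choose m r₁ r₀))) →-dec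
        ((k · (opposite m · choose n s₀ s₁) Signₚ.≟ j · (n · choose m r₀ r₁)) →-dec
        ((s₀ Signₚ.≟ s₁) ×-dec ((r₀ Signₚ.≟ r₁) ×-dec (opposite (k · (j · (s₀ · r₀))) Signₚ.≟ m · n))))))

    codes : ℕ → List Code
    codes n = quads n ++ (triples at-tails n ++ (triples at-heads n ++ pairs n))

    in-quads : ∀ n {c} → c ∈ quads n → c ∈ codes n
    in-quads n = ∈-++⁺ˡ

    in-tails : ∀ n {c} → c ∈ triples at-tails n → c ∈ codes n
    in-tails n h = ∈-++⁺ʳ (quads n) (∈-++⁺ˡ h)

    in-heads : ∀ n {c} → c ∈ triples at-heads n → c ∈ codes n
    in-heads n h = ∈-++⁺ʳ (quads n) (∈-++⁺ʳ (triples at-tails n) (∈-++⁺ˡ h))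

    in-pairs : ∀ n {c} → c ∈ pairs n → c ∈ codes n
    in-pairs n h = ∈-++⁺ʳ (quads n) (∈-++⁺ʳ (triples at-tails n) (∈-++⁺ʳ (triples at-heads n) h))

    Listed : ℕ → Point → Point → Point → Point → Set
    Listed n p q p′ q′ = (p , q , p′ , q′) ∈ codes n ⊎ (p′ , q′ , p , q) ∈ codes n

    private
      twin : ∀ {p q : Point} → idx p ≡ idx q → p ≢ q → q ≡ (idx p , not (bit p))
      twin {i , b} {_ , c} refl h = cong (i ,_) (not-≢ λ { refl → h refl })

    -- The list has the `false` twin first. When the `true` twin comes first, the code with the
    -- edges exchanged is found instead, and `order-reverse` adapts the condition.
    listed-tails : ∀ {n q q′} k b → k < n → idx q < n → idx q′ < n → idx q ≢ idx q′ →
      Crosses side (k , b) q (k , not b) q′ → Listed n (k , b) q (k , not b) q′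
    listed-tails {n} {q} {q′} k b k<n q<n q′<n q≁q′ C = go b b₁ b₃
      where
      open Crosses C
      j = idx q
      l = idx q′
      b₁ : parity j · order j k l ≡ parity k · (bit-sign b · side k q′)
      b₁ = trans (cong (parity j ·_) (sym (χ-none q (k , not b) q′ (λ e → p≁q (sym e)) p′≁q′ q≁q′)))
        (trans balance₁ (cong (parity k ·_) (χ-first (k , b) (k , not b) q′ refl)))
      b₃ : parity k · (bit-sign (not b) · side k q) ≡ parity l · opposite (order j k l)
      b₃ = trans (cong (parity k ·_) (sym (χ-third (k , b) q (k , not b) p≁q (λ e → p≁q (sym e)) refl)))
        (trans balance₃ (cong (parity l ·_) (trans (χ-none (k , b) q q′ p≁q q≁q′ p′≁q′)
          (order-swap (λ e → p≁q (sym e)) p′≁q′ q≁q′))))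
      go : ∀ b → parity j · order j k l ≡ parity k · (bit-sign b · side k q′) →
        parity k · (bit-sign (not b) · side k q) ≡ parity l · opposite (order j k l) → Listed n (k , b) q (k , not b) q′
      go false e₁ e₃ = inj₁ (in-tails n (∈-triples at-tails k<n q<n q′<n (λ e → p≁q (sym e)) (λ e → p′≁q′ (sym e)) q≁q′
        (tails-lemma (parity k) (parity j) (parity l) (order j k l) (side k q) (side k q′) e₁ e₃) e₁))
      go true e₁ e₃ =
        let s , o = tails-lemma′ (parity k) (parity j) (parity l) (order j k l) (side k q) (side k q′) e₁ e₃
        in inj₂ (in-tails n (∈-triples at-tails k<n q′<n q<n (λ e → p′≁q′ (sym e)) (λ e → p≁q (sym e)) (λ e → q≁q′ (sym e)) s
             (trans (cong (parity l ·_) (order-reverse (λ e → p≁q (sym e)) p′≁q′ q≁q′)) o)))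

    listed-heads : ∀ {n p p′} k b → k < n → idx p < n → idx p′ < n → idx p ≢ idx p′ →
      Crosses side p (k , b) p′ (k , not b) → Listed n p (k , b) p′ (k , not b)
    listed-heads {n} {p} {p′} k b k<n p<n p′<n p≁p′ C = go b b₂ b₃
      where
      open Crosses C
      i = idx p
      j = idx p′
      b₂ : parity i · (bit-sign b · side k p) ≡ opposite (parity j · (bit-sign (not b) · side k p′))
      b₂ = trans (cong (parity i ·_) (sym (χ-second p (k , b) (k , not b) p≁q refl)))
        (trans balance₂ (cong (λ s → opposite (parity j · s)) (χ-third (k , b) p′ (k , not b) (λ e → p′≁q′ (sym e)) p′≁q′ refl)))
      b₃ : parity j · order i k j ≡ parity k · (bit-sign b · side k p)
      b₃ = trans (cong (parity j ·_) (sym (χ-none p (k , b) p′ p≁q (λ e → p′≁q′ (sym e)) p≁p′)))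
        (trans balance₃ (cong (parity k ·_) (χ-second p (k , b) (k , not b) p≁q refl)))
      go : ∀ b → parity i · (bit-sign b · side k p) ≡ opposite (parity j · (bit-sign (not b) · side k p′)) →
        parity j · order i k j ≡ parity k · (bit-sign b · side k p) → Listed n p (k , b) p′ (k , not b)
      go false e₂ e₃ =
        let s , o = heads-lemma (parity k) (parity i) (parity j) (order i k j) (side k p) (side k p′) e₂ e₃
        in inj₁ (in-heads n (∈-triples at-heads k<n p<n p′<n p≁q p′≁q′ p≁p′ s o))
      go true e₂ e₃ =
        let s , o = heads-lemma′ (parity k) (parity i) (parity j) (order i k j) (side k p) (side k p′) e₂ e₃
        in inj₂ (in-heads n (∈-triples at-heads k<n p′<n p<n p′≁q′ p≁q (λ e → p≁p′ (sym e)) s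
             (trans (cong (parity j ·_) (order-reverse p≁q (λ e → p′≁q′ (sym e)) p≁p′)) o)))

    listed-pairs : ∀ {n} k b j c → k < n → j < n → Crosses side (k , b) (j , c) (k , not b) (j , not c) →
      Listed n (k , b) (j , c) (k , not b) (j , not c)
    listed-pairs {n} k b j c k<n j<n C = go b c b₁ b₂ b₃
      where
      open Crosses C
      k≢j : k ≢ j
      k≢j = p≁q
      b₁ : parity j · (bit-sign (not c) · side j (k , not b)) ≡ parity k · (bit-sign b · side k (j , not c))
      b₁ = trans (cong (parity j ·_) (sym (χ-third (j , c) (k , not b) (j , not c) (λ e → k≢j (sym e)) k≢j refl)))
        (trans balance₁ (cong (parity k ·_) (χ-first (k , b) (k , not b) (j , not c) refl)))
      b₂ : parity k · (bit-sign c · side j (k , b)) ≡ opposite (parity k · (bit-sign (not c) · side j (k , not b)))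
      b₂ = trans (cong (parity k ·_) (sym (χ-second (k , b) (j , c) (j , not c) k≢j refl)))
        (trans balance₂ (cong (λ s → opposite (parity k · s)) (χ-third (j , c) (k , not b) (j , not c) (λ e → k≢j (sym e)) k≢j refl)))
      b₃ : parity k · (bit-sign (not b) · side k (j , c)) ≡ parity j · (bit-sign c · side j (k , b))
      b₃ = trans (cong (parity k ·_) (sym (χ-third (k , b) (j , c) (k , not b) k≢j (λ e → k≢j (sym e)) refl)))
        (trans balance₃ (cong (parity j ·_) (χ-second (k , b) (j , c) (j , not c) k≢j refl)))
      s₀ = side k (j , false)
      s₁ = side k (j , true)
      r₀ = side j (k , false)
      r₁ = side j (k , true)
      link-as : ∀ {s} → opposite (parity k · (parity j · (s₀ · r₀))) ≡ s → link k j ≡ ((k , false) , (j , sign-bit s) , (k , true) , (j , not (sign-bit s)))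
      link-as refl = refl
      member : ∀ {s} → (s₀ ≡ s₁) × (r₀ ≡ r₁) × opposite (parity k · (parity j · (s₀ · r₀))) ≡ s →
        ((k , false) , (j , sign-bit s) , (k , true) , (j , not (sign-bit s))) ∈ codes n
      member (p , q , r) = in-pairs n (subst (_∈ pairs n) (link-as r) (∈-pairs k<n j<n k≢j p q))
      go : ∀ b c → parity j · (bit-sign (not c) · side j (k , not b)) ≡ parity k · (bit-sign b · side k (j , not c)) →
        parity k · (bit-sign c · side j (k , b)) ≡ opposite (parity k · (bit-sign (not c) · side j (k , not b))) →
        parity k · (bit-sign (not b) · side k (j , c)) ≡ parity j · (bit-sign c · side j (k , b)) →
        Listed n (k , b) (j , c) (k , not b) (j , not c)
      go false false p q r = inj₁ (member (pair-lemma Sign.+ Sign.+ (parity j) (parity k) s₀ s₁ r₀ r₁ p q r))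
      go false true p q r = inj₁ (member (pair-lemma Sign.+ Sign.- (parity j) (parity k) s₀ s₁ r₀ r₁ p q r))
      go true false p q r = inj₂ (member (pair-lemma Sign.- Sign.+ (parity j) (parity k) s₀ s₁ r₀ r₁ p q r))
      go true true p q r = inj₂ (member (pair-lemma Sign.- Sign.- (parity j) (parity k) s₀ s₁ r₀ r₁ p q r))

    listed-quads : ∀ {n p q p′ q′} → idx p < n → idx q < n → idx p′ < n → idx q′ < n →
      idx p ≢ idx p′ → idx q ≢ idx q′ → idx p ≢ idx q′ → idx q ≢ idx p′ → Crosses side p q p′ q′ → Listed n p q p′ q′
    listed-quads {n} {i , b₁} {j , b₂} {k , b₃} {l , b₄} i<n j<n k<n l<n i≢k j≢l i≢l j≢k C with <-cmp i k
    ... | tri≈ _ e _ = ⊥-elim (i≢k e)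
    ... | tri< i<k _ _ = inj₁ (in-quads n (∈-quads i j k l i<n j<n k<n l<n p≁q i≢l j≢k j≢l p′≁q′ i<k (e₁ , e₂ , e₃) b₁ b₂ b₃ b₄))
      where
      open Crosses C
      e₁ : parity j · order j k l ≡ parity i · order i k l
      e₁ = trans (cong (parity j ·_) (sym (χ-none (j , b₂) (k , b₃) (l , b₄) j≢k p′≁q′ j≢l))) (trans balance₁ (cong (parity i ·_) (χ-none (i , b₁) (k , b₃) (l , b₄) i≢k p′≁q′ i≢l)))
      e₂ : parity i · order i j l ≡ opposite (parity k · order j k l)
      e₂ = trans (cong (parity i ·_) (sym (χ-none (i , b₁) (j , b₂) (l , b₄) p≁q j≢l i≢l))) (trans balance₂ (cong (λ s → opposite (parity k · s)) (χ-none (j , b₂) (k , b₃) (l , b₄) j≢k p′≁q′ j≢l)))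
      e₃ : parity k · order i j k ≡ parity l · order i j l
      e₃ = trans (cong (parity k ·_) (sym (χ-none (i , b₁) (j , b₂) (k , b₃) p≁q j≢k i≢k))) (trans balance₃ (cong (parity l ·_) (χ-none (i , b₁) (j , b₂) (l , b₄) p≁q j≢l i≢l)))
    ... | tri> _ _ k<i = inj₂ (in-quads n (∈-quads k l i j k<n l<n i<n j<n p′≁q′ (λ e → j≢k (sym e)) (λ e → i≢l (sym e)) (λ e → j≢l (sym e)) p≁q k<i
        (e₁ , e₂ , e₃) b₃ b₄ b₁ b₂))
      where
      open Crosses C
      A = χ-none (j , b₂) (k , b₃) (l , b₄) j≢k p′≁q′ j≢l
      B = χ-none (i , b₁) (k , b₃) (l , b₄) i≢k p′≁q′ i≢l
      D = χ-none (i , b₁) (j , b₂) (k , b₃) p≁q j≢k i≢k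
      E = χ-none (i , b₁) (j , b₂) (l , b₄) p≁q j≢l i≢l
      flip : ∀ a b {s t} → a · s ≡ opposite (b · t) → b · t ≡ opposite (a · s)
      flip a b {s} {t} e = trans (sym (Signₚ.opposite-involutive (b · t))) (cong opposite (sym e))
      e₁ : parity l · order l i j ≡ parity k · order k i j
      e₁ = trans (cong (parity l ·_) (trans (order-rotate (λ e → i≢l (sym e)) p≁q (λ e → j≢l (sym e))) (sym E)))
        (trans (sym balance₃) (cong (parity k ·_) (trans D (sym (order-rotate (λ e → i≢k (sym e)) p≁q (λ e → j≢k (sym e)))))))
      e₂ : parity k · order k l j ≡ opposite (parity i · order l i j)
      e₂ = trans (cong (parity k ·_) (trans (sym (order-rotate j≢k p′≁q′ j≢l)) (sym A)))
        (trans (flip (parity i) (parity k) balance₂)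
          (cong (λ s → opposite (parity i · s)) (trans E (sym (order-rotate (λ e → i≢l (sym e)) p≁q (λ e → j≢l (sym e)))))))
      e₃ : parity i · order k l i ≡ parity j · order k l j
      e₃ = trans (cong (parity i ·_) (trans (sym (order-rotate i≢k p′≁q′ i≢l)) (sym B)))
        (trans (sym balance₁) (cong (parity j ·_) (trans A (order-rotate j≢k p′≁q′ j≢l))))

    -- With respect to two further indices the twins p and q′ have the same orientation, so `B q′`
    -- behaves like the antipode of `A p`. In the relation of the four ends these two would have
    -- equal signs, whereas a crossing needs opposite ones.
    ¬tail-head : ∀ {p q p′ q′} → idx p ≡ idx q′ → idx q ≢ idx p′ → ¬ Crosses side p q p′ q′
    ¬tail-head {p} {q} {p′} {q′} e q≁p′ C = Signₚ.s≢opposite[s] _ (trans (cong (parity (idx p′) ·_) χ₁≡χ₄)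
        (trans balance₃ (trans (cong (λ i → parity i · χ p q q′) (sym e)) balance₂)))
      where
      open Crosses C
      p≁p′ : idx p ≢ idx p′
      p≁p′ h = p′≁q′ (trans (sym h) e)
      χ₁≡χ₄ : χ q p′ q′ ≡ χ p q p′
      χ₁≡χ₄ = trans (χ-none q p′ q′ q≁p′ p′≁q′ (λ h → p≁q (trans e (sym h))))
        (trans (cong (order (idx q) (idx p′)) (sym e))
          (trans (sym (order-rotate p≁q q≁p′ p≁p′)) (sym (χ-none p q p′ p≁q q≁p′ p≁p′))))

    ¬head-tail : ∀ {p q p′ q′} → idx q ≡ idx p′ → idx p ≢ idx q′ → ¬ Crosses side p q p′ q′
    ¬head-tail {p} {q} {p′} {q′} e p≁q′ C = Signₚ.s≢opposite[s] _ (trans (cong (λ i → parity i · χ q p′ q′) (sym e))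
        (trans balance₁ (trans (cong (parity (idx p) ·_) χ₂≡χ₃) balance₂)))
      where
      open Crosses C
      χ₂≡χ₃ : χ p p′ q′ ≡ χ p q q′
      χ₂≡χ₃ = trans (χ-none p p′ q′ (λ h → p≁q (trans h (sym e))) p′≁q′ p≁q′)
        (trans (cong (λ i → order (idx p) i (idx q′)) (sym e)) (sym (χ-none p q q′ p≁q (λ h → p′≁q′ (trans (sym e) h)) p≁q′)))

    private
      unlinked-lemma : ∀ m n i j x y r t → j · (n · r) ≡ i · (m · x) → i · (m · y) ≡ opposite (j · (n · r)) → j · (n · t) ≡ i · (m · y) →
        (x ≡ opposite y) × (r ≡ opposite t)
      unlinked-lemma = from-yes (∀-sign? λ m → ∀-sign? λ n → ∀-sign? λ i → ∀-sign? λ j → ∀-sign? λ x → ∀-sign? λ y → ∀-sign? λ r → ∀-sign? λ t →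
        (j · (n · r) Signₚ.≟ i · (m · x)) →-dec ((i · (m · y) Signₚ.≟ opposite (j · (n · r))) →-dec ((j · (n · t) Signₚ.≟ i · (m · y)) →-dec
        ((x Signₚ.≟ opposite y) ×-dec (r Signₚ.≟ opposite t)))))

      constant-bits : ∀ (g : Bool → Sign) b → g false ≡ g true → g b ≢ opposite (g (not b))
      constant-bits g false e h = Signₚ.s≢opposite[s] _ (trans (sym e) h)
      constant-bits g true e h = Signₚ.s≢opposite[s] _ (trans e h)

      flip-opposite : ∀ {s t} → s ≡ opposite t → t ≡ opposite s
      flip-opposite {s} {t} e = trans (sym (Signₚ.opposite-involutive t)) (cong opposite (sym e))

    -- When each tail is a twin of the other edge's head, the orientations depend on the two twin
    -- lines only, and a crossing forces each line to separate the other twins.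
    ¬both : Unlinked → ∀ i b j c → ¬ Crosses side (i , b) (j , c) (j , not c) (i , not b)
    ¬both unlinked i b j c C = constant-bits (λ b → side j (i , b)) b
        (unlinked i j p≁q λ h → constant-bits (λ c → side i (j , c)) c h (flip-opposite (proj₁ facts)))
        (flip-opposite (proj₂ facts))
      where
      open Crosses C
      j≢i : j ≢ i
      j≢i h = p≁q (sym h)
      facts = unlinked-lemma (bit-sign (not b)) (bit-sign c) (parity i) (parity j)
        (side i (j , not c)) (side i (j , c)) (side j (i , not b)) (side j (i , b))
        (trans (cong (parity j ·_) (sym (χ-first (j , c) (j , not c) (i , not b) refl)))
          (trans balance₁ (cong (parity i ·_) (χ-third (i , b) (j , not c) (i , not b) p≁q j≢i refl))))
        (trans (cong (parity i ·_) (sym (χ-third (i , b) (j , c) (i , not b) p≁q j≢i refl)))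
          (trans balance₂ (cong (λ s → opposite (parity j · s)) (χ-first (j , c) (j , not c) (i , not b) refl))))
        (trans (cong (parity j ·_) (sym (χ-second (i , b) (j , c) (j , not c) p≁q refl)))
          (trans balance₃ (cong (parity i ·_) (χ-third (i , b) (j , c) (i , not b) p≁q j≢i refl))))

    listed : Unlinked → ∀ {n} p q p′ q′ → idx p < n → idx q < n → idx p′ < n → idx q′ < n → Crosses side p q p′ q′ → Listed n p q p′ q′
    listed unlinked {n} p@(i , b) q@(j , c) p′@(k , d) q′@(l , e) i<n j<n k<n l<n C = go (i ≟ k) (j ≟ l) (i ≟ l) (j ≟ k)
      where
      module X = Crosses C
      pairs-case : ∀ {p′ q′} → p′ ≡ (i , not b) → q′ ≡ (j , not c) → Crosses side p q p′ q′ → Listed n p q p′ q′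
      pairs-case refl refl = listed-pairs i b j c i<n j<n
      tails-case : ∀ {p′} → p′ ≡ (i , not b) → j ≢ l → Crosses side p q p′ q′ → Listed n p q p′ q′
      tails-case refl = listed-tails i b i<n j<n l<n
      heads-case : ∀ {q′} → q′ ≡ (j , not c) → i ≢ k → Crosses side p q p′ q′ → Listed n p q p′ q′
      heads-case refl = listed-heads j c j<n i<n k<n
      both-case : ∀ {p′ q′} → p′ ≡ (j , not c) → q′ ≡ (i , not b) → ¬ Crosses side p q p′ q′
      both-case refl refl = ¬both unlinked i b j c
      go : Dec (i ≡ k) → Dec (j ≡ l) → Dec (i ≡ l) → Dec (j ≡ k) → Listed n p q p′ q′
      go (yes x) (yes y) _ _ = pairs-case (twin x X.p≢p′) (twin y X.q≢q′) C
      go (yes x) (no y) _ _ = tails-case (twin x X.p≢p′) y C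
      go (no x) (yes y) _ _ = heads-case (twin y X.q≢q′) x C
      go (no x) (no y) (yes z) (yes t) = ⊥-elim (both-case (twin t X.q≢p′) (twin z X.p≢q′) C)
      go (no x) (no y) (yes z) (no t) = ⊥-elim (¬tail-head z t C)
      go (no x) (no y) (no z) (yes t) = ⊥-elim (¬head-tail t z C)
      go (no x) (no y) (no z) (no t) = listed-quads i<n j<n k<n l<n x y z t C

-- The length of the list as a polynomial.

module Counting where
  open import Data.Nat using (ℕ; zero; suc; _+_; _*_; _≟_)
  open import Data.Nat.Properties
  open import Data.Nat.Tactic.RingSolver using (solve-∀)
  open import Data.Fin using (zero; suc)
  open import Data.Bool using (Bool; true; false)
  open import Data.List using (List; []; _∷_; length; replicate)
  open import Data.List.Properties using (length-++; length-replicate)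
  open import Data.Product using (_×_; _,_)
  open import Data.Sum using (_⊎_; inj₁; inj₂)
  open import Data.Sign using (Sign; opposite) renaming (_*_ to _·_)
  open import Relation.Nullary using (Dec; yes; no)
  open import Relation.Nullary.Decidable using (from-yes)
  open import Relation.Binary.PropositionalEquality
  open Configurations
  open Drawings
  open Enumeration

  total : ∀ {A : Set} → List A → (A → ℕ) → ℕ
  total [] f = 0
  total (x ∷ xs) f = f x + total xs f

  length-each : ∀ {A B : Set} xs (f : A → List B) → length (each xs f) ≡ total xs (λ x → length (f x))
  length-each [] f = refl
  length-each (x ∷ xs) f = trans (length-++ (f x)) (cong (length (f x) +_) (length-each xs f))

  total-cong : ∀ {A : Set} xs {f g : A → ℕ} → (∀ x → f x ≡ g x) → total xs f ≡ total xs g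
  total-cong [] h = refl
  total-cong (x ∷ xs) h = cong₂ _+_ (h x) (total-cong xs h)

  total-*ˡ : ∀ {A : Set} c xs (f : A → ℕ) → total xs (λ x → c * f x) ≡ c * total xs f
  total-*ˡ c [] f = sym (*-zeroʳ c)
  total-*ˡ c (x ∷ xs) f = trans (cong (c * f x +_) (total-*ˡ c xs f)) (sym (*-distribˡ-+ c (f x) (total xs f)))

  double-bits : ∀ {A : Set} {m} (f : Bool → List A) → (∀ b → length (f b) ≡ m) → length (bits f) ≡ 2 * m
  double-bits {m = m} f h = trans (length-bits f) (trans (cong₂ _+_ (h false) (h true)) (cong (m +_) (sym (+-identityʳ m))))

  length-quad : ∀ f s → length (quad f s) ≡ 16 * total arrangements (balanced s)
  length-quad f s = trans (length-each arrangements row)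
    (trans (total-cong arrangements λ { π@(x , y , z , t) → trans
        (double-bits (λ b → bits λ c → bits λ d → bits λ e → cell π b c d e) λ b →
          double-bits (λ c → bits λ d → bits λ e → cell π b c d e) λ c →
            double-bits (λ d → bits λ e → cell π b c d e) λ d →
              double-bits (λ e → cell π b c d e) λ e → length-replicate (balanced s π))
        (lem (balanced s π)) })
      (total-*ˡ 16 arrangements (balanced s)))
    where
    cell : Arrangement → Bool → Bool → Bool → Bool → List Code
    cell π@(x , y , z , t) b c d e = replicate (balanced s π) ((f x , b) , (f y , c) , (f z , d) , (f t , e))
    row : Arrangement → List Code
    row π@(x , y , z , t) = bits λ b → bits λ c → bits λ d → bits λ e → replicate (balanced s π) ((f x , b) , (f y , c) , (f z , d) , (f t , e))
    lem : ∀ m → 2 * (2 * (2 * (2 * m))) ≡ 16 * m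
    lem = solve-∀

  eq ne : ℕ → ℕ → ℕ
  eq i j = ≡ˢ (parity i) (parity j)
  ne i j = ≡ˢ (parity i) (opposite (parity j))

  -- The sorted parities must follow the pattern xxyy, or xyyx with x and y different. Each such
  -- pattern admits 4 of the 12 arrangements; all 16 sign patterns are evaluated.
  balanced-count : ∀ a b c d → total arrangements (balanced (pick a b c d)) ≡
    4 * (≡ˢ c d * ≡ˢ a b + ≡ˢ c (opposite d) * (≡ˢ b c * ≡ˢ a (opposite b)))
  balanced-count = from-yes (∀-sign? λ a → ∀-sign? λ b → ∀-sign? λ c → ∀-sign? λ d →
    total arrangements (balanced (pick a b c d)) ≟ 4 * (≡ˢ c d * ≡ˢ a b + ≡ˢ c (opposite d) * (≡ˢ b c * ≡ˢ a (opposite b))))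

  same diff : ℕ → ℕ
  same b = sum b (λ a → eq a b)
  diff b = sum b (λ a → ne a b)

  -- The two patterns of `balanced-count` seen from c: `U` collects a, b of equal parity, to be
  -- completed by a d of the parity of c; `W` collects b like c and a unlike, to be completed by a d
  -- unlike c.
  U W : ℕ → ℕ
  U c = sum c same
  W c = sum c (λ b → eq b c * diff b)

  quads-at : ℕ → ℕ
  quads-at d = sum d (λ c → eq c d * U c + ne c d * W c)

  length-quads : ∀ n → length (quads n) ≡ 16 * (4 * sum n quads-at)
  length-quads n = begin
    length (quads n)
      ≡⟨ trans (length-range n (λ d → range d λ c → range c λ b → range b λ a → cell a b c d))
           (sum-cong n (λ d _ → trans (length-range d (λ c → range c λ b → range b λ a → cell a b c d))
             (sum-cong d λ c _ → trans (length-range c (λ b → range b λ a → cell a b c d))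
               (sum-cong c λ b _ → trans (length-range b (λ a → cell a b c d))
                 (sum-cong b λ a _ → trans (length-quad (pick a b c d) (pick (parity a) (parity b) (parity c) (parity d)))
                   (cong (16 *_) (balanced-count (parity a) (parity b) (parity c) (parity d)))))))) ⟩
    sum n (λ d → sum d λ c → sum c λ b → sum b λ a → 16 * (4 * (eq c d * eq a b + ne c d * (eq b c * ne a b))))
      ≡⟨ sum-cong n (λ d _ → level₃ d) ⟩
    sum n (λ d → 16 * (4 * quads-at d))
      ≡⟨ trans (sum-*ˡ n 16 (λ d → 4 * quads-at d)) (cong (16 *_) (sum-*ˡ n 4 quads-at)) ⟩
    16 * (4 * sum n quads-at) ∎
    where
    open ≡-Reasoning
    cell : ℕ → ℕ → ℕ → ℕ → List Code
    cell a b c d = quad (pick a b c d) (pick (parity a) (parity b) (parity c) (parity d))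
    pull : ∀ n f → sum n (λ i → 16 * (4 * f i)) ≡ 16 * (4 * sum n f)
    pull n f = trans (sum-*ˡ n 16 (λ d → 4 * f d)) (cong (16 *_) (sum-*ˡ n 4 f))
    level₁ : ∀ b c d → sum b (λ a → 16 * (4 * (eq c d * eq a b + ne c d * (eq b c * ne a b)))) ≡ 16 * (4 * (eq c d * same b + ne c d * (eq b c * diff b)))
    level₁ b c d = trans (pull b _) (cong (λ m → 16 * (4 * m)) (trans (sum-+ b (λ a → eq c d * eq a b) (λ a → ne c d * (eq b c * ne a b)))
      (cong₂ _+_ (sum-*ˡ b (eq c d) (λ a → eq a b))
        (trans (sum-*ˡ b (ne c d) (λ a → eq b c * ne a b)) (cong (ne c d *_) (sum-*ˡ b (eq b c) (λ a → ne a b)))))))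
    level₂ : ∀ c d → sum c (λ b → sum b λ a → 16 * (4 * (eq c d * eq a b + ne c d * (eq b c * ne a b)))) ≡ 16 * (4 * (eq c d * U c + ne c d * W c))
    level₂ c d = trans (sum-cong c λ b _ → level₁ b c d) (trans (pull c _) (cong (λ m → 16 * (4 * m))
      (trans (sum-+ c (λ b → eq c d * same b) (λ b → ne c d * (eq b c * diff b)))
        (cong₂ _+_ (sum-*ˡ c (eq c d) same) (sum-*ˡ c (ne c d) (λ b → eq b c * diff b))))))
    level₃ : ∀ d → sum d (λ c → sum c λ b → sum b λ a → 16 * (4 * (eq c d * eq a b + ne c d * (eq b c * ne a b)))) ≡ 16 * (4 * quads-at d)
    level₃ d = trans (sum-cong d λ c _ → level₂ c d) (pull d _)

  -- Preferred to 2 * m because it unfolds into two successors, along which sums and parities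
  -- compute.
  twice : ℕ → ℕ
  twice zero = 0
  twice (suc m) = suc (suc (twice m))

  parity-twice : ∀ m → parity (twice m) ≡ Sign.+
  parity-twice zero = refl
  parity-twice (suc m) = cong (λ s → opposite (opposite s)) (parity-twice m)

  -- Polynomial identities are kept free of subtraction: `A + x ≡ y` says that A is the polynomial y - x.
  combine : ∀ {A B a₁ a₂ b₁ b₂} c₁ c₂ → A + a₁ ≡ a₂ → B + b₁ ≡ b₂ → a₂ + b₂ + c₁ ≡ c₂ + (a₁ + b₁) → (A + B) + c₁ ≡ c₂
  combine {A} {B} {a₁} {a₂} {b₁} {b₂} c₁ c₂ p q r = +-cancelʳ-≡ (a₁ + b₁) (A + B + c₁) c₂
    (trans (lem A B c₁ a₁ b₁) (trans (cong₂ (λ m n → m + n + c₁) p q) r))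
    where lem : ∀ A B c a b → A + B + c + (a + b) ≡ (A + a) + (B + b) + c
          lem = solve-∀

  same-even : ∀ m → same (twice m) ≡ m
  same-odd : ∀ m → same (suc (twice m)) ≡ m
  same-even m = trans (sum-cong (twice m) (λ a _ → cong (≡ˢ (parity a)) (parity-twice m))) (go m)
    where
    go : ∀ m → sum (twice m) (λ a → ≡ˢ (parity a) Sign.+) ≡ m
    go zero = refl
    go (suc m) rewrite parity-twice m = cong suc (go m)
  same-odd m = trans (sum-cong (suc (twice m)) (λ a _ → cong (λ s → ≡ˢ (parity a) (opposite s)) (parity-twice m))) (go m)
    where
    go : ∀ m → sum (suc (twice m)) (λ a → ≡ˢ (parity a) Sign.-) ≡ m
    go zero = refl
    go (suc m) rewrite parity-twice m = cong suc (trans (step m) (go m))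
      where
      step : ∀ m → sum (twice m) (λ a → ≡ˢ (parity a) Sign.-) ≡ sum (suc (twice m)) (λ a → ≡ˢ (parity a) Sign.-)
      step m rewrite parity-twice m = refl

  same+diff : ∀ b → same b + diff b ≡ b
  same+diff b = trans (sym (sum-+ b (λ a → eq a b) (λ a → ne a b)))
    (trans (sum-cong b (λ a _ → lem (parity a) (parity b))) (trans (sum-const b 1) (*-identityʳ b)))
    where lem : ∀ s t → ≡ˢ s t + ≡ˢ s (opposite t) ≡ 1
          lem = from-yes (∀-sign? λ s → ∀-sign? λ t → ≡ˢ s t + ≡ˢ s (opposite t) ≟ 1)

  twice-+ : ∀ m → twice m ≡ m + m
  twice-+ zero = refl
  twice-+ (suc m) = cong suc (trans (cong suc (twice-+ m)) (sym (+-suc m m)))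

  diff-even : ∀ m → diff (twice m) ≡ m
  diff-even m = +-cancelˡ-≡ m (diff (twice m)) m (trans (cong (_+ diff (twice m)) (sym (same-even m))) (trans (same+diff (twice m)) (twice-+ m)))

  diff-odd : ∀ m → diff (suc (twice m)) ≡ suc m
  diff-odd m = +-cancelˡ-≡ m (diff (suc (twice m))) (suc m)
    (trans (cong (_+ diff (suc (twice m))) (sym (same-odd m))) (trans (same+diff (suc (twice m))) (trans (cong suc (twice-+ m)) (sym (+-suc m m)))))

  U-even : ∀ m → U (twice m) + m ≡ m * m
  U-odd : ∀ m → U (suc (twice m)) ≡ m * m
  U-even zero = refl
  U-even (suc m) rewrite same-odd m = trans (cong (λ u → m + u + suc m) (U-odd m)) (lem m)
    where lem : ∀ m → m + m * m + (1 + m) ≡ (1 + m) * (1 + m)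
          lem = solve-∀
  U-odd m rewrite same-even m = trans (+-comm m (U (twice m))) (U-even m)

  W-even : ∀ m → 2 * W (twice m) + m ≡ m * m
  W-even m = trans (cong (λ w → 2 * w + m) (sum-cong (twice m) (λ b _ → cong (λ s → ≡ˢ (parity b) s * diff b) (parity-twice m)))) (go m)
    where
    lem : ∀ m w → 2 * (m + 0 + w) + (1 + m) ≡ 2 * w + m + (2 * m + 1)
    lem = solve-∀
    lem′ : ∀ m → m * m + (2 * m + 1) ≡ (1 + m) * (1 + m)
    lem′ = solve-∀
    go : ∀ m → 2 * sum (twice m) (λ b → ≡ˢ (parity b) Sign.+ * diff b) + m ≡ m * m
    go zero = refl
    go (suc m) rewrite diff-even m | parity-twice m = trans (lem m (sum (twice m) (λ b → ≡ˢ (parity b) Sign.+ * diff b)))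
      (trans (cong (_+ (2 * m + 1)) (go m)) (lem′ m))

  W-odd : ∀ m → 2 * W (suc (twice m)) ≡ m * m + m
  W-odd m = trans (cong (2 *_) (sum-cong (suc (twice m)) (λ b _ → cong (λ s → ≡ˢ (parity b) (opposite s) * diff b) (parity-twice m)))) (go m)
    where
    lem : ∀ m w → 2 * (suc m + 0 + w) ≡ 2 * w + (2 * m + 2)
    lem = solve-∀
    lem′ : ∀ m → m * m + m + (2 * m + 2) ≡ (1 + m) * (1 + m) + (1 + m)
    lem′ = solve-∀
    drop : ∀ m → sum (suc (twice m)) (λ b → ≡ˢ (parity b) Sign.- * diff b) ≡ sum (twice m) (λ b → ≡ˢ (parity b) Sign.- * diff b)
    drop m rewrite parity-twice m = refl
    go : ∀ m → 2 * sum (suc (twice m)) (λ b → ≡ˢ (parity b) Sign.- * diff b) ≡ m * m + m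
    go zero = refl
    go (suc m) = trans (cong (2 *_) (trans (drop (suc m)) (step m)))
      (trans (lem m (sum (suc (twice m)) (λ b → ≡ˢ (parity b) Sign.- * diff b))) (trans (cong (_+ (2 * m + 2)) (go m)) (lem′ m)))
      where
      step : ∀ m → sum (twice (suc m)) (λ b → ≡ˢ (parity b) Sign.- * diff b) ≡ suc m + 0 + sum (suc (twice m)) (λ b → ≡ˢ (parity b) Sign.- * diff b)
      step m rewrite diff-odd m | parity-twice m = refl

  private
    S : Sign → ℕ → ℕ
    S s d = sum d (λ c → ≡ˢ (parity c) s * U c + ≡ˢ (parity c) (opposite s) * W c)

    term-U : ∀ s c → parity c ≡ s → ≡ˢ (parity c) s * U c + ≡ˢ (parity c) (opposite s) * W c ≡ U c
    term-U s c refl = trans (cong₂ (λ a b → a * U c + b * W c) (≡ˢ-≡ {parity c} refl) (lem (parity c))) (trans (+-identityʳ (1 * U c)) (+-identityʳ (U c)))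
      where lem : ∀ s → ≡ˢ s (opposite s) ≡ 0
            lem = from-yes (∀-sign? λ s → ≡ˢ s (opposite s) ≟ 0)

    term-W : ∀ s c → parity c ≡ opposite s → ≡ˢ (parity c) s * U c + ≡ˢ (parity c) (opposite s) * W c ≡ W c
    term-W s c e = trans (cong₂ (λ a b → a * U c + b * W c) (trans (cong (λ t → ≡ˢ t s) e) (lem s)) (≡ˢ-≡ e)) (+-identityʳ (W c))
      where lem : ∀ s → ≡ˢ (opposite s) s ≡ 0
            lem = from-yes (∀-sign? λ s → ≡ˢ (opposite s) s ≟ 0)

    parity-suc-twice : ∀ m → parity (suc (twice m)) ≡ Sign.-
    parity-suc-twice m = cong opposite (parity-twice m)

    S⁺-step : ∀ m → S Sign.+ (twice (suc m)) ≡ W (suc (twice m)) + (U (twice m) + S Sign.+ (twice m))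
    S⁺-step m = cong₂ (λ a b → a + (b + S Sign.+ (twice m))) (term-W Sign.+ (suc (twice m)) (parity-suc-twice m)) (term-U Sign.+ (twice m) (parity-twice m))

    S⁻-half : ∀ m → S Sign.- (suc (twice m)) ≡ W (twice m) + S Sign.- (twice m)
    S⁻-half m = cong (_+ S Sign.- (twice m)) (term-W Sign.- (twice m) (parity-twice m))

    S⁻-step : ∀ m → S Sign.- (twice (suc m)) ≡ U (suc (twice m)) + (W (twice m) + S Sign.- (twice m))
    S⁻-step m = cong₂ _+_ (term-U Sign.- (suc (twice m)) (parity-suc-twice m)) (S⁻-half m)

    S⁺-even : ∀ m → 4 * S Sign.+ (twice m) + 4 * (m * m) ≡ 2 * (m * m * m) + 2 * m
    S⁺-even zero = refl
    S⁺-even (suc m) = trans (cong (λ s → 4 * s + 4 * (suc m * suc m)) (S⁺-step m))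
      (trans (lem (W (suc (twice m))) (U (twice m)) (S Sign.+ (twice m)) m)
        (trans (cong₂ (λ a b → 2 * a + (4 * b + (4 * S Sign.+ (twice m) + 4 * (m * m))) + (4 * m + 4)) (W-odd m) (U-even m))
          (trans (cong (λ s → 2 * (m * m + m) + (4 * (m * m) + s) + (4 * m + 4)) (S⁺-even m)) (lem′ m))))
      where
      lem : ∀ w u s m → 4 * (w + (u + s)) + 4 * ((1 + m) * (1 + m)) ≡ 2 * (2 * w) + (4 * (u + m) + (4 * s + 4 * (m * m))) + (4 * m + 4)
      lem = solve-∀
      lem′ : ∀ m → 2 * (m * m + m) + (4 * (m * m) + (2 * (m * m * m) + 2 * m)) + (4 * m + 4) ≡ 2 * ((1 + m) * (1 + m) * (1 + m)) + 2 * (1 + m)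
      lem′ = solve-∀

    S⁻-even : ∀ m → 4 * S Sign.- (twice m) + 4 * (m * m) ≡ 2 * (m * m * m) + 2 * m
    S⁻-even zero = refl
    S⁻-even (suc m) = trans (cong (λ s → 4 * s + 4 * (suc m * suc m)) (S⁻-step m))
      (trans (lem (U (suc (twice m))) (W (twice m)) (S Sign.- (twice m)) m)
        (trans (cong₂ (λ a b → 4 * a + (2 * b + (4 * S Sign.- (twice m) + 4 * (m * m))) + (6 * m + 4)) (U-odd m) (W-even m))
          (trans (cong (λ s → 4 * (m * m) + (2 * (m * m) + s) + (6 * m + 4)) (S⁻-even m)) (lem′ m))))
      where
      lem : ∀ u w s m → 4 * (u + (w + s)) + 4 * ((1 + m) * (1 + m)) ≡ 4 * u + (2 * (2 * w + m) + (4 * s + 4 * (m * m))) + (6 * m + 4)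
      lem = solve-∀
      lem′ : ∀ m → 4 * (m * m) + (2 * (m * m) + (2 * (m * m * m) + 2 * m)) + (6 * m + 4) ≡ 2 * ((1 + m) * (1 + m) * (1 + m)) + 2 * (1 + m)
      lem′ = solve-∀

    S⁻-odd : ∀ m → 4 * S Sign.- (suc (twice m)) + 2 * (m * m) ≡ 2 * (m * m * m)
    S⁻-odd m = trans (cong (λ s → 4 * s + 2 * (m * m)) (trans (S⁻-half m) (+-comm (W (twice m)) (S Sign.- (twice m)))))
      (trans (cong (_+ 2 * (m * m)) (*-distribˡ-+ 4 (S Sign.- (twice m)) (W (twice m))))
        (combine {4 * S Sign.- (twice m)} {4 * W (twice m)} (2 * (m * m)) (2 * (m * m * m)) (S⁻-even m)
          (trans (lem (W (twice m)) m) (cong (2 *_) (W-even m))) (lem′ m)))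
      where
      lem : ∀ w m → 4 * w + 2 * m ≡ 2 * (2 * w + m)
      lem = solve-∀
      lem′ : ∀ m → 2 * (m * m * m) + 2 * m + 2 * (m * m) + 2 * (m * m) ≡ 2 * (m * m * m) + (4 * (m * m) + 2 * m)
      lem′ = solve-∀

  quads-at-even : ∀ m → 4 * quads-at (twice m) + 4 * (m * m) ≡ 2 * (m * m * m) + 2 * m
  quads-at-even m = trans (cong (λ s → 4 * sum (twice m) (λ c → ≡ˢ (parity c) s * U c + ≡ˢ (parity c) (opposite s) * W c) + 4 * (m * m)) (parity-twice m)) (S⁺-even m)

  quads-at-odd : ∀ m → 4 * quads-at (suc (twice m)) + 2 * (m * m) ≡ 2 * (m * m * m)
  quads-at-odd m = trans (cong (λ s → 4 * sum (suc (twice m)) (λ c → ≡ˢ (parity c) s * U c + ≡ˢ (parity c) (opposite s) * W c) + 2 * (m * m)) (cong opposite (parity-twice m))) (S⁻-odd m)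

  -- The values are m (m - 1)² (m - 2) for n = 2m and m² (m - 1)² for n = 2m + 1: in both cases the
  -- product of the four floors. The largest index is removed one at a time, so the two parities
  -- recurse into each other.
  quads-even : ∀ m → 4 * sum (twice m) quads-at + (4 * (m * m * m) + 2 * m) ≡ m * m * m * m + 5 * (m * m)
  quads-odd : ∀ m → 4 * sum (suc (twice m)) quads-at + 2 * (m * m * m) ≡ m * m * m * m + m * m

  quads-even zero = refl
  quads-even (suc m) = trans (cong (_+ (4 * (suc m * suc m * suc m) + 2 * suc m)) (*-distribˡ-+ 4 (quads-at (suc (twice m))) (sum (suc (twice m)) quads-at)))
    (combine {4 * quads-at (suc (twice m))} {4 * sum (suc (twice m)) quads-at} (4 * (suc m * suc m * suc m) + 2 * suc m)
      (suc m * suc m * suc m * suc m + 5 * (suc m * suc m)) (quads-at-odd m) (quads-odd m) (lem m))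
    where
    lem : ∀ m → 2 * (m * m * m) + (m * m * m * m + m * m) + (4 * ((1 + m) * (1 + m) * (1 + m)) + 2 * (1 + m))
      ≡ (1 + m) * (1 + m) * (1 + m) * (1 + m) + 5 * ((1 + m) * (1 + m)) + (2 * (m * m) + 2 * (m * m * m))
    lem = solve-∀
  quads-odd m = trans (cong (_+ 2 * (m * m * m)) (*-distribˡ-+ 4 (quads-at (twice m)) (sum (twice m) quads-at)))
    (combine {4 * quads-at (twice m)} {4 * sum (twice m) quads-at} (2 * (m * m * m)) (m * m * m * m + m * m) (quads-at-even m) (quads-even m) (lem m))
    where
    lem : ∀ m → 2 * (m * m * m) + 2 * m + (m * m * m * m + 5 * (m * m)) + 2 * (m * m * m)
      ≡ m * m * m * m + m * m + (4 * (m * m) + (4 * (m * m * m) + 2 * m))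
    lem = solve-∀

  plus minus : Sign → ℕ
  plus = ≡ˢ Sign.+
  minus = ≡ˢ Sign.-

  module Lengths (side : ℕ → Point → Sign) where
    open Codes side

    α β : ℕ → ℕ → ℕ
    α k i = ≢ᵇ i k * (plus (seen k (i , false)) + plus (seen k (i , true)))
    β k i = ≢ᵇ i k * (minus (seen k (i , false)) + minus (seen k (i , true)))

    cell : ℕ → ℕ → ℕ → ℕ
    cell k i j = (triple k (i , false) (j , false) + triple k (i , false) (j , true))
               + (triple k (i , true) (j , false) + triple k (i , true) (j , true))

    length-triples : ∀ code n → length (triples code n) ≡ sum n (λ k → sum n λ i → sum n λ j → cell k i j)
    length-triples code n = trans (length-range n (λ k → range n λ i → range n λ j → rows k i j))
      (sum-cong n λ k _ → trans (length-range n (λ i → range n λ j → rows k i j))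
        (sum-cong n λ i _ → trans (length-range n (λ j → rows k i j)) (sum-cong n λ j _ →
          trans (length-bits (λ b → bits λ c → leaf k i j b c)) (cong₂ _+_ (row k i j false) (row k i j true)))))
      where
      leaf : ℕ → ℕ → ℕ → Bool → Bool → List Code
      leaf k i j b c = replicate (triple k (i , b) (j , c)) (code k (i , b) (j , c))
      rows : ℕ → ℕ → ℕ → List Code
      rows k i j = bits λ b → bits λ c → leaf k i j b c
      row : ∀ k i j b → length (bits (leaf k i j b)) ≡ triple k (i , b) (j , false) + triple k (i , b) (j , true)
      row k i j b = trans (length-bits (leaf k i j b))
        (cong₂ _+_ (length-replicate (triple k (i , b) (j , false))) (length-replicate (triple k (i , b) (j , true))))

    private
      half-lemma : ∀ k x y o s t →
        ≡ˢ (x · s) (y · t) * ≡ˢ (x · o) (k · t) + ≡ˢ (y · t) (x · s) * ≡ˢ (y · opposite o) (k · s) ≡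
        plus (x · s) * plus (y · t) + minus (x · s) * minus (y · t)
      half-lemma = from-yes (∀-sign? λ k → ∀-sign? λ x → ∀-sign? λ y → ∀-sign? λ o → ∀-sign? λ s → ∀-sign? λ t →
        ≡ˢ (x · s) (y · t) * ≡ˢ (x · o) (k · t) + ≡ˢ (y · t) (x · s) * ≡ˢ (y · opposite o) (k · s) ≟
        plus (x · s) * plus (y · t) + minus (x · s) * minus (y · t))

    -- Of the two ways to join a twin pair to x and y, seen on the same side, exactly one has a crossing.
    triple-half : ∀ k x y → idx x ≢ k → idx y ≢ k → idx x ≢ idx y →
      triple k x y + triple k y x ≡ plus (seen k x) * plus (seen k y) + minus (seen k x) * minus (seen k y)
    triple-half k x y x≁k y≁k x≁y rewrite ≢ᵇ-≢ x≁k | ≢ᵇ-≢ y≁k | ≢ᵇ-≢ x≁y | ≢ᵇ-≢ (λ e → x≁y (sym e))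
      | order-reverse x≁k (λ e → y≁k (sym e)) x≁y = trans
        (lem (≡ˢ (seen k x) (seen k y) * ≡ˢ (parity (idx x) · order (idx x) k (idx y)) (parity k · side k y)) _)
        (half-lemma (parity k) (parity (idx x)) (parity (idx y)) (order (idx x) k (idx y)) (side k x) (side k y))
      where lem : ∀ a b → (a + 0 + 0 + 0) + (b + 0 + 0 + 0) ≡ a + b
            lem = solve-∀

    triple-zero : ∀ k x y → (≢ᵇ (idx x) k ≡ 0 ⊎ ≢ᵇ (idx y) k ≡ 0) ⊎ ≢ᵇ (idx x) (idx y) ≡ 0 → triple k x y ≡ 0
    triple-zero k x y (inj₁ (inj₁ e)) rewrite e = refl
    triple-zero k x y (inj₁ (inj₂ e)) rewrite e = *-zeroʳ (≢ᵇ (idx x) k)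
    triple-zero k x y (inj₂ e) rewrite e = trans (cong (≢ᵇ (idx x) k *_) (*-zeroʳ (≢ᵇ (idx y) k))) (*-zeroʳ (≢ᵇ (idx x) k))

    cell-zero : ∀ k i j → (≢ᵇ i k ≡ 0 ⊎ ≢ᵇ j k ≡ 0) ⊎ ≢ᵇ i j ≡ 0 → cell k i j ≡ 0
    cell-zero k i j z = cong₂ _+_
      (cong₂ _+_ (triple-zero k (i , false) (j , false) z) (triple-zero k (i , false) (j , true) z))
      (cong₂ _+_ (triple-zero k (i , true) (j , false) z) (triple-zero k (i , true) (j , true) z))

    ≢ᵇ-≡ : ∀ {i j} → i ≡ j → ≢ᵇ i j ≡ 0
    ≢ᵇ-≡ {i} refl = ≢ᵇ-refl i

    same-side : ℕ → ℕ → ℕ → ℕ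
    same-side k i j = α k i * α k j + β k i * β k j

    -- A single cell depends on the order of the indices, but by `triple-half` its sum with the
    -- transposed cell depends only on the sides.
    cell-half : ∀ k i j → cell k i j + cell k j i ≡ ≢ᵇ i j * same-side k i j
    cell-half k i j = go (i ≟ j) (i ≟ k) (j ≟ k)
      where
      zeros : ≢ᵇ i k ≡ 0 ⊎ ≢ᵇ j k ≡ 0 → same-side k i j ≡ 0
      zeros (inj₁ e) rewrite e = refl
      zeros (inj₂ e) rewrite e = cong₂ _+_ (*-zeroʳ (α k i)) (*-zeroʳ (β k i))
      lem : ∀ a b c d a′ b′ c′ d′ → ((a + b) + (c + d)) + ((a′ + b′) + (c′ + d′)) ≡ ((a + a′) + (b + c′)) + ((c + b′) + (d + d′))
      lem = solve-∀
      lem′ : ∀ p q r s m n o t → ((p * r + m * o) + (p * s + m * t)) + ((q * r + n * o) + (q * s + n * t))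
        ≡ 1 * ((1 * (p + q)) * (1 * (r + s)) + (1 * (m + n)) * (1 * (o + t)))
      lem′ = solve-∀
      go : Dec (i ≡ j) → Dec (i ≡ k) → Dec (j ≡ k) → cell k i j + cell k j i ≡ ≢ᵇ i j * same-side k i j
      go (yes e) _ _ = trans (cong₂ _+_ (cell-zero k i j (inj₂ (≢ᵇ-≡ e))) (cell-zero k j i (inj₂ (≢ᵇ-≡ (sym e)))))
        (sym (cong (_* same-side k i j) (≢ᵇ-≡ e)))
      go (no n) (yes e) _ = trans (cong₂ _+_ (cell-zero k i j (inj₁ (inj₁ (≢ᵇ-≡ e)))) (cell-zero k j i (inj₁ (inj₂ (≢ᵇ-≡ e)))))
        (sym (trans (cong (≢ᵇ i j *_) (zeros (inj₁ (≢ᵇ-≡ e)))) (*-zeroʳ (≢ᵇ i j))))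
      go (no n) (no _) (yes e) = trans (cong₂ _+_ (cell-zero k i j (inj₁ (inj₂ (≢ᵇ-≡ e)))) (cell-zero k j i (inj₁ (inj₁ (≢ᵇ-≡ e)))))
        (sym (trans (cong (≢ᵇ i j *_) (zeros (inj₂ (≢ᵇ-≡ e)))) (*-zeroʳ (≢ᵇ i j))))
      go (no n) (no i≢k) (no j≢k) = trans (lem (tr i false j false) (tr i false j true) (tr i true j false) (tr i true j true)
                                                (tr j false i false) (tr j false i true) (tr j true i false) (tr j true i true))
        (trans (cong₂ _+_ (cong₂ _+_ (half false false) (half false true)) (cong₂ _+_ (half true false) (half true true)))
          (trans (lem′ (P i false) (P i true) (P j false) (P j true) (M i false) (M i true) (M j false) (M j true))
            (sym (cong₂ (λ a b → a * same-side′ b) (≢ᵇ-≢ n) (cong₂ _,_ (≢ᵇ-≢ i≢k) (≢ᵇ-≢ j≢k))))))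
        where
        tr : ℕ → Bool → ℕ → Bool → ℕ
        tr i b j c = triple k (i , b) (j , c)
        P M : ℕ → Bool → ℕ
        P i b = plus (seen k (i , b))
        M i b = minus (seen k (i , b))
        half : ∀ b c → tr i b j c + tr j c i b ≡ P i b * P j c + M i b * M j c
        half b c = triple-half k (i , b) (j , c) i≢k j≢k n
        same-side′ : ℕ × ℕ → ℕ
        same-side′ (a , b) = (a * (P i false + P i true)) * (b * (P j false + P j true)) + (a * (M i false + M i true)) * (b * (M j false + M j true))

    squares : ℕ → ℕ → ℕ
    squares n k = sum n (λ i → same-side k i i)

    twin-count : ℕ → ℕ → ℕ
    twin-count n k = sum n λ i → sum n λ j → cell k i j

    -- A² + B² counts ordered couples of points seen on the same side. Those with equal indices are
    -- the `squares`; for the others, each unordered couple stands for one crossing.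
    twin-count-square : ∀ n k → 2 * twin-count n k + squares n k ≡ sum n (α k) * sum n (α k) + sum n (β k) * sum n (β k)
    twin-count-square n k = begin
      2 * twin-count n k + squares n k
        ≡⟨ cong (_+ squares n k) (trans (cong (twin-count n k +_) (+-identityʳ (twin-count n k)))
             (trans (cong (twin-count n k +_) (sum-swap n n (cell k)))
               (trans (sym (sum-+ n (λ i → sum n (cell k i)) (λ i → sum n (λ j → cell k j i))))
                 (sum-cong n λ i _ → trans (sym (sum-+ n (cell k i) (λ j → cell k j i))) (sum-cong n λ j _ → cell-half k i j))))) ⟩
      sum n (λ i → sum n λ j → ≢ᵇ i j * same-side k i j) + squares n k
        ≡⟨ sym (sum-+ n (λ i → sum n λ j → ≢ᵇ i j * same-side k i j) (λ i → same-side k i i)) ⟩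
      sum n (λ i → (sum n λ j → ≢ᵇ i j * same-side k i j) + same-side k i i)
        ≡⟨ sum-cong n (λ i i<n → sum-update n (λ j → ≢ᵇ i j * same-side k i j) (same-side k i) i (same-side k i i) i<n
             (λ j j≢i → trans (cong (_* same-side k i j) (≢ᵇ-≢ (λ e → j≢i (sym e)))) (+-identityʳ (same-side k i j)))
             (cong (λ m → m * same-side k i i + same-side k i i) (≢ᵇ-refl i))) ⟩
      sum n (λ i → sum n λ j → α k i * α k j + β k i * β k j)
        ≡⟨ trans (sum-cong n λ i _ → sum-+ n (λ j → α k i * α k j) (λ j → β k i * β k j))
             (sum-+ n (λ i → sum n λ j → α k i * α k j) (λ i → sum n λ j → β k i * β k j)) ⟩
      sum n (λ i → sum n λ j → α k i * α k j) + sum n (λ i → sum n λ j → β k i * β k j)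
        ≡⟨ cong₂ _+_ (sum-square n (α k)) (sum-square n (β k)) ⟩
      sum n (α k) * sum n (α k) + sum n (β k) * sum n (β k) ∎
      where open ≡-Reasoning

    split : ℕ → ℕ → ℕ
    split k j = ≢ᵇ k j * ≡ˢ (side k (j , false)) (opposite (side k (j , true)))

    -- For k ≢ j exactly one of three things holds: the couple (k, j) has a crossing, line k
    -- separates the twins of j, or line j those of k; `Unlinked` excludes the last two together. So
    -- a separation saves two crossings, one for each order of the indices. The summand n stands for
    -- the diagonal.
    length-pairs : Unlinked → ∀ n → length (pairs n) + 2 * sum n (λ k → sum n (split k)) + n ≡ n * n
    length-pairs unlinked n = begin
      length (pairs n) + 2 * splits + n
        ≡⟨ cong₂ (λ a b → a + b + n) (trans (length-range n (λ k → range n λ j → replicate (pair k j) (link k j)))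
             (sum-cong n λ k _ → trans (length-range n (λ j → replicate (pair k j) (link k j))) (sum-cong n λ j _ → length-replicate (pair k j))))
             (cong (splits +_) (trans (+-identityʳ splits) (sum-swap n n split))) ⟩
      sum n (λ k → sum n (pair k)) + (splits + sum n (λ k → sum n (λ j → split j k))) + n
        ≡⟨ cong₂ _+_ (trans (cong (sum n (λ k → sum n (pair k)) +_) (sym (sum-+ n (λ k → sum n (split k)) (λ k → sum n (λ j → split j k)))))
             (trans (sym (sum-+ n (λ k → sum n (pair k)) (λ k → sum n (split k) + sum n (λ j → split j k))))
               (sum-cong n λ k _ → trans (cong (sum n (pair k) +_) (sym (sum-+ n (split k) (λ j → split j k))))
                 (trans (sym (sum-+ n (pair k) (λ j → split k j + split j k))) (sum-cong n λ j _ → partition k j)))))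
             (sym (trans (sum-const n 1) (*-identityʳ n))) ⟩
      sum n (λ k → sum n (≢ᵇ k)) + sum n (λ _ → 1)
        ≡⟨ trans (sym (sum-+ n (λ k → sum n (≢ᵇ k)) (λ _ → 1))) (sum-cong n λ k k<n → trans
             (sum-update n (≢ᵇ k) (λ _ → 1) k 1 k<n (λ j j≢k → ≢ᵇ-≢ (λ e → j≢k (sym e))) (cong (_+ 1) (≢ᵇ-refl k)))
             (trans (sum-const n 1) (*-identityʳ n))) ⟩
      sum n (λ _ → n)
        ≡⟨ sum-const n n ⟩
      n * n ∎
      where
      open ≡-Reasoning
      splits = sum n (λ k → sum n (split k))
      signs : ∀ s t u v → (s ≢ t → u ≡ v) → ≡ˢ s t * ≡ˢ u v + (≡ˢ s (opposite t) + ≡ˢ u (opposite v)) ≡ 1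
      signs Sign.+ Sign.+ Sign.+ Sign.+ h = refl
      signs Sign.+ Sign.+ Sign.+ Sign.- h = refl
      signs Sign.+ Sign.+ Sign.- Sign.+ h = refl
      signs Sign.+ Sign.+ Sign.- Sign.- h = refl
      signs Sign.- Sign.- Sign.+ Sign.+ h = refl
      signs Sign.- Sign.- Sign.+ Sign.- h = refl
      signs Sign.- Sign.- Sign.- Sign.+ h = refl
      signs Sign.- Sign.- Sign.- Sign.- h = refl
      signs Sign.+ Sign.- u v h with h (λ ())
      ... | refl = cong suc (self u)
        where self : ∀ u → ≡ˢ u (opposite u) ≡ 0
              self = from-yes (∀-sign? λ u → ≡ˢ u (opposite u) ≟ 0)
      signs Sign.- Sign.+ u v h with h (λ ())
      ... | refl = cong suc (self u)
        where self : ∀ u → ≡ˢ u (opposite u) ≡ 0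
              self = from-yes (∀-sign? λ u → ≡ˢ u (opposite u) ≟ 0)
      partition : ∀ k j → pair k j + (split k j + split j k) ≡ ≢ᵇ k j
      partition k j = go (k ≟ j)
        where
        go : Dec (k ≡ j) → pair k j + (split k j + split j k) ≡ ≢ᵇ k j
        go (yes refl) rewrite ≢ᵇ-refl k = refl
        go (no k≢j) rewrite ≢ᵇ-≢ k≢j | ≢ᵇ-≢ (λ (e : j ≡ k) → k≢j (sym e)) = trans
          (lem (≡ˢ (side k (j , false)) (side k (j , true)) * ≡ˢ (side j (k , false)) (side j (k , true)))
               (≡ˢ (side k (j , false)) (opposite (side k (j , true)))) (≡ˢ (side j (k , false)) (opposite (side j (k , true)))))
          (signs (side k (j , false)) (side k (j , true)) (side j (k , false)) (side j (k , true)) (unlinked k j k≢j))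
          where lem : ∀ a b c → a + 0 + (b + 0 + (c + 0)) ≡ a + (b + c)
                lem = solve-∀

    -- Crossings at twin tails and at twin heads obey the same condition `triple`, so the twin count
    -- enters doubled.
    length-codes : ∀ n → length (codes n) ≡ 16 * (4 * sum n quads-at) + (sum n (λ k → 2 * twin-count n k) + length (pairs n))
    length-codes n = trans (length-++ (quads n)) (cong₂ _+_ (length-quads n)
      (trans (length-++ (triples at-tails n)) (trans (cong (length (triples at-tails n) +_) (length-++ (triples at-heads n)))
        (trans (cong₂ (λ a b → a + (b + length (pairs n))) (length-triples at-tails n) (length-triples at-heads n))
          (trans (lem (sum n (twin-count n)) (length (pairs n))) (cong (_+ length (pairs n)) (sym (sum-*ˡ n 2 (twin-count n)))))))))
      where lem : ∀ a b → a + (a + b) ≡ 2 * a + b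
            lem = solve-∀

-- Two configurations near a parabola, for odd and for even n.

module Parabolas where
  open import Data.Nat as ℕ using (ℕ; zero; suc)
  import Data.Nat.Properties as ℕₚ
  open import Data.Bool using (true; false)
  open import Data.Rational
  open import Data.Rational.Properties
  open import Data.Product using (_,_)
  open import Data.Empty using (⊥-elim)
  open import Data.Sign as Sign using (Sign)
  open import Relation.Nullary using (yes; no)
  open import Relation.Nullary.Decidable using (from-yes)
  open import Relation.Binary.PropositionalEquality
  open import Relation.Binary.Definitions using (tri<; tri≈; tri>)
  open import Tactic.RingSolver using (solve-∀)
  open Analysis
  open Vectors
  open Configurations
  open Counting using (twice)

  -- The determinant of the points (a , a² + p), (b , b² + q), (c , c² + r), with d = b - a and e = c - b.
  vandermonde : ℚ → ℚ → ℚ → ℚ → ℚ → ℚ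
  vandermonde d e p q r = (d + e) * (d * e - q) + (p * e + r * d)

  abstract
    -- Abstract, so that rational constants stay atoms in the goals. The six `special` inequalities
    -- need the actual values and therefore stand in the same block.
    ι : ℕ → ℚ
    ι zero = 0ℚ
    ι (suc n) = 1ℚ + ι n

    ι-zero : ι 0 ≡ 0ℚ
    ι-zero = refl

    ι-suc : ∀ n → ι (suc n) ≡ 1ℚ + ι n
    ι-suc n = refl

    ι-one : ι 1 ≡ 1ℚ
    ι-one = +-identityʳ 1ℚ

    -- The signs found by evaluation: the line of index 0 against index 1 and `(2 , false)` in the
    -- first three, the line of index 1 against index 0 in the next two, and a later line against
    -- the right twin just before it in the last.
    special₁ : 0ℚ < - vandermonde (ι 1) (ι 1) (- 1ℚ) (ι 3) (ι 2)
    special₁ = from-yes (0ℚ <? - vandermonde (ι 1) (ι 1) (- 1ℚ) (ι 3) (ι 2))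

    special₂ : 0ℚ < - vandermonde (ι 1) (ι 2) (- 1ℚ) (ι 3) 0ℚ
    special₂ = from-yes (0ℚ <? - vandermonde (ι 1) (ι 2) (- 1ℚ) (ι 3) 0ℚ)

    special₃ : 0ℚ < - vandermonde (ι 1) (ι 3) (- 1ℚ) (ι 3) (ι 2)
    special₃ = from-yes (0ℚ <? - vandermonde (ι 1) (ι 3) (- 1ℚ) (ι 3) (ι 2))

    special₄ : 0ℚ < - vandermonde (ι 2) (ι 1) (- 1ℚ) (ι 2) 0ℚ
    special₄ = from-yes (0ℚ <? - vandermonde (ι 2) (ι 1) (- 1ℚ) (ι 2) 0ℚ)

    special₅ : 0ℚ < vandermonde (ι 1) (ι 1) (ι 3) (ι 2) 0ℚ
    special₅ = from-yes (0ℚ <? vandermonde (ι 1) (ι 1) (ι 3) (ι 2) 0ℚ)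

    special₆ : 0ℚ < - vandermonde (ι 1) (ι 1) 0ℚ (ι 2) 0ℚ
    special₆ = from-yes (0ℚ <? - vandermonde (ι 1) (ι 1) 0ℚ (ι 2) 0ℚ)

  ι-+ : ∀ m n → ι (m ℕ.+ n) ≡ ι m + ι n
  ι-+ zero n = sym (trans (cong (_+ ι n) ι-zero) (+-identityˡ (ι n)))
  ι-+ (suc m) n = trans (ι-suc (m ℕ.+ n)) (trans (cong (1ℚ +_) (ι-+ m n))
    (trans (sym (+-assoc 1ℚ (ι m) (ι n))) (cong (_+ ι n) (sym (ι-suc m)))))

  ι-* : ∀ m n → ι (m ℕ.* n) ≡ ι m * ι n
  ι-* zero n = trans ι-zero (sym (trans (cong (_* ι n) ι-zero) (*-zeroˡ (ι n))))
  ι-* (suc m) n = trans (ι-+ n (m ℕ.* n)) (trans (cong (ι n +_) (ι-* m n))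
    (trans (lem (ι m) (ι n)) (cong (_* ι n) (sym (ι-suc m)))))
    where lem : ∀ a b → b + a * b ≡ (1ℚ + a) * b
          lem = solve-∀ ℚ-ring

  0≤ι : ∀ n → 0ℚ ≤ ι n
  0≤ι zero = ≤-reflexive (sym ι-zero)
  0≤ι (suc n) = subst (0ℚ ≤_) (sym (ι-suc n)) (+-nonneg 0≤1 (0≤ι n))

  ι-mono : ∀ {m n} → m ℕ.≤ n → ι m ≤ ι n
  ι-mono {m} {n} m≤n = subst (λ k → ι m ≤ ι k) (ℕₚ.m+[n∸m]≡n m≤n)
    (subst (ι m ≤_) (sym (ι-+ m (n ℕ.∸ m))) (p≤p+q {ι m} {ι (n ℕ.∸ m)} (0≤ι (n ℕ.∸ m))))

  0<ι : ∀ {n} → 0 ℕ.< n → 0ℚ < ι n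
  0<ι {suc n} _ = subst (0ℚ <_) (sym (ι-suc n)) (<-≤-trans 0<1 (p≤p+q {1ℚ} {ι n} (0≤ι n)))

  ι-strict : ∀ {m n} → m ℕ.< n → ι m < ι n
  ι-strict {m} m<n = <-≤-trans (subst₂ _<_ (+-identityˡ (ι m)) (sym (ι-suc m)) (+-monoˡ-< (ι m) 0<1)) (ι-mono m<n)

  ι-difference : ∀ A m → ι (A ℕ.+ m) - ι A ≡ ι m
  ι-difference A m = trans (cong (_- ι A) (ι-+ A m)) (lem (ι A) (ι m))
    where lem : ∀ a b → a + b - a ≡ b
          lem = solve-∀ ℚ-ring

  ι-gap : ∀ {A B} m → A ℕ.+ m ℕ.≤ B → ι m ≤ ι B - ι A
  ι-gap {A} {B} m h = subst (_≤ ι B - ι A) (ι-difference A m) (+-monoˡ-≤ (- ι A) (ι-mono h))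

  product-bound : ∀ m n {d e} → ι m ≤ d → ι n ≤ e → ι (m ℕ.* n) ≤ d * e
  product-bound m n {d} {e} h k = subst (_≤ d * e) (sym (ι-* m n)) (*-mono-nonneg {ι m} {d} {ι n} {e} (0≤ι m) (≤-trans (0≤ι n) k) h k)

  p<q⇒0<q-p : ∀ {p q} → p < q → 0ℚ < q - p
  p<q⇒0<q-p {p} {q} h = subst (_< q - p) (+-inverseʳ p) (+-monoˡ-< (- p) h)

  module _ {d e p q r : ℚ} (0<d : 0ℚ < d) (0<e : 0ℚ < e) where

    private
      0<d+e : 0ℚ < d + e
      0<d+e = +-pos 0<d 0<e

    -- With p and r nonnegative only the middle perturbation q can spoil convexity, and d e is the
    -- room it has. The two variants take strictness from r or p instead.
    vandermonde-pos : q < d * e → 0ℚ ≤ p → 0ℚ ≤ r → 0ℚ < vandermonde d e p q r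
    vandermonde-pos h 0≤p 0≤r = +-mono-<-≤ (*-pos 0<d+e (p<q⇒0<q-p h)) (+-nonneg (*-nonneg 0≤p (<⇒≤ 0<e)) (*-nonneg 0≤r (<⇒≤ 0<d)))

    vandermonde-posʳ : q ≤ d * e → 0ℚ ≤ p → 0ℚ < r → 0ℚ < vandermonde d e p q r
    vandermonde-posʳ h 0≤p 0<r = +-mono-≤-< (*-nonneg (<⇒≤ 0<d+e) (p≤q⇒0≤q-p h)) (+-mono-≤-< (*-nonneg 0≤p (<⇒≤ 0<e)) (*-pos 0<r 0<d))

    vandermonde-posˡ : q ≤ d * e → 0ℚ < p → 0ℚ ≤ r → 0ℚ < vandermonde d e p q r
    vandermonde-posˡ h 0<p 0≤r = +-mono-≤-< (*-nonneg (<⇒≤ 0<d+e) (p≤q⇒0≤q-p h)) (+-mono-<-≤ (*-pos 0<p 0<e) (*-nonneg 0≤r (<⇒≤ 0<d)))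

  -- The lowered first point costs e, which one unit of spare room in d e - q, multiplied by e, pays
  -- back.
  vandermonde-neg : ∀ {d e q r} → 0ℚ < d → 0ℚ < e → q + 1ℚ ≤ d * e → 0ℚ ≤ r → 0ℚ < vandermonde d e (- 1ℚ) q r
  vandermonde-neg {d} {e} {q} {r} 0<d 0<e h 0≤r = subst (0ℚ <_) (lem d e q r)
    (+-mono-<-≤ (*-pos 0<d (p<q⇒0<q-p (<-≤-trans (subst (_< q + 1ℚ) (+-identityʳ q) (+-monoʳ-< q 0<1)) h)))
      (+-nonneg (*-nonneg (<⇒≤ 0<e) (p≤q⇒0≤q-p h)) (*-nonneg 0≤r (<⇒≤ 0<d))))
    where
    lem : ∀ d e q r → d * (d * e - q) + (e * (d * e - (q + 1ℚ)) + r * d) ≡ (d + e) * (d * e - q) + ((- 1ℚ) * e + r * d)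
    lem = solve-∀ ℚ-ring

  det-parabola : ∀ a b c p q r → det ⟨ 1ℚ , a , a * a + p ⟩ ⟨ 1ℚ , b , b * b + q ⟩ ⟨ 1ℚ , c , c * c + r ⟩ ≡ vandermonde (b - a) (c - b) p q r
  det-parabola = lem
    where
    lem : ∀ a b c p q r → 1ℚ * (b * (c * c + r) - (b * b + q) * c) - a * (1ℚ * (c * c + r) - (b * b + q) * 1ℚ) + (a * a + p) * (1ℚ * c - b * 1ℚ)
      ≡ ((b - a) + (c - b)) * ((b - a) * (c - b) - q) + (p * (c - b) + r * (b - a))
    lem = solve-∀ ℚ-ring

  twice-mono : ∀ {i j} → i ℕ.< j → twice i ℕ.+ 2 ℕ.≤ twice j
  twice-mono {i} {suc j} (ℕ.s≤s i≤j) = subst (ℕ._≤ twice (suc j)) (ℕₚ.+-comm 2 (twice i)) (ℕ.s≤s (ℕ.s≤s (twice-≤ i≤j)))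
    where
    twice-≤ : ∀ {i j} → i ℕ.≤ j → twice i ℕ.≤ twice j
    twice-≤ ℕ.z≤n = ℕ.z≤n
    twice-≤ (ℕ.s≤s h) = ℕ.s≤s (ℕ.s≤s (twice-≤ h))

  module Parabola (X : Point → ℕ) (η : Point → ℚ) where

    abscissa height : Point → ℚ
    abscissa p = ι (X p)
    height p = abscissa p * abscissa p + η p

    w : Point → ℚ³
    w p = ⟨ 1ℚ , abscissa p , height p ⟩

    det-w : ∀ p q r → det (w p) (w q) (w r) ≡ vandermonde (abscissa q - abscissa p) (abscissa r - abscissa q) (η p) (η q) (η r)
    det-w p q r = det-parabola (abscissa p) (abscissa q) (abscissa r) (η p) (η q) (η r)

    apart : (∀ p q → idx p ℕ.< idx q → X p ℕ.< X q) → ∀ p q → idx p ℕ.< idx q → abscissa p + 1ℚ ≤ abscissa q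
    apart h p q l = subst (_≤ abscissa q) (trans (ι-suc (X p)) (+-comm 1ℚ (ι (X p)))) (ι-mono (h p q l))

  module OddConfiguration where

    -- Spacing 2 makes d e at least 4, more than any perturbation, so the order of the moment curve
    -- survives. The line through two twins is vertical, and its sides are left and right.
    X : Point → ℕ
    X (k , _) = twice k

    η : Point → ℚ
    η (_ , false) = 0ℚ
    η (_ , true) = ι 1

    open Parabola X η

    0≤η : ∀ p → 0ℚ ≤ η p
    0≤η (_ , false) = ≤-refl
    0≤η (_ , true) = 0≤ι 1

    η<4 : ∀ p → η p < ι 4
    η<4 (_ , false) = 0<ι (ℕ.s≤s ℕ.z≤n)
    η<4 (_ , true) = ι-strict (ℕ.s≤s (ℕ.s≤s ℕ.z≤n))

    side : ℕ → Point → Sign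
    side k x = below (idx x) k

    ordered : ∀ p q r → idx p ℕ.< idx q → idx q ℕ.< idx r → 0ℚ < det (w p) (w q) (w r)
    ordered p q r l m = subst (0ℚ <_) (sym (det-w p q r)) (vandermonde-pos (0<gap d≥2) (0<gap e≥2)
      (<-≤-trans (η<4 q) (product-bound 2 2 d≥2 e≥2)) (0≤η p) (0≤η r))
      where
      d≥2 : ι 2 ≤ abscissa q - abscissa p
      d≥2 = ι-gap {X p} {X q} 2 (twice-mono l)
      e≥2 : ι 2 ≤ abscissa r - abscissa q
      e≥2 = ι-gap {X q} {X r} 2 (twice-mono m)
      0<gap : ∀ {d} → ι 2 ≤ d → 0ℚ < d
      0<gap = <-≤-trans (0<ι (ℕ.s≤s ℕ.z≤n))

    det-twins : ∀ k r → det (w (k , false)) (w (k , true)) (w r) ≡ ι 1 * (abscissa (k , false) - abscissa r)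
    det-twins k r = trans (det-w (k , false) (k , true) r) (lem (ι (twice k)) (abscissa r) (η r) (ι 1))
      where
      lem : ∀ a c r t → ((a - a) + (c - a)) * ((a - a) * (c - a) - t) + (0ℚ * (c - a) + r * (a - a)) ≡ t * (a - c)
      lem = solve-∀ ℚ-ring

    side-sign : ∀ k r → k ≢ idx r → HasSign (side k r) (det (w (k , false)) (w (k , true)) (w r))
    side-sign k r k≢ with ℕₚ.<-cmp (idx r) k
    ... | tri≈ _ e _ = ⊥-elim (k≢ (sym e))
    ... | tri< l _ _ rewrite below-< l = subst (0ℚ <_) (sym (det-twins k r)) (*-pos (0<ι (ℕ.s≤s ℕ.z≤n))
      (p<q⇒0<q-p (ι-strict (ℕₚ.<-≤-trans (ℕₚ.m<m+n (X r) (ℕ.s≤s ℕ.z≤n)) (twice-mono l)))))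
    ... | tri> _ _ l rewrite below-> l = subst (0ℚ <_) (trans (lem (ι 1) (abscissa r) (ι (twice k))) (cong -_ (sym (det-twins k r)))) (*-pos (0<ι (ℕ.s≤s ℕ.z≤n))
      (p<q⇒0<q-p (ι-strict (ℕₚ.<-≤-trans (ℕₚ.m<m+n (twice k) (ℕ.s≤s ℕ.z≤n)) (twice-mono l)))))
      where lem : ∀ t a b → t * (a - b) ≡ - (t * (b - a))
            lem = solve-∀ ℚ-ring

    twins : ∀ k → w (k , false) ≢ w (k , true)
    twins k e = <-irrefl (trans (sym (lem A 0ℚ)) (trans (cong (λ v → ℚ³.z v - A) e) (lem A (ι 1)))) (0<ι {1} (ℕ.s≤s ℕ.z≤n))
      where
      A = ι (twice k) * ι (twice k)
      lem : ∀ a t → a + t - a ≡ t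
      lem = solve-∀ ℚ-ring

    configuration : Configuration
    configuration = record
      { abscissa = abscissa ; height = height ; side = side ; twins = twins ; ordered = ordered ; side-sign = side-sign
      ; apart = apart (λ p q l → ℕₚ.<-≤-trans (ℕₚ.m<m+n (X p) (ℕ.s≤s ℕ.z≤n)) (twice-mono l)) }

  -- The line through the twins with index k ≥ 1 separates those with index k - 1, and the line through the twins with
  -- index 0 separates those with index 2.
  module EvenConfiguration where

    X : Point → ℕ
    X (k , false) = twice k
    X (k , true) = suc (twice k)

    η : Point → ℚ
    η (zero , false) = - 1ℚ
    η (zero , true) = ι 3
    η (suc _ , false) = ι 2
    η (suc _ , true) = 0ℚ

    open Parabola X η

    side : ℕ → Point → Sign
    side zero (suc zero , _) = Sign.-
    side zero (suc (suc zero) , false) = Sign.-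
    side zero _ = Sign.+
    side (suc zero) (zero , false) = Sign.-
    side (suc zero) _ = Sign.+
    side (suc (suc k)) (i , true) with i ℕ.≟ suc k
    ... | yes _ = Sign.-
    ... | no _ = Sign.+
    side (suc (suc k)) (i , false) = Sign.+

    X-lower : ∀ k b → twice k ℕ.≤ X (k , b)
    X-lower k false = ℕₚ.≤-refl
    X-lower k true = ℕₚ.n≤1+n (twice k)

    X-upper : ∀ k b → X (k , b) ℕ.+ 1 ℕ.≤ twice k ℕ.+ 2
    X-upper k false = ℕₚ.+-monoʳ-≤ (twice k) (ℕ.s≤s ℕ.z≤n)
    X-upper k true = ℕₚ.≤-reflexive (trans (ℕₚ.+-comm (suc (twice k)) 1) (ℕₚ.+-comm 2 (twice k)))

    gap₁ : ∀ p q → idx p ℕ.< idx q → X p ℕ.+ 1 ℕ.≤ X q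
    gap₁ (i , b) (j , c) l = ℕₚ.≤-trans (X-upper i b) (ℕₚ.≤-trans (twice-mono l) (X-lower j c))

    gap₂ : ∀ i q → i ℕ.< idx q → X (i , false) ℕ.+ 2 ℕ.≤ X q
    gap₂ i (j , c) l = ℕₚ.≤-trans (twice-mono l) (X-lower j c)

    gap₃ : ∀ i j → i ℕ.< j → X (i , false) ℕ.+ 3 ℕ.≤ X (j , true)
    gap₃ i j l = subst (ℕ._≤ suc (twice j)) (sym (ℕₚ.+-suc (twice i) 2)) (ℕ.s≤s (twice-mono l))

    0<1ⁿ : ∀ {n} → 0 ℕ.< suc n
    0<1ⁿ = ℕ.s≤s ℕ.z≤n

    0≤η : ∀ p → p ≢ (0 , false) → 0ℚ ≤ η p
    0≤η (zero , false) h = ⊥-elim (h refl)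
    0≤η (zero , true) _ = 0≤ι 3
    0≤η (suc _ , false) _ = 0≤ι 2
    0≤η (suc _ , true) _ = ≤-refl

    0<gap : ∀ {d} n → ι (suc n) ≤ d → 0ℚ < d
    0<gap n = <-≤-trans (0<ι 0<1ⁿ)

    at-least : ∀ m n {d e} k → k ℕ.≤ m ℕ.* n → ι m ≤ d → ι n ≤ e → ι k ≤ d * e
    at-least m n k h x y = ≤-trans (ι-mono h) (product-bound m n x y)

    0+1≤ : ∀ {q} → ι 1 ≤ q → 0ℚ + 1ℚ ≤ q
    0+1≤ {q} = subst (_≤ q) (trans ι-one (sym (+-identityˡ 1ℚ)))

    ι+1≤ : ∀ n {q} → ι (suc n) ≤ q → ι n + 1ℚ ≤ q
    ι+1≤ n {q} = subst (_≤ q) (trans (ι-suc n) (+-comm 1ℚ (ι n)))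

    ordered⁺ : ∀ p q r → p ≢ (0 , false) → idx p ℕ.< idx q → idx q ℕ.< idx r →
      0ℚ < vandermonde (abscissa q - abscissa p) (abscissa r - abscissa q) (η p) (η q) (η r)
    ordered⁺ p (zero , _) r _ ()
    ordered⁺ p q (zero , _) _ _ ()
    ordered⁺ p q@(suc j , true) r@(suc k , _) p≢0 l m =
      vandermonde-pos (0<gap 0 d≥1) (0<gap 0 e≥1) (*-pos (0<gap 0 d≥1) (0<gap 0 e≥1)) (0≤η p p≢0) (0≤η r λ ())
      where
      d≥1 = ι-gap {X p} {X q} 1 (gap₁ p q l)
      e≥1 = ι-gap {X q} {X r} 1 (gap₁ q r m)
    -- With gaps 1 and 2 the product d e equals the perturbation 2 of q; the lift of r then gives
    -- strictness.
    ordered⁺ p q@(suc j , false) r@(suc k , false) p≢0 l m =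
      vandermonde-posʳ (0<gap 0 d≥1) (0<gap 1 e≥2) (at-least 1 2 2 ℕₚ.≤-refl d≥1 e≥2) (0≤η p p≢0) (0<ι 0<1ⁿ)
      where
      d≥1 = ι-gap {X p} {X q} 1 (gap₁ p q l)
      e≥2 = ι-gap {X q} {X r} 2 (gap₂ (suc j) r m)
    ordered⁺ p q@(suc j , false) r@(suc k , true) p≢0 l m =
      vandermonde-pos (0<gap 0 d≥1) (0<gap 2 e≥3) (<-≤-trans (ι-strict ℕₚ.≤-refl) (product-bound 1 3 d≥1 e≥3)) (0≤η p p≢0) ≤-refl
      where
      d≥1 = ι-gap {X p} {X q} 1 (gap₁ p q l)
      e≥3 = ι-gap {X q} {X r} 3 (gap₃ (suc j) (suc k) m)

    ordered⁻ : ∀ q r → 0 ℕ.< idx q → idx q ℕ.< idx r →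
      0ℚ < vandermonde (abscissa q - abscissa (0 , false)) (abscissa r - abscissa q) (- 1ℚ) (η q) (η r)
    ordered⁻ q@(suc j , true) r l m =
      vandermonde-neg {abscissa q - abscissa (0 , false)} {abscissa r - abscissa q} {0ℚ} {η r} (0<gap 0 d≥1) (0<gap 0 e≥1) (0+1≤ (at-least 1 1 1 ℕₚ.≤-refl d≥1 e≥1)) (0≤η r λ { refl → ℕₚ.n≮0 m })
      where
      d≥1 = ι-gap {0} {X q} 1 (gap₁ (0 , false) q l)
      e≥1 = ι-gap {X q} {X r} 1 (gap₁ q r m)
    ordered⁻ q@(suc j , false) r l m =
      vandermonde-neg (0<gap 1 d≥2) (0<gap 1 e≥2) (ι+1≤ 2 (at-least 2 2 3 (ℕₚ.n≤1+n 3) d≥2 e≥2)) (0≤η r λ { refl → ℕₚ.n≮0 m })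
      where
      d≥2 = ι-gap {0} {X q} 2 (gap₂ 0 q l)
      e≥2 = ι-gap {X q} {X r} 2 (gap₂ (suc j) r m)

    ordered : ∀ p q r → idx p ℕ.< idx q → idx q ℕ.< idx r → 0ℚ < det (w p) (w q) (w r)
    ordered p q r l m = subst (0ℚ <_) (sym (det-w p q r)) (go p l)
      where
      go : ∀ p → idx p ℕ.< idx q → 0ℚ < vandermonde (abscissa q - abscissa p) (abscissa r - abscissa q) (η p) (η q) (η r)
      go (zero , false) l = ordered⁻ q r l m
      go p@(zero , true) l = ordered⁺ p q r (λ ()) l m
      go p@(suc _ , _) l = ordered⁺ p q r (λ ()) l m

    unit-gap : ∀ k → abscissa (k , true) - abscissa (k , false) ≡ ι 1
    unit-gap k = trans (cong (λ n → ι n - ι (twice k)) (ℕₚ.+-comm 1 (twice k))) (ι-difference (twice k) 1)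

    det-right : ∀ k r → det (w (k , false)) (w (k , true)) (w r) ≡ vandermonde (ι 1) (abscissa r - abscissa (k , true)) (η (k , false)) (η (k , true)) (η r)
    det-right k r = trans (det-w (k , false) (k , true) r)
      (cong (λ d → vandermonde d (abscissa r - abscissa (k , true)) (η (k , false)) (η (k , true)) (η r)) (unit-gap k))

    det-left : ∀ k r → det (w (k , false)) (w (k , true)) (w r) ≡ vandermonde (abscissa (k , false) - abscissa r) (ι 1) (η r) (η (k , false)) (η (k , true))
    det-left k r = trans (sym (det-rotate (w r) (w (k , false)) (w (k , true)))) (trans (det-w r (k , false) (k , true))
      (cong (λ e → vandermonde (abscissa (k , false) - abscissa r) e (η r) (η (k , false)) (η (k , true))) (unit-gap k)))

    right-suc : ∀ k r → suc k ℕ.< idx r → 0ℚ < det (w (suc k , false)) (w (suc k , true)) (w r)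
    right-suc k r@(suc _ , _) l = subst (0ℚ <_) (sym (det-right (suc k) r))
      (vandermonde-pos (0<ι 0<1ⁿ) (0<gap 0 e≥1) (*-pos (0<ι 0<1ⁿ) (0<gap 0 e≥1)) (0≤ι 2) (0≤η r λ ()))
      where e≥1 = ι-gap {X (suc k , true)} {X r} 1 (gap₁ (suc k , true) r l)

    right-zero : ∀ r → 5 ℕ.≤ X r → 0ℚ < det (w (0 , false)) (w (0 , true)) (w r)
    right-zero (zero , false) ()
    right-zero (zero , true) (ℕ.s≤s ())
    right-zero r@(suc _ , _) l = subst (0ℚ <_) (sym (det-right 0 r))
      (vandermonde-neg (0<ι 0<1ⁿ) (0<gap 3 e≥4) (ι+1≤ 3 (product-bound 1 4 (≤-refl {ι 1}) e≥4)) (0≤η r λ ()))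
      where e≥4 = ι-gap {1} {X r} 4 l

    exact : ∀ A m B → A ℕ.+ m ≡ B → ι B - ι A ≡ ι m
    exact A m B e = trans (cong (λ n → ι n - ι A) (sym e)) (ι-difference A m)

    side-zero : ∀ r → 0 ≢ idx r → HasSign (side 0 r) (det (w (0 , false)) (w (0 , true)) (w r))
    side-zero (zero , _) h = ⊥-elim (h refl)
    side-zero r@(suc zero , false) _ = subst (λ d → 0ℚ < - d) (sym (trans (det-right 0 r) (cong (λ e → vandermonde (ι 1) e (- 1ℚ) (ι 3) (ι 2)) (exact 1 1 2 refl)))) special₁
    side-zero r@(suc zero , true) _ = subst (λ d → 0ℚ < - d) (sym (trans (det-right 0 r) (cong (λ e → vandermonde (ι 1) e (- 1ℚ) (ι 3) 0ℚ) (exact 1 2 3 refl)))) special₂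
    side-zero r@(suc (suc zero) , false) _ = subst (λ d → 0ℚ < - d) (sym (trans (det-right 0 r) (cong (λ e → vandermonde (ι 1) e (- 1ℚ) (ι 3) (ι 2)) (exact 1 3 4 refl)))) special₃
    side-zero r@(suc (suc zero) , true) _ = right-zero r ℕₚ.≤-refl
    side-zero r@(suc (suc (suc i)) , b) _ = right-zero r (ℕₚ.≤-trans (ℕ.s≤s (ℕ.s≤s (ℕ.s≤s (ℕ.s≤s (ℕ.s≤s ℕ.z≤n))))) (X-lower (suc (suc (suc i))) b))

    side-one : ∀ r → 1 ≢ idx r → HasSign (side 1 r) (det (w (1 , false)) (w (1 , true)) (w r))
    side-one r@(zero , false) _ = subst (λ d → 0ℚ < - d) (sym (trans (det-left 1 r) (cong (λ d → vandermonde d (ι 1) (- 1ℚ) (ι 2) 0ℚ) (exact 0 2 2 refl)))) special₄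
    side-one r@(zero , true) _ = subst (0ℚ <_) (sym (trans (det-left 1 r) (cong (λ d → vandermonde d (ι 1) (ι 3) (ι 2) 0ℚ) (exact 1 1 2 refl)))) special₅
    side-one (suc zero , _) h = ⊥-elim (h refl)
    side-one r@(suc (suc i) , b) _ = right-suc 0 r (ℕ.s≤s (ℕ.s≤s ℕ.z≤n))

    left-far : ∀ k r → X r ℕ.+ 3 ℕ.≤ twice (suc k) → 0ℚ < det (w (suc k , false)) (w (suc k , true)) (w r)
    left-far k r h = subst (0ℚ <_) (sym (det-left (suc k) r)) (go r (ι-gap {X r} {twice (suc k)} 3 h))
      where
      go : ∀ r → ι 3 ≤ ι (twice (suc k)) - abscissa r → 0ℚ < vandermonde (ι (twice (suc k)) - abscissa r) (ι 1) (η r) (ι 2) 0ℚ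
      go (zero , false) d≥3 = vandermonde-neg (0<gap 2 d≥3) (0<ι 0<1ⁿ) (ι+1≤ 2 (product-bound 3 1 d≥3 (≤-refl {ι 1}))) ≤-refl
      go r@(zero , true) d≥3 = vandermonde-pos (0<gap 2 d≥3) (0<ι 0<1ⁿ) (<-≤-trans (ι-strict ℕₚ.≤-refl) (product-bound 3 1 d≥3 (≤-refl {ι 1}))) (0≤η r λ ()) ≤-refl
      go r@(suc _ , _) d≥3 = vandermonde-pos (0<gap 2 d≥3) (0<ι 0<1ⁿ) (<-≤-trans (ι-strict ℕₚ.≤-refl) (product-bound 3 1 d≥3 (≤-refl {ι 1}))) (0≤η r λ ()) ≤-refl

    -- The point lies over the end of the chord, where d e equals the perturbation exactly; only its
    -- own lift puts it above the line.
    left-near : ∀ k → 0ℚ < det (w (suc (suc k) , false)) (w (suc (suc k) , true)) (w (suc k , false))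
    left-near k = subst (0ℚ <_) (sym (det-left (suc (suc k)) (suc k , false)))
      (vandermonde-posˡ (0<gap 1 d≥2) (0<ι 0<1ⁿ) (product-bound 2 1 d≥2 (≤-refl {ι 1})) (0<ι 0<1ⁿ) ≤-refl)
      where d≥2 = ι-gap {twice (suc k)} {twice (suc (suc k))} 2 (ℕₚ.≤-reflexive (ℕₚ.+-comm (twice (suc k)) 2))

    left-next : ∀ k → 0ℚ < - det (w (suc (suc k) , false)) (w (suc (suc k) , true)) (w (suc k , true))
    left-next k = subst (λ d → 0ℚ < - d) (sym (trans (det-left (suc (suc k)) (suc k , true))
      (cong (λ d → vandermonde d (ι 1) 0ℚ (ι 2) 0ℚ) (exact (suc (twice (suc k))) 1 (twice (suc (suc k))) (ℕₚ.+-comm (suc (twice (suc k))) 1))))) special₆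

    further : ∀ i k b → i ℕ.< suc k → X (i , b) ℕ.+ 3 ℕ.≤ twice (suc (suc k))
    further i k b l = ℕₚ.≤-trans (subst (ℕ._≤ twice i ℕ.+ 2 ℕ.+ 2) (ℕₚ.+-assoc (X (i , b)) 1 2) (ℕₚ.+-monoˡ-≤ 2 (X-upper i b)))
      (subst (ℕ._≤ twice (suc (suc k))) (ℕₚ.+-comm 2 (twice i ℕ.+ 2)) (ℕ.s≤s (ℕ.s≤s (twice-mono l))))

    side-more : ∀ k r → suc (suc k) ≢ idx r → HasSign (side (suc (suc k)) r) (det (w (suc (suc k) , false)) (w (suc (suc k) , true)) (w r))
    side-more k r@(i , false) h with ℕₚ.<-cmp i (suc k)
    ... | tri< l _ _ = left-far (suc k) r (further i k false l)
    ... | tri≈ _ refl _ = left-near k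
    ... | tri> _ _ l = right-suc (suc k) r (ℕₚ.≤∧≢⇒< l h)
    side-more k r@(i , true) h with i ℕ.≟ suc k
    ... | yes refl = left-next k
    ... | no i≢ with ℕₚ.<-cmp i (suc k)
    ...   | tri< l _ _ = left-far (suc k) r (further i k true l)
    ...   | tri≈ _ e _ = ⊥-elim (i≢ e)
    ...   | tri> _ _ l = right-suc (suc k) r (ℕₚ.≤∧≢⇒< l h)

    side-sign : ∀ k r → k ≢ idx r → HasSign (side k r) (det (w (k , false)) (w (k , true)) (w r))
    side-sign zero = side-zero
    side-sign (suc zero) = side-one
    side-sign (suc (suc k)) = side-more k

    twins : ∀ k → w (k , false) ≢ w (k , true)
    twins k e = <-irrefl (cong ℚ³.y e) (ι-strict {twice k} ℕₚ.≤-refl)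

    configuration : Configuration
    configuration = record
      { abscissa = abscissa ; height = height ; side = side ; twins = twins ; ordered = ordered ; side-sign = side-sign
      ; apart = apart (λ p q l → subst (ℕ._≤ X q) (ℕₚ.+-comm (X p) 1) (gap₁ p q l)) }

-- The balance of sides in both configurations, and the totals.

open import Data.Nat using (ℕ; zero; suc; _+_; _*_; _∸_; _/_; _≤_; _<_; _≥_; z≤n; s≤s; _≟_)
open import Data.Nat.Properties
open import Data.Nat.DivMod using (m/n≡1+[m∸n]/n)
open import Data.Nat.Tactic.RingSolver using (solve-∀)
open import Data.Bool using (true; false)
open import Data.List using (length)
open import Data.Product using (_,_; ∃-syntax)
open import Data.Sum using (_⊎_; inj₁; inj₂)
open import Data.Empty using (⊥-elim)
open import Data.Sign using (Sign; opposite) renaming (_*_ to _·_)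
import Data.Sign.Properties as Signₚ
open import Relation.Nullary using (Dec; yes; no)
open import Relation.Nullary.Decidable using (from-yes)
open import Relation.Binary.PropositionalEquality
open import Relation.Binary.Definitions using (tri<; tri≈; tri>)
open Configurations using (Point; below; below-<; below->)
open Drawings using (parity; ∀-sign?; module Draw)
open Enumeration
open Counting
open Parabolas

ev od : ℕ → ℕ
ev n = sum n (λ i → plus (parity i))
od n = sum n (λ i → minus (parity i))

plus-opposite : ∀ s → plus (opposite s) ≡ minus s
plus-opposite Sign.+ = refl
plus-opposite Sign.- = refl

minus-opposite : ∀ s → minus (opposite s) ≡ plus s
minus-opposite Sign.+ = refl
minus-opposite Sign.- = refl

od-suc : ∀ n → od (suc n) ≡ ev n
od-suc zero = refl
od-suc (suc n) = cong₂ _+_ (minus-opposite (parity n)) (od-suc n)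

ev-suc : ∀ n → ev (suc n) ≡ suc (od n)
ev-suc zero = refl
ev-suc (suc n) = trans (cong₂ _+_ (plus-opposite (parity n)) (ev-suc n)) (+-suc (minus (parity n)) (od n))

od-twice : ∀ m → od (twice m) ≡ m
od-twice zero = refl
od-twice (suc m) = trans (od-suc (suc (twice m))) (trans (ev-suc (twice m)) (cong suc (od-twice m)))

ev-twice : ∀ m → ev (twice m) ≡ m
ev-twice m = trans (sym (od-suc (twice m))) (suc-injective (trans (sym (ev-suc (suc (twice m)))) (trans (lem m) (cong suc refl))))
  where
  lem : ∀ m → ev (twice (suc m)) ≡ suc m
  lem zero = refl
  lem (suc m) = trans (ev-suc (suc (twice (suc m)))) (cong suc (trans (od-suc (twice (suc m))) (lem m)))

-- Confines the difference of two sums to a finite front, where it can be computed.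
sum-extend : ∀ {N n} (f g : ℕ → ℕ) c → N ≤ n → (∀ i → N ≤ i → f i ≡ g i) → sum N f + c ≡ sum N g → sum n f + c ≡ sum n g
sum-extend {N} {n} f g c N≤n tail base with m≤n⇒m<n∨m≡n N≤n
... | inj₂ refl = base
sum-extend {N} {suc n} f g c N≤n tail base | inj₁ (s≤s N≤n′) =
  trans (+-assoc (f n) (sum n f) c) (cong₂ _+_ (tail n N≤n′) (sum-extend f g c N≤n′ tail base))

halve₂ : ∀ n → suc (suc n) / 2 ≡ suc (n / 2)
halve₂ n = m/n≡1+[m∸n]/n {suc (suc n)} {2} (s≤s (s≤s z≤n))

half-even : ∀ m → twice m / 2 ≡ m
half-even zero = refl
half-even (suc m) = trans (halve₂ (twice m)) (cong suc (half-even m))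

half-odd : ∀ m → suc (twice m) / 2 ≡ m
half-odd zero = refl
half-odd (suc m) = trans (halve₂ (suc (twice m))) (cong suc (half-odd m))

bound : ℕ → ℕ
bound n = 16 * (n / 2) * ((n ∸ 1) / 2) * ((n ∸ 2) / 2) * ((n ∸ 3) / 2) + n * (n ∸ 1) * (2 * n ∸ 5)

module Pure (side : ℕ → Point → Sign) where
  open Lengths side

  module _ (k i : ℕ) (i≢k : i ≢ k) {s : Sign} (f : Codes.seen side k (i , false) ≡ s) (t : Codes.seen side k (i , true) ≡ s) where

    pure-α : α k i ≡ 2 * plus s
    pure-α = trans (cong₂ _*_ (≢ᵇ-≢ i≢k) (cong₂ (λ a b → plus a + plus b) f t)) (lem (plus s))
      where lem : ∀ a → a + a + 0 ≡ 2 * a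
            lem = solve-∀

    pure-β : β k i ≡ 2 * minus s
    pure-β = trans (cong₂ _*_ (≢ᵇ-≢ i≢k) (cong₂ (λ a b → minus a + minus b) f t)) (lem (minus s))
      where lem : ∀ a → a + a + 0 ≡ 2 * a
            lem = solve-∀

    pure-square : same-side k i i ≡ 4
    pure-square = trans (cong₂ (λ a b → a * a + b * b) pure-α pure-β) (lem s)
      where lem : ∀ s → 2 * plus s * (2 * plus s) + 2 * minus s * (2 * minus s) ≡ 4
            lem Sign.+ = refl
            lem Sign.- = refl

  self-α : ∀ k → α k k ≡ 0
  self-α k = cong (_* (plus (Codes.seen side k (k , false)) + plus (Codes.seen side k (k , true)))) (≢ᵇ-refl k)

  self-β : ∀ k → β k k ≡ 0
  self-β k = cong (_* (minus (Codes.seen side k (k , false)) + minus (Codes.seen side k (k , true)))) (≢ᵇ-refl k)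

  self-square : ∀ k → same-side k k k ≡ 0
  self-square k = cong₂ (λ a b → a * a + b * b) (self-α k) (self-β k)

·-+ : ∀ s → s · Sign.+ ≡ s
·-+ = Signₚ.*-identityʳ

·-- : ∀ s → s · Sign.- ≡ opposite s
·-- Sign.+ = refl
·-- Sign.- = refl

double-sum : ∀ n (f : ℕ → ℕ) → sum n (λ i → 2 * f i) ≡ 2 * sum n f
double-sum n f = sum-*ˡ n 2 f

module Odd where
  open OddConfiguration using (side; configuration)
  open Codes side using (Unlinked; seen; codes; listed; pairs)
  open Lengths side
  open Pure side

  unlinked : Unlinked
  unlinked k j _ h = ⊥-elim (h refl)

  seen-left : ∀ k i b → i < k → seen k (i , b) ≡ parity i
  seen-left k i b l = trans (cong (parity i ·_) (below-< l)) (·-+ (parity i))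

  seen-right : ∀ k i b → k < i → seen k (i , b) ≡ opposite (parity i)
  seen-right k i b l = trans (cong (parity i ·_) (below-> l)) (·-- (parity i))

  -- Points to the left of k count with their own parity, points to the right with the opposite one.
  -- Leaving out k shifts the latter by one place, so the signs alternate without a break and the
  -- sum does not depend on k.
  sum-α : ∀ {k n} → k < n → sum n (α k) ≡ 2 * od n
  sum-α {k} {n} k<n = trans (sym (+-identityʳ (sum n (α k)))) (trans
    (sum-extend (α k) (λ i → 2 * minus (parity i)) 0 k<n
      (λ i k<i → trans (pure-α k i (λ { refl → <-irrefl refl k<i }) (seen-right k i false k<i) (seen-right k i true k<i)) (cong (2 *_) (plus-opposite (parity i))))
      (trans (+-identityʳ (sum (suc k) (α k))) (trans (cong₂ _+_ (self-α k)
        (trans (sum-cong k λ i i<k → pure-α k i (λ { refl → <-irrefl refl i<k }) (seen-left k i false i<k) (seen-left k i true i<k)) (double-sum k (λ i → plus (parity i)))))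
        (trans (cong (2 *_) (sym (od-suc k))) (sym (double-sum (suc k) (λ i → minus (parity i))))))))
    (double-sum n (λ i → minus (parity i))))

  sum-β : ∀ {k n} → k < n → sum n (β k) + 2 ≡ 2 * ev n
  sum-β {k} {n} k<n = trans
    (sum-extend (β k) (λ i → 2 * plus (parity i)) 2 k<n
      (λ i k<i → trans (pure-β k i (λ { refl → <-irrefl refl k<i }) (seen-right k i false k<i) (seen-right k i true k<i)) (cong (2 *_) (minus-opposite (parity i))))
      (trans (cong (_+ 2) (cong₂ _+_ (self-β k)
        (trans (sum-cong k λ i i<k → pure-β k i (λ { refl → <-irrefl refl i<k }) (seen-left k i false i<k) (seen-left k i true i<k)) (double-sum k (λ i → minus (parity i))))))
        (trans (lem (od k)) (trans (cong (2 *_) (sym (ev-suc k))) (sym (double-sum (suc k) (λ i → plus (parity i))))))))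
    (double-sum n (λ i → plus (parity i)))
    where lem : ∀ a → 2 * a + 2 ≡ 2 * (1 + a)
          lem = solve-∀

  sum-squares : ∀ {k n} → k < n → squares n k + 4 ≡ n * 4
  sum-squares {k} {n} k<n = trans (sum-update n (λ i → same-side k i i) (λ _ → 4) k 4 k<n off (cong (_+ 4) (self-square k))) (sum-const n 4)
    where
    off : ∀ i → i ≢ k → same-side k i i ≡ 4
    off i i≢k with <-cmp i k
    ... | tri< l _ _ = pure-square k i i≢k (seen-left k i false l) (seen-left k i true l)
    ... | tri≈ _ e _ = ⊥-elim (i≢k e)
    ... | tri> _ _ l = pure-square k i i≢k (seen-right k i false l) (seen-right k i true l)

  module _ (m : ℕ) where
    n : ℕ
    n = suc (twice (suc m))

    -- Both sides hold n - 1 = 2 (m + 1) points.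
    twins-at : ∀ {k} → k < n → 2 * twin-count n k ≡ 8 * (suc m * m)
    twins-at {k} k<n = +-cancelʳ-≡ (8 * suc m) (2 * twin-count n k) (8 * (suc m * m)) (begin
      2 * twin-count n k + 8 * suc m
        ≡⟨ cong (2 * twin-count n k +_) (sym squares≡) ⟩
      2 * twin-count n k + squares n k
        ≡⟨ twin-count-square n k ⟩
      sum n (α k) * sum n (α k) + sum n (β k) * sum n (β k)
        ≡⟨ cong₂ (λ a b → a * a + b * b) α≡ β≡ ⟩
      2 * suc m * (2 * suc m) + 2 * suc m * (2 * suc m)
        ≡⟨ lem m ⟩
      8 * (suc m * m) + 8 * suc m ∎)
      where
      open ≡-Reasoning
      lem : ∀ m → 2 * (1 + m) * (2 * (1 + m)) + 2 * (1 + m) * (2 * (1 + m)) ≡ 8 * ((1 + m) * m) + 8 * (1 + m)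
      lem = solve-∀
      α≡ : sum n (α k) ≡ 2 * suc m
      α≡ = trans (sum-α k<n) (cong (2 *_) (trans (od-suc (twice (suc m))) (ev-twice (suc m))))
      β≡ : sum n (β k) ≡ 2 * suc m
      β≡ = +-cancelʳ-≡ 2 (sum n (β k)) (2 * suc m) (trans (sum-β k<n)
        (trans (cong (2 *_) (trans (ev-suc (twice (suc m))) (cong suc (od-twice (suc m))))) (lem′ m)))
        where lem′ : ∀ m → 2 * (2 + m) ≡ 2 * (1 + m) + 2
              lem′ = solve-∀
      squares≡ : squares n k ≡ 8 * suc m
      squares≡ = +-cancelʳ-≡ 4 (squares n k) (8 * suc m) (trans (sum-squares k<n) (trans (cong (λ t → suc t * 4) (twice-+ (suc m))) (lem′ m)))
        where lem′ : ∀ m → (1 + ((1 + m) + (1 + m))) * 4 ≡ 8 * (1 + m) + 4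
              lem′ = solve-∀

    pairs≡ : length (pairs n) ≡ n * twice (suc m)
    pairs≡ = +-cancelʳ-≡ n (length (pairs n)) (n * twice (suc m)) (trans (cong (_+ n) (sym (+-identityʳ (length (pairs n)))))
      (trans (cong (λ s → length (pairs n) + 2 * s + n) (sym no-splits)) (trans (length-pairs unlinked n) (lem (twice (suc m))))))
      where
      lem : ∀ t → (1 + t) * (1 + t) ≡ (1 + t) * t + (1 + t)
      lem = solve-∀
      no-split : ∀ k j → split k j ≡ 0
      no-split k j = trans (cong (≢ᵇ k j *_) (zero-eq (below j k))) (*-zeroʳ (≢ᵇ k j))
        where zero-eq : ∀ s → ≡ˢ s (opposite s) ≡ 0
              zero-eq = from-yes (∀-sign? λ s → ≡ˢ s (opposite s) ≟ 0)
      no-splits : sum n (λ k → sum n (split k)) ≡ 0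
      no-splits = trans (sum-cong n λ k _ → trans (sum-cong n λ j _ → no-split k j) (trans (sum-const n 0) (*-zeroʳ n))) (trans (sum-const n 0) (*-zeroʳ n))

    quads≡ : 4 * sum n quads-at ≡ suc m * suc m * m * m
    quads≡ = +-cancelʳ-≡ (2 * (suc m * suc m * suc m)) (4 * sum n quads-at) (suc m * suc m * m * m) (trans (quads-odd (suc m)) (lem m))
      where lem : ∀ m → (1 + m) * (1 + m) * (1 + m) * (1 + m) + (1 + m) * (1 + m) ≡ (1 + m) * (1 + m) * m * m + 2 * ((1 + m) * (1 + m) * (1 + m))
            lem = solve-∀

    length≡ : length (codes n) ≡ bound n
    length≡ = begin
      length (codes n)
        ≡⟨ length-codes n ⟩
      16 * (4 * sum n quads-at) + (sum n (λ k → 2 * twin-count n k) + length (pairs n))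
        ≡⟨ cong₂ (λ a b → 16 * a + b) quads≡ (cong₂ _+_ (trans (sum-cong n λ k k<n → twins-at k<n) (sum-const n (8 * (suc m * m)))) pairs≡) ⟩
      16 * (suc m * suc m * m * m) + (n * (8 * (suc m * m)) + n * twice (suc m))
        ≡⟨ cong (λ t → 16 * (suc m * suc m * m * m) + (suc t * (8 * (suc m * m)) + suc t * t)) (twice-+ (suc m)) ⟩
      16 * (suc m * suc m * m * m) + (suc (suc m + suc m) * (8 * (suc m * m)) + suc (suc m + suc m) * (suc m + suc m))
        ≡⟨ lem m ⟩
      16 * suc m * suc m * m * m + suc (suc m + suc m) * (suc m + suc m) * (4 * m + 1)
        ≡⟨ cong₂ _+_ (cong₂ (λ p q → 16 * p * q * m * m) (sym (half-odd (suc m))) (sym (half-even (suc m))))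
             (cong₂ (λ t r → suc t * t * r) (sym (twice-+ (suc m))) (sym last)) ⟩
      16 * (n / 2) * ((n ∸ 1) / 2) * m * m + n * (n ∸ 1) * (2 * n ∸ 5)
        ≡⟨ cong₂ (λ p q → 16 * (n / 2) * ((n ∸ 1) / 2) * p * q + n * (n ∸ 1) * (2 * n ∸ 5)) (sym (half-odd m)) (sym (half-even m)) ⟩
      bound n ∎
      where
      open ≡-Reasoning
      lem : ∀ m → 16 * ((1 + m) * (1 + m) * m * m) + ((1 + ((1 + m) + (1 + m))) * (8 * ((1 + m) * m)) + (1 + ((1 + m) + (1 + m))) * ((1 + m) + (1 + m)))
        ≡ 16 * (1 + m) * (1 + m) * m * m + (1 + ((1 + m) + (1 + m))) * ((1 + m) + (1 + m)) * (4 * m + 1)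
      lem = solve-∀
      -- As n is at least 3, the subtraction is not truncated.
      last : 2 * n ∸ 5 ≡ 4 * m + 1
      last = trans (cong (_∸ 5) (trans (cong (λ t → 2 * suc (suc (suc t))) (twice-+ m)) (lem′ m))) (m+n∸m≡n 5 (4 * m + 1))
        where lem′ : ∀ m → 2 * (3 + (m + m)) ≡ 5 + (4 * m + 1)
              lem′ = solve-∀

    crossing-bound : cr (K n ⊗ C₄) ≤ bound n
    crossing-bound = drawing , at-most (bound n) (codes n) (≤-reflexive length≡) (listed unlinked)
      where open Draw n configuration

module Even where
  open EvenConfiguration using (side; configuration)
  open Codes side using (Unlinked; seen; codes; listed; pairs)
  open Lengths side
  open Pure side

  -- The index whose twins are separated by the line through the twins with index k.
  partner : ℕ → ℕ
  partner zero = 2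
  partner (suc zero) = 0
  partner (suc (suc k)) = suc k

  far-side : ∀ k {i} → i ≢ suc k → side (suc (suc k)) (i , true) ≡ Sign.+
  far-side k {i} i≢ with i ≟ suc k
  ... | yes e = ⊥-elim (i≢ e)
  ... | no _ = refl

  near-side : ∀ k → side (suc (suc k)) (suc k , true) ≡ Sign.-
  near-side k with suc k ≟ suc k
  ... | yes _ = refl
  ... | no h = ⊥-elim (h refl)

  unsplit : ∀ k j → k ≢ j → j ≢ partner k → side k (j , false) ≡ side k (j , true)
  unsplit zero zero k≢j _ = ⊥-elim (k≢j refl)
  unsplit zero (suc zero) _ _ = refl
  unsplit zero (suc (suc zero)) _ h = ⊥-elim (h refl)
  unsplit zero (suc (suc (suc j))) _ _ = refl
  unsplit (suc zero) zero _ h = ⊥-elim (h refl)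
  unsplit (suc zero) (suc j) _ _ = refl
  unsplit (suc (suc k)) j _ h = sym (far-side k h)

  partner-≢ : ∀ k → k ≢ partner k
  partner-≢ zero ()
  partner-≢ (suc zero) ()
  partner-≢ (suc (suc k)) ()

  -- Partners descend to 1, then 0, and from 0 jump to 2, which closes a cycle of length three. Had
  -- the line of index 0 separated the twins of index 1, these two indices would separate each
  -- other.
  partner-partner : ∀ k → partner (partner k) ≢ k
  partner-partner zero ()
  partner-partner (suc zero) ()
  partner-partner (suc (suc zero)) ()
  partner-partner (suc (suc (suc k))) ()

  unlinked : Unlinked
  unlinked k j k≢j h with j ≟ partner k
  ... | no j≢ = ⊥-elim (h (unsplit k j k≢j j≢))
  ... | yes refl = unsplit (partner k) k (λ e → k≢j (sym e)) (λ e → partner-partner k (sym e))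

  split-partner : ∀ k → split k (partner k) ≡ 1
  split-partner zero = refl
  split-partner (suc zero) = refl
  split-partner (suc (suc k)) = cong₂ _*_ (≢ᵇ-≢ (partner-≢ (suc (suc k)))) (cong (λ s → ≡ˢ Sign.+ (opposite s)) (near-side k))

  split-zero : ∀ k j → j ≢ partner k → split k j ≡ 0
  split-zero k j h = go (k ≟ j)
    where
    differ : ∀ {s t} → s ≡ t → ≡ˢ s (opposite t) ≡ 0
    differ {Sign.+} refl = refl
    differ {Sign.-} refl = refl
    go : Dec (k ≡ j) → split k j ≡ 0
    go (yes refl) = cong (_* ≡ˢ (side k (k , false)) (opposite (side k (k , true)))) (≢ᵇ-refl k)
    go (no k≢j) = trans (cong (≢ᵇ k j *_) (differ (unsplit k j k≢j h))) (*-zeroʳ (≢ᵇ k j))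

  partner-< : ∀ {n} → 3 ≤ n → ∀ k → k < n → partner k < n
  partner-< 3≤n zero _ = 3≤n
  partner-< 3≤n (suc zero) _ = ≤-trans (s≤s z≤n) 3≤n
  partner-< 3≤n (suc (suc k)) h = <-trans (n<1+n (suc k)) h

  split-row : ∀ {n} → 3 ≤ n → ∀ k → k < n → sum n (split k) ≡ 1
  split-row {n} 3≤n k k<n = sym (trans (cong (_+ 1) (sym (trans (sum-const n 0) (*-zeroʳ n))))
    (sum-update n (λ _ → 0) (split k) (partner k) 1 (partner-< 3≤n k k<n) (λ j j≢ → sym (split-zero k j j≢)) (sym (split-partner k))))

  -- Up to this index, the sides as seen from the twins with index k may differ from the parities.
  exceptional : ℕ → ℕ
  exceptional zero = 3
  exceptional (suc zero) = 2
  exceptional (suc (suc k)) = suc (suc (suc k))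

  exceptional-≤ : ∀ {n} → 3 ≤ n → ∀ k → k < n → exceptional k ≤ n
  exceptional-≤ 3≤n zero _ = 3≤n
  exceptional-≤ 3≤n (suc zero) _ = ≤-trans (n≤1+n 2) 3≤n
  exceptional-≤ 3≤n (suc (suc k)) h = h

  ordinary : ∀ k i b → exceptional k ≤ i → side k (i , b) ≡ Sign.+
  ordinary zero (suc (suc (suc i))) b _ = refl
  ordinary zero zero b ()
  ordinary zero (suc zero) b (s≤s ())
  ordinary zero (suc (suc zero)) b (s≤s (s≤s ()))
  ordinary (suc zero) (suc i) b _ = refl
  ordinary (suc (suc k)) i false _ = refl
  ordinary (suc (suc k)) i true h = far-side k λ { refl → <-asym (n<1+n (suc k)) h }

  k<exceptional : ∀ k → k < exceptional k
  k<exceptional zero = s≤s z≤n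
  k<exceptional (suc zero) = ≤-refl
  k<exceptional (suc (suc k)) = ≤-refl

  module Tail (k i : ℕ) (h : exceptional k ≤ i) where
    i≢k : i ≢ k
    i≢k refl = <-irrefl refl (<-≤-trans (k<exceptional k) h)
    seen≡ : ∀ b → seen k (i , b) ≡ parity i
    seen≡ b = trans (cong (parity i ·_) (ordinary k i b h)) (·-+ (parity i))
    α≡ : α k i ≡ 2 * plus (parity i)
    α≡ = pure-α k i i≢k (seen≡ false) (seen≡ true)
    β≡ : β k i ≡ 2 * minus (parity i)
    β≡ = pure-β k i i≢k (seen≡ false) (seen≡ true)
    square≡ : same-side k i i ≡ 4
    square≡ = pure-square k i i≢k (seen≡ false) (seen≡ true)

  module Front (k i : ℕ) (h : i < suc k) where
    i≢k : i ≢ suc (suc k)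
    i≢k refl = <-asym h (n<1+n (suc k))
    seen≡ : ∀ b → seen (suc (suc k)) (i , b) ≡ parity i
    seen≡ false = ·-+ (parity i)
    seen≡ true = trans (cong (parity i ·_) (far-side k λ { refl → <-irrefl refl h })) (·-+ (parity i))
    α≡ : α (suc (suc k)) i ≡ 2 * plus (parity i)
    α≡ = pure-α (suc (suc k)) i i≢k (seen≡ false) (seen≡ true)
    β≡ : β (suc (suc k)) i ≡ 2 * minus (parity i)
    β≡ = pure-β (suc (suc k)) i i≢k (seen≡ false) (seen≡ true)
    square≡ : same-side (suc (suc k)) i i ≡ 4
    square≡ = pure-square (suc (suc k)) i i≢k (seen≡ false) (seen≡ true)

  one-each : ∀ (f : Sign → ℕ) s → f (s · Sign.+) + f (s · Sign.-) ≡ f s + f (opposite s)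
  one-each f s = cong₂ (λ a b → f a + f b) (·-+ s) (·-- s)

  next-α : ∀ k → α (suc (suc k)) (suc k) ≡ 1
  next-α k = cong₂ _*_ (≢ᵇ-≢ (λ e → partner-≢ (suc (suc k)) (sym e)))
    (trans (cong (λ t → plus (parity (suc k) · Sign.+) + plus (parity (suc k) · t)) (near-side k)) (trans (one-each plus (parity (suc k))) (lem (parity (suc k)))))
    where lem : ∀ s → plus s + plus (opposite s) ≡ 1
          lem = from-yes (∀-sign? λ s → plus s + plus (opposite s) ≟ 1)

  next-β : ∀ k → β (suc (suc k)) (suc k) ≡ 1
  next-β k = cong₂ _*_ (≢ᵇ-≢ (λ e → partner-≢ (suc (suc k)) (sym e)))
    (trans (cong (λ t → minus (parity (suc k) · Sign.+) + minus (parity (suc k) · t)) (near-side k)) (trans (one-each minus (parity (suc k))) (lem (parity (suc k)))))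
    where lem : ∀ s → minus s + minus (opposite s) ≡ 1
          lem = from-yes (∀-sign? λ s → minus s + minus (opposite s) ≟ 1)

  -- For k ≥ 2, index k counts nothing and its separated neighbour k - 1 counts 1, where these two
  -- indices, being of different parity, would together contribute 2. The front of k = 0 and k = 1
  -- is evaluated.
  base-α : ∀ k → sum (exceptional k) (α k) + 1 ≡ sum (exceptional k) (λ i → 2 * plus (parity i))
  base-α zero = refl
  base-α (suc zero) = refl
  base-α (suc (suc k)) = trans (cong (_+ 1) (cong₂ _+_ (self-α (suc (suc k))) (cong₂ _+_ (next-α k) (sum-cong (suc k) λ i h → Front.α≡ k i h))))
    (trans (+-comm (1 + s) 1) (trans (cong (_+ s) (sym (lem (parity k)))) (+-assoc (2 * plus (parity (suc (suc k)))) (2 * plus (parity (suc k))) s)))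
    where
    s = sum (suc k) (λ i → 2 * plus (parity i))
    lem : ∀ p → 2 * plus (opposite (opposite p)) + 2 * plus (opposite p) ≡ 2
    lem = from-yes (∀-sign? λ p → 2 * plus (opposite (opposite p)) + 2 * plus (opposite p) ≟ 2)

  base-β : ∀ k → sum (exceptional k) (β k) + 1 ≡ sum (exceptional k) (λ i → 2 * minus (parity i))
  base-β zero = refl
  base-β (suc zero) = refl
  base-β (suc (suc k)) = trans (cong (_+ 1) (cong₂ _+_ (self-β (suc (suc k))) (cong₂ _+_ (next-β k) (sum-cong (suc k) λ i h → Front.β≡ k i h))))
    (trans (+-comm (1 + s) 1) (trans (cong (_+ s) (sym (lem (parity k)))) (+-assoc (2 * minus (parity (suc (suc k)))) (2 * minus (parity (suc k))) s)))
    where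
    s = sum (suc k) (λ i → 2 * minus (parity i))
    lem : ∀ p → 2 * minus (opposite (opposite p)) + 2 * minus (opposite p) ≡ 2
    lem = from-yes (∀-sign? λ p → 2 * minus (opposite (opposite p)) + 2 * minus (opposite p) ≟ 2)

  -- The deficit 6 consists of 4 for index k itself and 2 for the separated pair, which gives 1 + 1
  -- in place of 4.
  base-squares : ∀ k → squares (exceptional k) k + 6 ≡ sum (exceptional k) (λ _ → 4)
  base-squares zero = refl
  base-squares (suc zero) = refl
  base-squares (suc (suc k)) = trans (cong (_+ 6) (cong₂ _+_ (self-square (suc (suc k)))
      (cong₂ _+_ (cong₂ (λ a b → a * a + b * b) (next-α k) (next-β k)) (sum-cong (suc k) λ i h → Front.square≡ k i h))))
    (+-comm (2 + sum (suc k) (λ _ → 4)) 6)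

  module _ {n : ℕ} (3≤n : 3 ≤ n) {k : ℕ} (k<n : k < n) where

    sum-α : sum n (α k) + 1 ≡ 2 * ev n
    sum-α = trans (sum-extend (α k) (λ i → 2 * plus (parity i)) 1 (exceptional-≤ 3≤n k k<n) (Tail.α≡ k) (base-α k)) (double-sum n (λ i → plus (parity i)))

    sum-β : sum n (β k) + 1 ≡ 2 * od n
    sum-β = trans (sum-extend (β k) (λ i → 2 * minus (parity i)) 1 (exceptional-≤ 3≤n k k<n) (Tail.β≡ k) (base-β k)) (double-sum n (λ i → minus (parity i)))

    sum-squares : squares n k + 6 ≡ n * 4
    sum-squares = trans (sum-extend (λ i → same-side k i i) (λ _ → 4) 6 (exceptional-≤ 3≤n k k<n) (Tail.square≡ k) (base-squares k)) (sum-const n 4)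

  module _ (m : ℕ) where
    n : ℕ
    n = twice (suc (suc m))

    3≤n : 3 ≤ n
    3≤n = s≤s (s≤s (s≤s z≤n))

    -- Both sides hold n - 1 = 2m + 3 points, an odd number reached through the one separated pair.
    twins-at : ∀ {k} → k < n → 2 * twin-count n k ≡ 8 * (suc m * suc m)
    twins-at {k} k<n = +-cancelʳ-≡ (8 * m + 10) (2 * twin-count n k) (8 * (suc m * suc m)) (begin
      2 * twin-count n k + (8 * m + 10)
        ≡⟨ cong (2 * twin-count n k +_) (sym squares≡) ⟩
      2 * twin-count n k + squares n k
        ≡⟨ twin-count-square n k ⟩
      sum n (α k) * sum n (α k) + sum n (β k) * sum n (β k)
        ≡⟨ cong₂ (λ a b → a * a + b * b) α≡ β≡ ⟩
      (2 * m + 3) * (2 * m + 3) + (2 * m + 3) * (2 * m + 3)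
        ≡⟨ lem m ⟩
      8 * (suc m * suc m) + (8 * m + 10) ∎)
      where
      open ≡-Reasoning
      lem : ∀ m → (2 * m + 3) * (2 * m + 3) + (2 * m + 3) * (2 * m + 3) ≡ 8 * ((1 + m) * (1 + m)) + (8 * m + 10)
      lem = solve-∀
      lem′ : ∀ m → 2 * (2 + m) ≡ 2 * m + 3 + 1
      lem′ = solve-∀
      α≡ : sum n (α k) ≡ 2 * m + 3
      α≡ = +-cancelʳ-≡ 1 (sum n (α k)) (2 * m + 3) (trans (sum-α 3≤n k<n) (trans (cong (2 *_) (ev-twice (suc (suc m)))) (lem′ m)))
      β≡ : sum n (β k) ≡ 2 * m + 3
      β≡ = +-cancelʳ-≡ 1 (sum n (β k)) (2 * m + 3) (trans (sum-β 3≤n k<n) (trans (cong (2 *_) (od-twice (suc (suc m)))) (lem′ m)))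
      squares≡ : squares n k ≡ 8 * m + 10
      squares≡ = +-cancelʳ-≡ 6 (squares n k) (8 * m + 10) (trans (sum-squares 3≤n k<n) (trans (cong (_* 4) (twice-+ (suc (suc m)))) (lem″ m)))
        where lem″ : ∀ m → (2 + m + (2 + m)) * 4 ≡ 8 * m + 10 + 6
              lem″ = solve-∀

    pairs≡ : length (pairs n) ≡ n * (2 * m + 1)
    pairs≡ = +-cancelʳ-≡ (2 * n + n) (length (pairs n)) (n * (2 * m + 1)) (trans (sym (+-assoc (length (pairs n)) (2 * n) n))
      (trans (cong (λ s → length (pairs n) + 2 * s + n) (sym splits)) (trans (length-pairs unlinked n)
        (subst (λ t → t * t ≡ t * (2 * m + 1) + (2 * t + t)) (sym (twice-+ (suc (suc m)))) (lem m)))))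
      where
      lem : ∀ m → (2 + m + (2 + m)) * (2 + m + (2 + m)) ≡ (2 + m + (2 + m)) * (2 * m + 1) + (2 * (2 + m + (2 + m)) + (2 + m + (2 + m)))
      lem = solve-∀
      splits : sum n (λ k → sum n (split k)) ≡ n
      splits = trans (sum-cong n λ k k<n → split-row 3≤n k k<n) (trans (sum-const n 1) (*-identityʳ n))

    quads≡ : 4 * sum n quads-at ≡ suc (suc m) * suc m * suc m * m
    quads≡ = +-cancelʳ-≡ (4 * (M * M * M) + 2 * M) (4 * sum n quads-at) (suc (suc m) * suc m * suc m * m) (trans (quads-even M) (lem m))
      where
      M = suc (suc m)
      lem : ∀ m → (2 + m) * (2 + m) * (2 + m) * (2 + m) + 5 * ((2 + m) * (2 + m)) ≡ (2 + m) * (1 + m) * (1 + m) * m + (4 * ((2 + m) * (2 + m) * (2 + m)) + 2 * (2 + m))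
      lem = solve-∀

    length≡ : length (codes n) ≡ bound n
    length≡ = begin
      length (codes n)
        ≡⟨ length-codes n ⟩
      16 * (4 * sum n quads-at) + (sum n (λ k → 2 * twin-count n k) + length (pairs n))
        ≡⟨ cong₂ (λ a b → 16 * a + b) quads≡ (cong₂ _+_ (trans (sum-cong n λ k k<n → twins-at k<n) (sum-const n (8 * (suc m * suc m)))) pairs≡) ⟩
      16 * (suc (suc m) * suc m * suc m * m) + (n * (8 * (suc m * suc m)) + n * (2 * m + 1))
        ≡⟨ lem m n ⟩
      16 * suc (suc m) * suc m * suc m * m + n * (3 + (m + m)) * (4 * m + 3)
        ≡⟨ cong₂ _+_ (cong₂ (λ p q → 16 * p * q * suc m * m) (sym (half-even (suc (suc m)))) (sym (half-odd (suc m))))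
             (cong₂ (λ t r → n * (3 + t) * r) (sym (twice-+ m)) (sym last)) ⟩
      16 * (n / 2) * ((n ∸ 1) / 2) * suc m * m + n * (n ∸ 1) * (2 * n ∸ 5)
        ≡⟨ cong₂ (λ p q → 16 * (n / 2) * ((n ∸ 1) / 2) * p * q + n * (n ∸ 1) * (2 * n ∸ 5)) (sym (half-even (suc m))) (sym (half-odd m)) ⟩
      bound n ∎
      where
      open ≡-Reasoning
      lem : ∀ m n → 16 * ((2 + m) * (1 + m) * (1 + m) * m) + (n * (8 * ((1 + m) * (1 + m))) + n * (2 * m + 1))
        ≡ 16 * (2 + m) * (1 + m) * (1 + m) * m + n * (3 + (m + m)) * (4 * m + 3)
      lem = solve-∀
      last : 2 * n ∸ 5 ≡ 4 * m + 3
      last = trans (cong (_∸ 5) (trans (cong (λ t → 2 * suc (suc (suc (suc t)))) (twice-+ m)) (lem′ m))) (m+n∸m≡n 5 (4 * m + 3))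
        where lem′ : ∀ m → 2 * (4 + (m + m)) ≡ 5 + (4 * m + 3)
              lem′ = solve-∀

    crossing-bound : cr (K n ⊗ C₄) ≤ bound n
    crossing-bound = drawing , at-most (bound n) (codes n) (≤-reflexive length≡) (listed unlinked)
      where open Draw n configuration

even-or-odd : ∀ n → (∃[ m ] n ≡ twice m) ⊎ (∃[ m ] n ≡ suc (twice m))
even-or-odd zero = inj₁ (0 , refl)
even-or-odd (suc n) with even-or-odd n
... | inj₁ (m , refl) = inj₂ (m , refl)
... | inj₂ (m , refl) = inj₁ (suc m , refl)

theorem4p1 : ∀ (n : ℕ) → n ≥ 3 →
  cr (K n ⊗ C₄) ≤ (16 * (n / 2) * ((n ∸ 1) / 2) * ((n ∸ 2) / 2) * ((n ∸ 3) / 2)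
                   + n * (n ∸ 1) * (2 * n ∸ 5))
theorem4p1 n n≥3 with even-or-odd n
-- The two families start at n = 4 and n = 3; smaller values contradict the hypothesis.
... | inj₁ (suc (suc m) , refl) = Even.crossing-bound m
... | inj₂ (suc m , refl) = Odd.crossing-bound m
theorem4p1 n (s≤s (s≤s ())) | inj₁ (suc zero , refl)
theorem4p1 n (s≤s ()) | inj₂ (zero , refl)
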